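{- Let $q=(1+uy)/(1+y)$. For $n\ge1$ let $s_n(u,y)=\sum_D u^{\operatorname{des}(D)}y^{e(D)}$, the sum over all strongly connected digraphs $D$ on $[n]$, and let $S(x)=\sum_{n\ge1}s_n(u,y)\frac{x^n}{n!}$. Let \[D(x)=\sum_{n=0}^\infty (1+uy)^{\binom n2}\frac{x^n}{n!_q}.\] Let $\Delta$ be the linear map on formal power series in $x$ defined by \[\Delta\Bigl(\sum_{n\ge0}a_n\frac{x^n}{n!}\Bigr)=\sum_{n\ge0}a_n\frac{x^n}{n!_q\,(1+y)^{\binom n2}}.\] Then \[S(x)=-\log\bigl(\Delta^{ -1}(D(x)^{ -1})\bigr).\]
   Context: All series are formal power series in $x$ with coefficients in the field $\mathbb{Q}(u,y)$. A digraph on a finite set $V$ of integers is a set $E\subseteq V\times V$ of ordered pairs $(s,t)$ with $s\neq t$ (its edges); $e(D)$ is the number of edges. A descent is an edge $(s,t)$ with $s>t$; $\operatorname{des}(D)$ is the number of descents. A digraph is strongly connected if for every two vertices $a,b$ there is a directed path from $a$ to $b$ (the empty path allowed when $a=b$). The $q$-factorial is $n!_q=\prod_{k=1}^n(1+q+\cdots+q^{k-1})$. -}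

module Defs where

open import Data.Nat as ℕ using (ℕ; zero; suc; _∸_)
open import Data.Nat.Combinatorics using (_C_)
open import Data.Nat.Base using (_!)
open import Data.Integer using (+_)
open import Data.Rational as Q using (ℚ; 0ℚ; 1ℚ)
open import Data.Bool using (Bool; true; false; if_then_else_)
open import Data.Fin using (Fin; toℕ; _<?_)
open import Data.Vec using (Vec; lookup)
open import Data.List using (List; []; _∷_; map; allFin)
open import Data.Nat.ListAction using () renaming (sum to sumℕ)
open import Relation.Nullary using (does; ¬_)
open import Relation.Binary.PropositionalEquality using (_≡_)
open import Data.Product using (_×_)

sumToℚ : ℕ → (ℕ → ℚ) → ℚ
sumToℚ zero    f = f 0
sumToℚ (suc n) f = sumToℚ n f Q.+ f (suc n)

ℕtoℚ : ℕ → ℚ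
ℕtoℚ n = + n Q./ 1

-- P = ℚ[[u,y]] : f a b is the coefficient of u^a y^b.
-- (Every element we actually construct is a polynomial in u,y.)

P : Set
P = ℕ → ℕ → ℚ

constP : ℚ → P
constP c zero    zero    = c
constP c _       _       = 0ℚ

monoP : ℕ → ℕ → P
monoP i j a b = if (does (a ℕ.≟ i)) then (if does (b ℕ.≟ j) then 1ℚ else 0ℚ) else 0ℚ

_+P_ : P → P → P
(f +P g) a b = f a b Q.+ g a b

-P_ : P → P
(-P f) a b = Q.- f a b

_*P_ : P → P → P
(f *P g) a b = sumToℚ a (λ i → sumToℚ b (λ j → f i j Q.* g (a ∸ i) (b ∸ j)))

-- K = fractions num/den over P; this is where ℚ(u,y) lives.
-- Equality is the usual cross-multiplication relation.

record K : Set where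
  constructor _⁄_
  field
    num : P
    den : P
open K public

infix 4 _≈K_
_≈K_ : K → K → Set
x ≈K z = ∀ a b → (num x *P den z) a b ≡ (num z *P den x) a b

fromP : P → K
fromP p = p ⁄ constP 1ℚ

fromℚ : ℚ → K
fromℚ c = fromP (constP c)

0K 1K : K
0K = fromℚ 0ℚ
1K = fromℚ 1ℚ

uK yK : K
uK = fromP (monoP 1 0)
yK = fromP (monoP 0 1)

_+K_ : K → K → K
(p ⁄ q) +K (r ⁄ s) = ((p *P s) +P (r *P q)) ⁄ (q *P s)

_*K_ : K → K → K
(p ⁄ q) *K (r ⁄ s) = (p *P r) ⁄ (q *P s)

-K_ : K → K
-K (p ⁄ q) = (-P p) ⁄ q

-- multiplicative inverse (only applied to nonzero elements)
invK : K → K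
invK (p ⁄ q) = q ⁄ p

_/K_ : K → K → K
x /K z = x *K invK z

powK : K → ℕ → K
powK x zero    = 1K
powK x (suc n) = x *K powK x n

ℕtoK : ℕ → K
ℕtoK n = fromℚ (ℕtoℚ n)

sumToK : ℕ → (ℕ → K) → K
sumToK zero    f = f 0
sumToK (suc n) f = sumToK n f +K f (suc n)

sumBelowK : ℕ → (ℕ → K) → K
sumBelowK zero    f = 0K
sumBelowK (suc n) f = sumBelowK n f +K f n

prodK : ℕ → (ℕ → K) → K
prodK zero    f = 1K
prodK (suc n) f = prodK n f *K f (suc n)

qK : K
qK = (1K +K (uK *K yK)) /K (1K +K yK)

qIntK : ℕ → K
qIntK k = sumBelowK k (λ j → powK qK j)

qFactK : ℕ → K
qFactK n = prodK n qIntK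

-- Formal power series in x over K : f n is the coefficient of x^n.

Ser : Set
Ser = ℕ → K

_≈S_ : Ser → Ser → Set
f ≈S g = ∀ n → f n ≈K g n

_*S_ : Ser → Ser → Ser
(f *S g) n = sumToK n (λ i → f i *K g (n ∸ i))

powS : Ser → ℕ → Ser
powS f zero    zero    = 1K
powS f zero    (suc n) = 0K
powS f (suc k) = f *S powS f k

-S_ : Ser → Ser
(-S f) n = -K f n

minusOneS : Ser → Ser
minusOneS f zero    = f zero +K (-K 1K)
minusOneS f (suc n) = f (suc n)

-- multiplicative inverse of a series with invertible constant term a_0:
-- b_0 = 1/a_0,  b_n = -(1/a_0) Σ_{k=1}^{n} a_k b_{n-k}.
-- invRev f n is the list [b_n , b_{n-1} , ... , b_0].
module _ (f : Ser) where
  private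
    weighted : ℕ → List K → K
    weighted j []       = 0K
    weighted j (c ∷ cs) = (f (suc j) *K c) +K weighted (suc j) cs

  invRev : ℕ → List K
  invRev zero    = invK (f 0) ∷ []
  invRev (suc n) = (-K (invK (f 0) *K weighted 0 (invRev n))) ∷ invRev n

headK : List K → K
headK []      = 0K
headK (c ∷ _) = c

invS : Ser → Ser
invS f n = headK (invRev f n)

-- log f = Σ_{k≥1} (-1)^(k+1) (f-1)^k / k   (for f with constant term 1);
-- coefficient of x^n only involves k = 1 .. n.
logS : Ser → Ser
logS f n = sumBelowK n (λ k → (powK (-K 1K) k /K ℕtoK (suc k)) *K powS (minusOneS f) (suc k) n)

-- The operator Δ :  a_n x^n / n!  ↦  a_n x^n / (n!_q (1+y)^(n choose 2)).
-- On ordinary coefficients it multiplies the n-th coefficient by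
-- δ n = n! / (n!_q (1+y)^(n choose 2)); Δ⁻¹ divides by δ n.

δ : ℕ → K
δ n = ℕtoK (n !) /K (qFactK n *K powK (1K +K yK) (n C 2))

Δ : Ser → Ser
Δ f n = f n *K δ n

Δ⁻¹ : Ser → Ser
Δ⁻¹ f n = f n /K δ n

Dser : Ser
Dser n = powK (1K +K (uK *K yK)) (n C 2) /K qFactK n

-- Digraphs on the vertex set [n] (represented by Fin n; the shift
-- i ↦ i+1 preserves the order, hence descents).
-- A digraph is its adjacency matrix: edge s → t iff lookup (lookup D s) t ≡ true.

Digraph : ℕ → Set
Digraph n = Vec (Vec Bool n) n

module _ {n : ℕ} (D : Digraph n) where

  Edge : Fin n → Fin n → Set
  Edge s t = lookup (lookup D s) t ≡ true

  Loopless : Set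
  Loopless = ∀ s → ¬ Edge s s

  data Path : Fin n → Fin n → Set where
    [] : ∀ {a} → Path a a
    _∷_ : ∀ {a b c} → Edge a b → Path b c → Path a c

  StronglyConnected : Set
  StronglyConnected = ∀ a b → Path a b

  private
    count : (Fin n → Fin n → Bool) → ℕ
    count p = sumℕ (map (λ s → sumℕ (map (λ t →
                if p s t then 1 else 0) (allFin n))) (allFin n))

  edges : ℕ
  edges = count (λ s t → lookup (lookup D s) t)

  des : ℕ
  des = count (λ s t → if does (t <? s) then lookup (lookup D s) t else false)

weightK : ∀ {n} → Digraph n → K
weightK D = fromP (monoP (des D) (edges D))

sumWeights : ∀ {n} → List (Digraph n) → K
sumWeights []       = 0K
sumWeights (D ∷ Ds) = weightK D +K sumWeights Ds

{-# OPTIONS --safe #-}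

-- Write a = 1 + y and b = 1 + uy. Every element of K in the statement has an invertible denominator in
-- ℚ⟦u,y⟧, so the identity can be proved in that ring. There exp(-S) has coefficients tₙ/n!, where tₙ is the
-- sum of (-1)ᶜ u^des y^e over the digraphs on [n] that are disjoint unions of c strong digraphs; this is the
-- recursion coming from (exp(-S))′ = -S′ exp(-S). The q-binomial coefficient times a^(k(n-k)) is the sum,
-- over the k-subsets A of [n] and the sets X of edges from A to its complement, of the weight of X. Hence
-- the n-th coefficient of Δ(exp(-S)) D is, up to a unit, the sum of (-1)ᶜ u^des y^e over all digraphs on [n]
-- with a vertex set A that no edge enters from outside and that induces a disjoint union of c strong
-- digraphs. Such an A is a set of source components. A nonempty digraph has a source component, so the
-- signs cancel for n ≥ 1, and Δ(exp(-S)) = 1/D.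

module Submission where

open import Defs
open import Algebra.Bundles using (CommutativeRing)
open import Data.Bool using (Bool; true; false; if_then_else_)
import Data.Bool.Properties as Bool
open import Data.Empty using (⊥)
open import Data.Fin as Fin using (Fin; zero; suc; toℕ)
import Data.Fin.Properties as Fin
open import Data.Integer as ℤ using (+_)
import Data.Integer.Properties as ℤ
open import Data.List as List
  using (List; []; _∷_; _++_; length; map; filter; cartesianProduct; allFin; tabulate; lookup)
import Data.List.Properties as List
open import Data.List.Membership.Propositional using (_∈_; _∉_)
open import Data.List.Membership.Propositional.Properties
  using (∈-filter⁻; ∈-cartesianProduct⁺; ∈-cartesianProduct⁻; ∈-allFin; ∈-map⁺; ∈-map⁻; ∈-lookup)
open import Data.List.Relation.Binary.Permutation.Propositional as Perm using (_↭_; ↭-trans; ↭-refl)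
import Data.List.Relation.Binary.Permutation.Propositional.Properties as Perm
import Data.List.Relation.Binary.Pointwise as Pointwise
open import Data.List.Relation.Ternary.Interleaving.Propositional as Interleaving
  using (Interleaving; []; consˡ; consʳ)
open import Data.List.Relation.Ternary.Interleaving.Properties using (interleave-length)
open import Data.List.Relation.Unary.All as All using (All; []; _∷_)
open import Data.List.Relation.Unary.AllPairs as AllPairs using (AllPairs; []; _∷_)
import Data.List.Relation.Unary.AllPairs.Properties as AllPairs
open import Data.List.Relation.Unary.Any using (here; there)
open import Data.List.Relation.Unary.Unique.Propositional using (Unique)
import Data.List.Relation.Unary.Unique.Propositional.Properties as Unique
open import Data.Nat as ℕ using (ℕ; zero; suc; _≤_; _<_; s≤s)
open import Data.Nat.Base using (_!)
open import Data.Nat.Combinatorics using (nC1≡n; nCk+nC[k+1]≡[n+1]C[k+1]) renaming (_C_ to _choose_)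
open import Data.Nat.ListAction using () renaming (sum to sumℕ)
import Data.Nat.Properties as ℕ
open import Data.Product using (_×_; _,_; proj₁; proj₂; ∃-syntax)
open import Data.Product.Properties using () renaming (≡-dec to ×-≡-dec)
open import Data.Rational as ℚ using (ℚ; 0ℚ; 1ℚ)
import Data.Rational.Properties as ℚ
import Data.Rational.Unnormalised as ℚᵘ
import Data.Rational.Unnormalised.Properties as ℚᵘ
open import Data.Sum using (_⊎_; inj₁; inj₂; [_,_]′)
open import Data.Unit using (⊤; tt)
import Data.Vec as Vec
import Data.Vec.Properties as Vec
open import Function.Bundles using (_⇔_; Equivalence)
open import Level using (0ℓ)
open import Relation.Binary.Definitions using (DecidableEquality; tri<; tri≈; tri>)
open import Relation.Binary.PropositionalEquality as ≡ using (_≡_; _≢_)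
open import Relation.Nullary using (Dec; yes; no; does; ¬_; contradiction)
open import Relation.Nullary.Decidable using (_×-dec_; _⊎-dec_; ¬?; map′; dec-true; dec-false)
open import Relation.Unary using (Decidable)

-- `K` admits every denominator, even 0, so `≈K` is not transitive and algebra inside `K` is unsafe.
-- The combinatorics is therefore done over an arbitrary commutative ring with weights `asc` and
-- `desc`, and a fraction meets it only through `x ∼ p`, which demands a unit as denominator. As the
-- ring is no field, identities stay free of division for as long as possible: q-integers are
-- homogenised to polynomials in a and b, and q-binomial coefficients appear as sums over subsets.
-- The same development at a = b = 1 gives the ordinary binomial sums of exponential series. The
-- exponential of -S is never formed; its differential equation takes its place. The cancellation of
-- signs does not enumerate source components. It fixes one vertex v and shows that the signed sum
-- is (1 - N) η, where η collects the sets without v and N counts the source components that contain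
-- v.

-- Commutative rings: units, finite sums and antidiagonal sums.

module RingTools (R : CommutativeRing 0ℓ 0ℓ) where
  open CommutativeRing R public
  open import Relation.Binary.Reasoning.Setoid setoid public
  open import Algebra.Properties.Ring ring public
    using (-‿distribˡ-*; -‿distribʳ-*; -1*x≈-x)
  open import Algebra.Properties.AbelianGroup +-abelianGroup public
    using () renaming (⁻¹-∙-comm to -‿+-comm; ⁻¹-involutive to -‿involutive;
      ε⁻¹≈ε to -0#≈0#; inverseˡ-unique to -‿uniqueˡ)
  open import Algebra.Properties.CommutativeSemiring.Exp commutativeSemiring public
    using (_^_; ^-congˡ; ^-homo-*; ^-distrib-*)
  open import Algebra.Solver.Ring.NaturalCoefficients.Default commutativeSemiring public
    using (solve; _:=_; _:+_; _:*_)

  fromℕ : ℕ → Carrier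
  fromℕ zero    = 0#
  fromℕ (suc n) = 1# + fromℕ n

  fromℕ-+ : ∀ m n → fromℕ (m ℕ.+ n) ≈ fromℕ m + fromℕ n
  fromℕ-+ zero    n = sym (+-identityˡ _)
  fromℕ-+ (suc m) n = trans (+-congˡ (fromℕ-+ m n)) (sym (+-assoc _ _ _))

  IsUnit : Carrier → Set
  IsUnit x = ∃[ y ] x * y ≈ 1#

  IsUnit-* : ∀ {x y} → IsUnit x → IsUnit y → IsUnit (x * y)
  IsUnit-* {x} {y} (x′ , p) (y′ , q) = x′ * y′ , (begin
    (x * y) * (x′ * y′)  ≈⟨ solve 4 (λ a b c d → (a :* b) :* (c :* d) := (a :* c) :* (b :* d)) refl x y x′ y′ ⟩
    (x * x′) * (y * y′)  ≈⟨ *-cong p q ⟩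
    1# * 1#              ≈⟨ *-identityˡ 1# ⟩
    1#                   ∎)

  IsUnit-resp : ∀ {x y} → x ≈ y → IsUnit x → IsUnit y
  IsUnit-resp eq (x′ , p) = x′ , trans (*-congʳ (sym eq)) p

  IsUnit-cancelˡ : ∀ {x} y z → IsUnit x → x * y ≈ x * z → y ≈ z
  IsUnit-cancelˡ {x} y z (x′ , p) eq = begin
    y             ≈⟨ sym (*-identityˡ y) ⟩
    1# * y        ≈⟨ *-congʳ (trans (sym p) (*-comm x x′)) ⟩
    (x′ * x) * y  ≈⟨ *-assoc x′ x y ⟩
    x′ * (x * y)  ≈⟨ *-congˡ eq ⟩
    x′ * (x * z)  ≈⟨ *-assoc x′ x z ⟨
    (x′ * x) * z  ≈⟨ *-congʳ (trans (*-comm x′ x) p) ⟩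
    1# * z        ≈⟨ *-identityˡ z ⟩
    z             ∎

  +-interchange : ∀ a b c d → (a + b) + (c + d) ≈ (a + c) + (b + d)
  +-interchange = solve 4 (λ a b c d → (a :+ b) :+ (c :+ d) := (a :+ c) :+ (b :+ d)) refl

  sumTo : ℕ → (ℕ → Carrier) → Carrier
  sumTo zero    f = f 0
  sumTo (suc n) f = sumTo n f + f (suc n)

  sumBelow : ℕ → (ℕ → Carrier) → Carrier
  sumBelow zero    f = 0#
  sumBelow (suc n) f = sumBelow n f + f n

  sumBelow-cong : ∀ n {f g : ℕ → Carrier} → (∀ i → i < n → f i ≈ g i) → sumBelow n f ≈ sumBelow n g
  sumBelow-cong zero    eq = refl
  sumBelow-cong (suc n) eq = +-cong (sumBelow-cong n λ i i<n → eq i (ℕ.m<n⇒m<1+n i<n)) (eq n ℕ.≤-refl)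

  sumBelow-truncate : ∀ {f : ℕ → Carrier} {n N} → n ≤ N → (∀ i → n ≤ i → f i ≈ 0#) → sumBelow N f ≈ sumBelow n f
  sumBelow-truncate {f} {n} n≤N vanish with ℕ.≤⇒≤′ n≤N
  ... | ℕ.≤′-reflexive ≡.refl = refl
  ... | ℕ.≤′-step {N} n≤′N = begin
    sumBelow N f + f N  ≈⟨ +-cong (sumBelow-truncate (ℕ.≤′⇒≤ n≤′N) vanish) (vanish N (ℕ.≤′⇒≤ n≤′N)) ⟩
    sumBelow n f + 0#   ≈⟨ +-identityʳ _ ⟩
    sumBelow n f        ∎

  sumBelow-*ˡ : ∀ n c f → c * sumBelow n f ≈ sumBelow n (λ i → c * f i)
  sumBelow-*ˡ zero    c f = zeroʳ c
  sumBelow-*ˡ (suc n) c f = trans (distribˡ c _ _) (+-congʳ (sumBelow-*ˡ n c f))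

  -- The factor 1 + z is written with z, not - z, so that it matches 1 + (f - 1) in log f.
  geometric-sum : ∀ z N → (1# + z) * sumBelow N (λ k → (- z) ^ k) ≈ 1# + - ((- z) ^ N)
  geometric-sum z zero = trans (zeroʳ _) (sym (-‿inverseʳ 1#))
  geometric-sum z (suc N) = begin
    (1# + z) * (G + w)             ≈⟨ distribˡ _ G w ⟩
    (1# + z) * G + (1# + z) * w    ≈⟨ +-cong (geometric-sum z N) (trans (distribʳ w 1# z) (+-congʳ (*-identityˡ w))) ⟩
    (1# + - w) + (w + z * w)       ≈⟨ solve 4 (λ a b c d → (a :+ b) :+ (c :+ d) := a :+ ((c :+ b) :+ d)) refl 1# (- w) w (z * w) ⟩
    1# + ((w + - w) + z * w)       ≈⟨ +-congˡ (trans (+-congʳ (-‿inverseʳ w)) (+-identityˡ _)) ⟩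
    1# + z * w                     ≈⟨ +-congˡ (sym (-‿involutive _)) ⟩
    1# + - (- (z * w))             ≈⟨ +-congˡ (-‿cong (-‿distribˡ-* z w)) ⟩
    1# + - ((- z) * w)             ∎
    where
    G = sumBelow N (λ k → (- z) ^ k)
    w = (- z) ^ N

  -- The sum over i + j = n is peeled from the left, so that no truncated subtraction enters the
  -- algebra; `sumTo-conv` links it to the form used by the products in the statement.
  conv : ℕ → (ℕ → ℕ → Carrier) → Carrier
  conv zero    h = h 0 0
  conv (suc n) h = h 0 (suc n) + conv n (λ i j → h (suc i) j)

  conv-cong : ∀ n {h k : ℕ → ℕ → Carrier} → (∀ i j → i ℕ.+ j ≡ n → h i j ≈ k i j) → conv n h ≈ conv n k
  conv-cong zero    eq = eq 0 0 ≡.refl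
  conv-cong (suc n) eq = +-cong (eq 0 (suc n) ≡.refl) (conv-cong n λ i j p → eq (suc i) j (≡.cong suc p))

  conv-0 : ∀ n → conv n (λ _ _ → 0#) ≈ 0#
  conv-0 zero    = refl
  conv-0 (suc n) = trans (+-identityˡ _) (conv-0 n)

  conv-+ : ∀ n h k → conv n (λ i j → h i j + k i j) ≈ conv n h + conv n k
  conv-+ zero    h k = refl
  conv-+ (suc n) h k = trans (+-congˡ (conv-+ n _ _)) (+-interchange _ _ _ _)

  conv-neg : ∀ n h → conv n (λ i j → - h i j) ≈ - conv n h
  conv-neg zero    h = refl
  conv-neg (suc n) h = trans (+-congˡ (conv-neg n _)) (-‿+-comm _ _)

  conv-*ˡ : ∀ n c h → c * conv n h ≈ conv n (λ i j → c * h i j)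
  conv-*ˡ zero    c h = refl
  conv-*ˡ (suc n) c h = trans (distribˡ c _ _) (+-congˡ (conv-*ˡ n c _))

  conv-*ʳ : ∀ n c h → conv n h * c ≈ conv n (λ i j → h i j * c)
  conv-*ʳ zero    c h = refl
  conv-*ʳ (suc n) c h = trans (distribʳ c _ _) (+-congˡ (conv-*ʳ n c _))

  conv-last : ∀ n h → conv (suc n) h ≈ conv n (λ i j → h i (suc j)) + h (suc n) 0
  conv-last zero    h = refl
  conv-last (suc n) h = trans (+-congˡ (conv-last n (λ i j → h (suc i) j))) (sym (+-assoc _ _ _))

  conv-flip : ∀ n h → conv n h ≈ conv n (λ i j → h j i)
  conv-flip zero    h = refl
  conv-flip (suc n) h = begin
    h 0 (suc n) + conv n (λ i j → h (suc i) j)  ≈⟨ +-comm _ _ ⟩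
    conv n (λ i j → h (suc i) j) + h 0 (suc n)  ≈⟨ +-congʳ (conv-flip n _) ⟩
    conv n (λ i j → h (suc j) i) + h 0 (suc n)  ≈⟨ conv-last n (λ i j → h j i) ⟨
    conv (suc n) (λ i j → h j i)                ∎

  -- Both sides run over the triples with sum n. A function of three indices, rather than a product,
  -- lets the induction shift the first index.
  conv-assoc : ∀ n (h : ℕ → ℕ → ℕ → Carrier) →
    conv n (λ m l → conv m (λ i j → h i j l)) ≈ conv n (λ i m → conv m (λ j l → h i j l))
  conv-assoc zero    h = refl
  conv-assoc (suc n) h = begin
    h 0 0 (suc n) + conv n (λ m l → h 0 (suc m) l + conv m (λ i j → h (suc i) j l))
      ≈⟨ +-congˡ (conv-+ n _ _) ⟩
    h 0 0 (suc n) + (conv n (λ m l → h 0 (suc m) l) + conv n (λ m l → conv m (λ i j → h (suc i) j l)))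
      ≈⟨ +-assoc _ _ _ ⟨
    conv (suc n) (h 0) + conv n (λ m l → conv m (λ i j → h (suc i) j l))
      ≈⟨ +-congˡ (conv-assoc n _) ⟩
    conv (suc n) (h 0) + conv n (λ i m → conv m (λ j l → h (suc i) j l)) ∎

  sumTo-suc : ∀ n f → sumTo (suc n) f ≈ f 0 + sumTo n (λ i → f (suc i))
  sumTo-suc zero    f = refl
  sumTo-suc (suc n) f = trans (+-congʳ (sumTo-suc n f)) (+-assoc _ _ _)

  sumTo-conv : ∀ n h → sumTo n (λ i → h i (n ℕ.∸ i)) ≈ conv n h
  sumTo-conv zero    h = refl
  sumTo-conv (suc n) h = trans (sumTo-suc n _) (+-congˡ (sumTo-conv n (λ i j → h (suc i) j)))

-- Formal power series: inverses, derivative and logarithm.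

module PowerSeries (R : CommutativeRing 0ℓ 0ℓ) where
  open RingTools R

  constant : Carrier → ℕ → Carrier
  constant c zero    = c
  constant c (suc _) = 0#

  conv-constantˡ : ∀ n c (f : ℕ → Carrier) → conv n (λ i j → constant c i * f j) ≈ c * f n
  conv-constantˡ zero    c f = refl
  conv-constantˡ (suc n) c f = begin
    c * f (suc n) + conv n (λ _ j → 0# * f j)  ≈⟨ +-congˡ (conv-cong n λ _ _ _ → zeroˡ _) ⟩
    c * f (suc n) + conv n (λ _ _ → 0#)        ≈⟨ +-congˡ (conv-0 n) ⟩
    c * f (suc n) + 0#                         ≈⟨ +-identityʳ _ ⟩
    c * f (suc n)                              ∎

  infixl 7 _⊛_
  _⊛_ : (ℕ → Carrier) → (ℕ → Carrier) → ℕ → Carrier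
  (f ⊛ g) n = conv n (λ i j → f i * g j)

  ⊛-comm : ∀ f g n → (f ⊛ g) n ≈ (g ⊛ f) n
  ⊛-comm f g n = trans (conv-flip n _) (conv-cong n λ _ _ _ → *-comm _ _)

  ⊛-assoc : ∀ f g h n → ((f ⊛ g) ⊛ h) n ≈ (f ⊛ (g ⊛ h)) n
  ⊛-assoc f g h n = begin
    conv n (λ m l → (f ⊛ g) m * h l)                       ≈⟨ conv-cong n (λ m l _ → conv-*ʳ m (h l) _) ⟩
    conv n (λ m l → conv m (λ i j → (f i * g j) * h l))    ≈⟨ conv-assoc n _ ⟩
    conv n (λ i m → conv m (λ j l → (f i * g j) * h l))    ≈⟨ conv-cong n (λ i m _ → conv-cong m λ j l _ → *-assoc _ _ _) ⟩
    conv n (λ i m → conv m (λ j l → f i * (g j * h l)))    ≈⟨ conv-cong n (λ i m _ → conv-*ˡ m (f i) _) ⟨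
    conv n (λ i m → f i * (g ⊛ h) m)                       ∎

  ⊛-identityˡ : ∀ f n → (constant 1# ⊛ f) n ≈ f n
  ⊛-identityˡ f n = trans (conv-constantˡ n 1# f) (*-identityˡ _)

  ⊛-distribˡ : ∀ f g h n → (f ⊛ (λ m → g m + h m)) n ≈ (f ⊛ g) n + (f ⊛ h) n
  ⊛-distribˡ f g h n = trans (conv-cong n λ _ _ _ → distribˡ _ _ _) (conv-+ n _ _)

  ring-PS : CommutativeRing 0ℓ 0ℓ
  ring-PS = record
    { Carrier = ℕ → Carrier
    ; _≈_     = λ f g → ∀ n → f n ≈ g n
    ; _+_     = λ f g n → f n + g n
    ; _*_     = _⊛_
    ; -_      = λ f n → - f n
    ; 0#      = λ _ → 0#
    ; 1#      = constant 1#
    ; isCommutativeRing = record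
      { isRing = record
        { +-isAbelianGroup = record
          { isGroup = record
            { isMonoid = record
              { isSemigroup = record
                { isMagma = record
                  { isEquivalence = record
                    { refl  = λ _ → refl
                    ; sym   = λ p n → sym (p n)
                    ; trans = λ p q n → trans (p n) (q n)
                    }
                  ; ∙-cong = λ p q n → +-cong (p n) (q n)
                  }
                ; assoc = λ f g h n → +-assoc _ _ _
                }
              ; identity = (λ f n → +-identityˡ _) , (λ f n → +-identityʳ _)
              }
            ; inverse = (λ f n → -‿inverseˡ _) , (λ f n → -‿inverseʳ _)
            ; ⁻¹-cong = λ p n → -‿cong (p n)
            }
          ; comm = λ f g n → +-comm _ _
          }
        ; *-cong     = λ p q n → conv-cong n λ i j _ → *-cong (p i) (q j)
        ; *-assoc    = ⊛-assoc
        ; *-identity = ⊛-identityˡ , λ f n → trans (⊛-comm f _ n) (⊛-identityˡ f n)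
        ; distrib    = ⊛-distribˡ , λ f g h n →
            trans (⊛-comm _ f n) (trans (⊛-distribˡ f g h n) (+-cong (⊛-comm f g n) (⊛-comm f h n)))
        }
      ; *-comm = ⊛-comm
      }
    }

  X : ℕ → Carrier
  X zero    = 0#
  X (suc n) = constant 1# n

  X-⊛-zero : ∀ f → (X ⊛ f) 0 ≈ 0#
  X-⊛-zero f = zeroˡ _

  X-⊛-suc : ∀ f n → (X ⊛ f) (suc n) ≈ f n
  X-⊛-suc f n = trans (+-cong (zeroˡ _) (conv-constantˡ n 1# f)) (trans (+-identityˡ _) (*-identityˡ _))

  module S = RingTools ring-PS

  VanishesBelow : ℕ → (ℕ → Carrier) → Set
  VanishesBelow k f = ∀ n → n < k → f n ≈ 0#

  ⊛-vanishes : ∀ {z f k} → z 0 ≈ 0# → VanishesBelow k f → VanishesBelow (suc k) (z ⊛ f)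
  ⊛-vanishes {z} {f} z₀ f-vanishes zero    _         = trans (*-congʳ z₀) (zeroˡ _)
  ⊛-vanishes {z} {f} z₀ f-vanishes (suc n) (s≤s n<k) = begin
    z 0 * f (suc n) + conv n (λ i j → z (suc i) * f j)
      ≈⟨ +-cong (trans (*-congʳ z₀) (zeroˡ _)) (conv-cong n λ i j i+j≡n →
           trans (*-congˡ (f-vanishes j (ℕ.≤-<-trans (ℕ.m+n≤o⇒n≤o i (ℕ.≤-reflexive i+j≡n)) n<k))) (zeroʳ _)) ⟩
    0# + conv n (λ _ _ → 0#)  ≈⟨ trans (+-identityˡ _) (conv-0 n) ⟩
    0#                        ∎

  pow-vanishes : ∀ {z} → z 0 ≈ 0# → ∀ k → VanishesBelow k (z S.^ k)
  pow-vanishes z₀ (suc k) = ⊛-vanishes z₀ (pow-vanishes z₀ k)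

  sumBelow-coeff : ∀ N (f : ℕ → ℕ → Carrier) n → S.sumBelow N f n ≡ sumBelow N (λ k → f k n)
  sumBelow-coeff zero    f n = ≡.refl
  sumBelow-coeff (suc N) f n = ≡.cong (_+ f N n) (sumBelow-coeff N f n)

  sumBelow-stable : ∀ (f : ℕ → ℕ → Carrier) {n m N} → m ≤ N → (∀ k → m ≤ k → f k n ≈ 0#) →
    S.sumBelow N f n ≈ sumBelow m (λ k → f k n)
  sumBelow-stable f {n} {m} {N} m≤N vanish =
    trans (reflexive (sumBelow-coeff N f n)) (sumBelow-truncate m≤N vanish)

  -- The infinite geometric sum is formed coefficientwise: powers of z beyond the j-th vanish at j,
  -- so `G j` may stop there, and for a given n all the `G j` involved come from one partial sum.
  geometric-inverse : ∀ z → z 0 ≈ 0# → S.IsUnit (S.1# S.+ z)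
  geometric-inverse z z₀ = G , λ n → begin
    conv n (λ i j → (S.1# S.+ z) i * G j)
      ≈⟨ conv-cong n (λ i j i+j≡n → *-congˡ (G-stable (s≤s (ℕ.m+n≤o⇒n≤o i (ℕ.≤-reflexive i+j≡n))))) ⟩
    ((S.1# S.+ z) S.* S.sumBelow (suc n) (λ k → (S.- z) S.^ k)) n
      ≈⟨ S.geometric-sum z (suc n) n ⟩
    S.1# n + - ((S.- z) S.^ suc n) n
      ≈⟨ +-congˡ (trans (-‿cong (pow-vanishes -z₀ (suc n) n ℕ.≤-refl)) -0#≈0#) ⟩
    S.1# n + 0#
      ≈⟨ +-identityʳ _ ⟩
    S.1# n ∎
    where
    -z₀ : (S.- z) 0 ≈ 0#
    -z₀ = trans (-‿cong z₀) -0#≈0#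
    G : ℕ → Carrier
    G j = sumBelow (suc j) (λ k → ((S.- z) S.^ k) j)
    G-stable : ∀ {j N} → suc j ≤ N → G j ≈ S.sumBelow N (λ k → (S.- z) S.^ k) j
    G-stable {j} j<N = sym (sumBelow-stable (λ k → (S.- z) S.^ k) j<N λ k j<k → pow-vanishes -z₀ k j j<k)

  -- Multiplication by the inverse of the constant term gives a series 1 + z with z vanishing at 0.
  unit-series : ∀ f → IsUnit (f 0) → S.IsUnit f
  unit-series f (c , f₀c≈1) with geometric-inverse z z₀
    where
    z : ℕ → Carrier
    z = (f S.* constant c) S.+ (S.- S.1#)
    z₀ : z 0 ≈ 0#
    z₀ = trans (+-congʳ f₀c≈1) (-‿inverseʳ 1#)
  ... | g , p = constant c S.* g , S.trans (S.sym (S.*-assoc _ _ _)) (S.trans (S.*-congʳ eq) p)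
    where
    eq : (f S.* constant c) S.≈ (S.1# S.+ ((f S.* constant c) S.+ (S.- S.1#)))
    eq = S.sym (S.trans (S.+-congˡ (S.+-comm _ _)) (S.trans (S.sym (S.+-assoc _ _ _))
      (S.trans (S.+-congʳ (S.-‿inverseʳ S.1#)) (S.+-identityˡ _))))

  ∂ : (ℕ → Carrier) → ℕ → Carrier
  ∂ f n = fromℕ (suc n) * f (suc n)

  -- The factor i + j in front of `f i * g j` splits in two. The terms i = 0 of the first sum and j
  -- = 0 of the second vanish, which realigns the indices.
  ∂-⊛ : ∀ f g → ∂ (f ⊛ g) S.≈ ((∂ f ⊛ g) S.+ (f ⊛ ∂ g))
  ∂-⊛ f g n = begin
    fromℕ (suc n) * conv (suc n) (λ i j → f i * g j)
      ≈⟨ conv-*ˡ (suc n) _ (λ i j → f i * g j) ⟩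
    conv (suc n) (λ i j → fromℕ (suc n) * (f i * g j))
      ≈⟨ conv-cong (suc n) (λ i j i+j≡n → trans (*-congʳ (trans (reflexive (≡.cong fromℕ (≡.sym i+j≡n))) (fromℕ-+ i j)))
           (solve 4 (λ a b c d → (a :+ b) :* (c :* d) := (a :* c) :* d :+ c :* (b :* d)) refl (fromℕ i) (fromℕ j) (f i) (g j))) ⟩
    conv (suc n) (λ i j → (fromℕ i * f i) * g j + f i * (fromℕ j * g j))
      ≈⟨ conv-+ (suc n) (λ i j → (fromℕ i * f i) * g j) (λ i j → f i * (fromℕ j * g j)) ⟩
    conv (suc n) (λ i j → (fromℕ i * f i) * g j) + conv (suc n) (λ i j → f i * (fromℕ j * g j))
      ≈⟨ +-cong (trans (+-congʳ (trans (*-congʳ (zeroˡ _)) (zeroˡ _))) (+-identityˡ _))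
           (trans (conv-last n (λ i j → f i * (fromℕ j * g j))) (trans (+-congˡ (trans (*-congˡ (zeroˡ _)) (zeroʳ _))) (+-identityʳ _))) ⟩
    (∂ f ⊛ g) n + (f ⊛ ∂ g) n ∎

  ∂-pow : ∀ z k → ∂ (z S.^ suc k) S.≈ (S.fromℕ (suc k) S.* ((z S.^ k) S.* ∂ z))
  ∂-pow z zero n = begin
    fromℕ (suc n) * (z ⊛ S.1#) (suc n)      ≈⟨ *-congˡ (S.*-identityʳ z (suc n)) ⟩
    ∂ z n                                   ≈⟨ S.*-identityˡ _ n ⟨
    (S.1# S.* ∂ z) n                        ≈⟨ S.*-identityˡ _ n ⟨
    (S.1# S.* (S.1# S.* ∂ z)) n             ≈⟨ S.*-congʳ (S.+-identityʳ S.1#) n ⟨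
    (S.fromℕ 1 S.* (S.1# S.* ∂ z)) n ∎
  ∂-pow z (suc k) = S.begin
    ∂ (z S.* (z S.^ suc k))
      S.≈⟨ ∂-⊛ z (z S.^ suc k) ⟩
    (∂ z S.* (z S.^ suc k)) S.+ (z S.* ∂ (z S.^ suc k))
      S.≈⟨ S.+-congˡ (S.*-congˡ (∂-pow z k)) ⟩
    (∂ z S.* (z S.* (z S.^ k))) S.+ (z S.* (S.fromℕ (suc k) S.* ((z S.^ k) S.* ∂ z)))
      S.≈⟨ S.solve 5 (λ d x p m o → d S.:* (x S.:* p) S.:+ x S.:* ((o S.:+ m) S.:* (p S.:* d)) S.:=
              x S.:* p S.:* d S.:+ (o S.:+ m) S.:* (x S.:* p S.:* d)) S.refl (∂ z) z (z S.^ k) (S.fromℕ k) S.1# ⟩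
    ((z S.^ suc k) S.* ∂ z) S.+ (S.fromℕ (suc k) S.* ((z S.^ suc k) S.* ∂ z))
      S.≈⟨ S.+-congʳ (S.*-identityˡ _) ⟨
    (S.1# S.* ((z S.^ suc k) S.* ∂ z)) S.+ (S.fromℕ (suc k) S.* ((z S.^ suc k) S.* ∂ z))
      S.≈⟨ S.distribʳ _ _ _ ⟨
    S.fromℕ (suc (suc k)) S.* ((z S.^ suc k) S.* ∂ z) S.∎

  ∂-sumBelow : ∀ N f → ∂ (S.sumBelow N f) S.≈ S.sumBelow N (λ k → ∂ (f k))
  ∂-sumBelow zero    f n = zeroʳ _
  ∂-sumBelow (suc N) f n = trans (distribˡ _ _ _) (+-congʳ (∂-sumBelow N f n))

  ∂-constant-⊛ : ∀ c f → ∂ (constant c ⊛ f) S.≈ (constant c ⊛ ∂ f)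
  ∂-constant-⊛ c f n = begin
    fromℕ (suc n) * (constant c ⊛ f) (suc n)  ≈⟨ *-congˡ (conv-constantˡ (suc n) c f) ⟩
    fromℕ (suc n) * (c * f (suc n))           ≈⟨ solve 3 (λ a b d → a :* (b :* d) := b :* (a :* d)) refl _ _ _ ⟩
    c * ∂ f n                                 ≈⟨ conv-constantˡ n c (∂ f) ⟨
    (constant c ⊛ ∂ f) n                      ∎

  fromℕ-constant : ∀ k → S.fromℕ k S.≈ constant (fromℕ k)
  fromℕ-constant zero    zero    = refl
  fromℕ-constant zero    (suc n) = refl
  fromℕ-constant (suc k) zero    = +-congˡ (fromℕ-constant k 0)
  fromℕ-constant (suc k) (suc n) = trans (+-identityˡ _) (fromℕ-constant k (suc n))

  constant-⊛-constant : ∀ c d → (constant c ⊛ constant d) S.≈ constant (c * d)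
  constant-⊛-constant c d zero    = refl
  constant-⊛-constant c d (suc n) = trans (conv-constantˡ (suc n) c _) (zeroʳ _)

  constant-cong : ∀ {c d} → c ≈ d → constant c S.≈ constant d
  constant-cong eq zero    = eq
  constant-cong eq (suc n) = refl

  constant-neg-⊛ : ∀ f → (constant (- 1#) ⊛ f) S.≈ (S.- f)
  constant-neg-⊛ f n = trans (conv-constantˡ n _ f) (-1*x≈-x _)

  pow-neg : ∀ z k → ((S.- z) S.^ k) S.≈ (constant ((- 1#) ^ k) S.* (z S.^ k))
  pow-neg z zero    = S.sym (S.*-identityˡ _)
  pow-neg z (suc k) = S.begin
    (S.- z) S.* ((S.- z) S.^ k)
      S.≈⟨ S.*-cong (S.sym (constant-neg-⊛ z)) (pow-neg z k) ⟩
    (constant (- 1#) S.* z) S.* (constant ((- 1#) ^ k) S.* (z S.^ k))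
      S.≈⟨ S.solve 4 (λ a b c d → (a S.:* b) S.:* (c S.:* d) S.:= (a S.:* c) S.:* (b S.:* d)) S.refl _ _ _ _ ⟩
    (constant (- 1#) S.* constant ((- 1#) ^ k)) S.* (z S.* (z S.^ k))
      S.≈⟨ S.*-congʳ (constant-⊛-constant _ _) ⟩
    constant ((- 1#) ^ suc k) S.* (z S.^ suc k) S.∎

  module Logarithm (z : ℕ → Carrier) (z₀ : z 0 ≈ 0#)
    (inv : ℕ → Carrier) (inv-correct : ∀ k → fromℕ (suc k) * inv k ≈ 1#) where

    c : ℕ → Carrier
    c k = (- 1#) ^ k * inv k

    log1+ : ℕ → Carrier
    log1+ n = sumBelow n (λ k → c k * (z S.^ suc k) n)

    partial : ℕ → ℕ → Carrier
    partial N = S.sumBelow N (λ k → constant (c k) S.* (z S.^ suc k))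

    -- `log1+`, like `logS`, cuts the series at a length that varies with the coefficient. A cut of
    -- fixed length is a single finite sum of series and can be differentiated termwise.
    log1+-partial : ∀ {n N} → n ≤ N → log1+ n ≈ partial N n
    log1+-partial {n} {N} n≤N = begin
      sumBelow n (λ k → c k * (z S.^ suc k) n)
        ≈⟨ sumBelow-cong n (λ k _ → sym (conv-constantˡ n (c k) (z S.^ suc k))) ⟩
      sumBelow n (λ k → (constant (c k) S.* (z S.^ suc k)) n)
        ≈⟨ sumBelow-stable (λ k → constant (c k) S.* (z S.^ suc k)) n≤N (λ k n≤k →
             trans (conv-constantˡ n (c k) (z S.^ suc k)) (trans (*-congˡ (pow-vanishes z₀ (suc k) n (s≤s n≤k))) (zeroʳ _))) ⟨
      partial N n ∎

    -- The factor k + 1 from the derivative of the power cancels `inv k`, and a geometric sum in -z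
    -- remains.
    ∂-partial : ∀ N → ∂ (partial N) S.≈ (S.sumBelow N (λ k → (S.- z) S.^ k) S.* ∂ z)
    ∂-partial N = S.begin
      ∂ (partial N)
        S.≈⟨ ∂-sumBelow N _ ⟩
      S.sumBelow N (λ k → ∂ (constant (c k) S.* (z S.^ suc k)))
        S.≈⟨ S.sumBelow-cong N (λ k _ → term k) ⟩
      S.sumBelow N (λ k → ∂ z S.* ((S.- z) S.^ k))
        S.≈⟨ S.sumBelow-*ˡ N (∂ z) _ ⟨
      ∂ z S.* S.sumBelow N (λ k → (S.- z) S.^ k)
        S.≈⟨ S.*-comm _ _ ⟩
      S.sumBelow N (λ k → (S.- z) S.^ k) S.* ∂ z S.∎
      where
      coefficient : ∀ k → fromℕ (suc k) * c k ≈ (- 1#) ^ k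
      coefficient k = begin
        fromℕ (suc k) * ((- 1#) ^ k * inv k)  ≈⟨ solve 3 (λ a b d → a :* (b :* d) := b :* (a :* d)) refl _ _ _ ⟩
        (- 1#) ^ k * (fromℕ (suc k) * inv k)  ≈⟨ *-congˡ (inv-correct k) ⟩
        (- 1#) ^ k * 1#                       ≈⟨ *-identityʳ _ ⟩
        (- 1#) ^ k                            ∎
      term : ∀ k → ∂ (constant (c k) S.* (z S.^ suc k)) S.≈ (∂ z S.* ((S.- z) S.^ k))
      term k = S.begin
        ∂ (constant (c k) S.* (z S.^ suc k))
          S.≈⟨ ∂-constant-⊛ (c k) _ ⟩
        constant (c k) S.* ∂ (z S.^ suc k)
          S.≈⟨ S.*-congˡ (S.trans (∂-pow z k) (S.*-congʳ (fromℕ-constant (suc k)))) ⟩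
        constant (c k) S.* (constant (fromℕ (suc k)) S.* ((z S.^ k) S.* ∂ z))
          S.≈⟨ S.solve 4 (λ a b p d → a S.:* (b S.:* (p S.:* d)) S.:= d S.:* ((b S.:* a) S.:* p)) S.refl _ _ _ _ ⟩
        ∂ z S.* ((constant (fromℕ (suc k)) S.* constant (c k)) S.* (z S.^ k))
          S.≈⟨ S.*-congˡ (S.*-congʳ (S.trans (constant-⊛-constant _ _) (constant-cong (coefficient k)))) ⟩
        ∂ z S.* (constant ((- 1#) ^ k) S.* (z S.^ k))
          S.≈⟨ S.*-congˡ (pow-neg z k) ⟨
        ∂ z S.* ((S.- z) S.^ k) S.∎

    -- Multiplication by 1 + z telescopes the geometric sum. The error term contains the power n + 1
    -- of -z, which has no coefficient up to degree n.
    ∂-log1+ : ((S.1# S.+ z) S.* ∂ log1+) S.≈ ∂ z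
    ∂-log1+ n = begin
      conv n (λ i j → (S.1# S.+ z) i * ∂ log1+ j)
        ≈⟨ conv-cong n (λ i j i+j≡n → *-congˡ (*-congˡ
             (log1+-partial (s≤s (ℕ.m+n≤o⇒n≤o i (ℕ.≤-reflexive i+j≡n)))))) ⟩
      ((S.1# S.+ z) S.* ∂ (partial (suc n))) n
        ≈⟨ S.*-congˡ (∂-partial (suc n)) n ⟩
      ((S.1# S.+ z) S.* (S.sumBelow (suc n) (λ k → (S.- z) S.^ k) S.* ∂ z)) n
        ≈⟨ S.*-assoc _ _ _ n ⟨
      (((S.1# S.+ z) S.* S.sumBelow (suc n) (λ k → (S.- z) S.^ k)) S.* ∂ z) n
        ≈⟨ S.*-congʳ (S.geometric-sum z (suc n)) n ⟩
      ((S.1# S.+ (S.- ((S.- z) S.^ suc n))) S.* ∂ z) n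
        ≈⟨ S.distribʳ _ _ _ n ⟩
      (S.1# S.* ∂ z) n + ((S.- ((S.- z) S.^ suc n)) S.* ∂ z) n
        ≈⟨ +-cong (S.*-identityˡ _ n) (trans (conv-cong n λ i j i+j≡n →
             trans (*-congʳ (trans (-‿cong (pow-vanishes (trans (-‿cong z₀) -0#≈0#) (suc n) i
               (s≤s (ℕ.m+n≤o⇒m≤o i (ℕ.≤-reflexive i+j≡n))))) -0#≈0#)) (zeroˡ _)) (conv-0 n)) ⟩
      ∂ z n + 0#
        ≈⟨ +-identityʳ _ ⟩
      ∂ z n ∎

  ⊛-cancelʳ : ∀ {f g h} → h 0 ≈ 1# → (f ⊛ h) S.≈ (g ⊛ h) → f S.≈ g
  ⊛-cancelʳ {f} {g} {h} h₀ eq = S.IsUnit-cancelˡ f g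
    (unit-series h (IsUnit-resp (sym h₀) (1# , *-identityˡ 1#)))
    (S.trans (S.*-comm h f) (S.trans eq (S.*-comm g h)))

-- Subsets of a list with their complements, and sums over them.

module _ {A : Set} where

  ∈-interleaving : ∀ {x : A} {ys zs xs} → Interleaving ys zs xs → x ∈ xs → x ∈ ys ⊎ x ∈ zs
  ∈-interleaving (consˡ s) (here eq) = inj₁ (here eq)
  ∈-interleaving (consʳ s) (here eq) = inj₂ (here eq)
  ∈-interleaving (consˡ s) (there p) = [ (λ q → inj₁ (there q)) , inj₂ ]′ (∈-interleaving s p)
  ∈-interleaving (consʳ s) (there p) = [ inj₁ , (λ q → inj₂ (there q)) ]′ (∈-interleaving s p)

  ∈-interleavingˡ : ∀ {x : A} {ys zs xs} → Interleaving ys zs xs → x ∈ ys → x ∈ xs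
  ∈-interleavingˡ (consˡ s) (here eq) = here eq
  ∈-interleavingˡ (consˡ s) (there p) = there (∈-interleavingˡ s p)
  ∈-interleavingˡ (consʳ s) p         = there (∈-interleavingˡ s p)

  ∈-interleavingʳ : ∀ {x : A} {ys zs xs} → Interleaving ys zs xs → x ∈ zs → x ∈ xs
  ∈-interleavingʳ (consʳ s) (here eq) = here eq
  ∈-interleavingʳ (consʳ s) (there p) = there (∈-interleavingʳ s p)
  ∈-interleavingʳ (consˡ s) p         = there (∈-interleavingʳ s p)

  interleaving-disjoint : ∀ {x : A} {ys zs xs} → Unique xs → Interleaving ys zs xs → x ∈ ys → x ∈ zs → ⊥
  interleaving-disjoint (x∉ ∷ _) (consˡ s) (here ≡.refl) q = All.lookup x∉ (∈-interleavingʳ s q) ≡.refl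
  interleaving-disjoint (_ ∷ u)  (consˡ s) (there p)     q = interleaving-disjoint u s p q
  interleaving-disjoint (x∉ ∷ _) (consʳ s) p (here ≡.refl) = All.lookup x∉ (∈-interleavingˡ s p) ≡.refl
  interleaving-disjoint (_ ∷ u)  (consʳ s) p (there q)     = interleaving-disjoint u s p q

  interleaving-lengthʳ : ∀ {ys zs xs : List A} → Interleaving ys zs xs → length zs ≤ length xs
  interleaving-lengthʳ s = ℕ.≤-trans (ℕ.m≤n+m _ _) (ℕ.≤-reflexive (≡.sym (interleave-length s)))

  AllPairs-interleavingˡ : ∀ {R : A → A → Set} {ys zs xs} → Interleaving ys zs xs → AllPairs R xs → AllPairs R ys
  AllPairs-interleavingˡ []        []       = []
  AllPairs-interleavingˡ (consˡ s) (r ∷ rs) =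
    All.tabulate (λ p → All.lookup r (∈-interleavingˡ s p)) ∷ AllPairs-interleavingˡ s rs
  AllPairs-interleavingˡ (consʳ s) (r ∷ rs) = AllPairs-interleavingˡ s rs

  AllPairs-interleavingʳ : ∀ {R : A → A → Set} {ys zs xs} → Interleaving ys zs xs → AllPairs R xs → AllPairs R zs
  AllPairs-interleavingʳ s = AllPairs-interleavingˡ (Interleaving.swap s)

  interleaving-filter : ∀ {P : A → Set} (P? : Decidable P) xs →
    Interleaving (filter P? xs) (filter (λ x → ¬? (P? x)) xs) xs
  interleaving-filter P? []       = []
  interleaving-filter P? (x ∷ xs) with P? x
  ... | yes _ = consˡ (interleaving-filter P? xs)
  ... | no  _ = consʳ (interleaving-filter P? xs)

module SplitSums (R : CommutativeRing 0ℓ 0ℓ) {A : Set} where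
  open RingTools R

  -- A subset and its complement are built together as sublists in the original order, so a property
  -- such as being increasing passes to both.
  splitSum : List A → (List A → List A → Carrier) → Carrier
  splitSum []       F = F [] []
  splitSum (x ∷ xs) F = splitSum xs (λ ys zs → F (x ∷ ys) zs) + splitSum xs (λ ys zs → F ys (x ∷ zs))

  splitSum-cong : ∀ xs {F G : List A → List A → Carrier} →
    (∀ {ys zs} → Interleaving ys zs xs → F ys zs ≈ G ys zs) → splitSum xs F ≈ splitSum xs G
  splitSum-cong []       eq = eq []
  splitSum-cong (x ∷ xs) eq = +-cong (splitSum-cong xs λ s → eq (consˡ s)) (splitSum-cong xs λ s → eq (consʳ s))

  splitSum-0 : ∀ xs → splitSum xs (λ _ _ → 0#) ≈ 0#
  splitSum-0 []       = refl
  splitSum-0 (x ∷ xs) = trans (+-cong (splitSum-0 xs) (splitSum-0 xs)) (+-identityʳ _)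

  splitSum-+ : ∀ xs F G → splitSum xs (λ ys zs → F ys zs + G ys zs) ≈ splitSum xs F + splitSum xs G
  splitSum-+ []       F G = refl
  splitSum-+ (x ∷ xs) F G = trans (+-cong (splitSum-+ xs _ _) (splitSum-+ xs _ _)) (+-interchange _ _ _ _)

  splitSum-*ˡ : ∀ xs c F → c * splitSum xs F ≈ splitSum xs (λ ys zs → c * F ys zs)
  splitSum-*ˡ []       c F = refl
  splitSum-*ˡ (x ∷ xs) c F = trans (distribˡ c _ _) (+-cong (splitSum-*ˡ xs c _) (splitSum-*ˡ xs c _))

  splitSum-*ʳ : ∀ xs c F → splitSum xs F * c ≈ splitSum xs (λ ys zs → F ys zs * c)
  splitSum-*ʳ xs c F = trans (*-comm _ c) (trans (splitSum-*ˡ xs c F) (splitSum-cong xs λ _ → *-comm c _))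

  splitSum-neg : ∀ xs F → splitSum xs (λ ys zs → - F ys zs) ≈ - splitSum xs F
  splitSum-neg []       F = refl
  splitSum-neg (x ∷ xs) F = trans (+-cong (splitSum-neg xs _) (splitSum-neg xs _)) (-‿+-comm _ _)

  -- Both sides run over the ordered partitions of `xs` into three parts.
  splitSum-assoc : ∀ xs (F : List A → List A → List A → Carrier) →
    splitSum xs (λ ys cs → splitSum ys (λ as bs → F as bs cs)) ≈
    splitSum xs (λ as zs → splitSum zs (λ bs cs → F as bs cs))
  splitSum-assoc []       F = refl
  splitSum-assoc (x ∷ xs) F = begin
    splitSum xs (λ ys cs → splitSum ys (λ as bs → F (x ∷ as) bs cs) + splitSum ys (λ as bs → F as (x ∷ bs) cs)) +
      splitSum xs (λ ys cs → splitSum ys (λ as bs → F as bs (x ∷ cs)))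
        ≈⟨ +-congʳ (splitSum-+ xs _ _) ⟩
    (splitSum xs (λ ys cs → splitSum ys (λ as bs → F (x ∷ as) bs cs)) +
      splitSum xs (λ ys cs → splitSum ys (λ as bs → F as (x ∷ bs) cs))) +
      splitSum xs (λ ys cs → splitSum ys (λ as bs → F as bs (x ∷ cs)))
        ≈⟨ +-cong (+-cong (splitSum-assoc xs _) (splitSum-assoc xs _)) (splitSum-assoc xs _) ⟩
    (splitSum xs (λ as zs → splitSum zs (λ bs cs → F (x ∷ as) bs cs)) +
      splitSum xs (λ as zs → splitSum zs (λ bs cs → F as (x ∷ bs) cs))) +
      splitSum xs (λ as zs → splitSum zs (λ bs cs → F as bs (x ∷ cs)))
        ≈⟨ +-assoc _ _ _ ⟩
    splitSum xs (λ as zs → splitSum zs (λ bs cs → F (x ∷ as) bs cs)) +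
      (splitSum xs (λ as zs → splitSum zs (λ bs cs → F as (x ∷ bs) cs)) +
      splitSum xs (λ as zs → splitSum zs (λ bs cs → F as bs (x ∷ cs))))
        ≈⟨ +-congˡ (splitSum-+ xs _ _) ⟨
    splitSum xs (λ as zs → splitSum zs (λ bs cs → F (x ∷ as) bs cs)) +
      splitSum xs (λ as zs → splitSum zs (λ bs cs → F as (x ∷ bs) cs) + splitSum zs (λ bs cs → F as bs (x ∷ cs))) ∎

  -- An element of `cs` can only go to the complement, so the surviving splits of `us` are the
  -- splits of `xs` with `cs` joined to the right part.
  splitSum-restrict : ∀ {cs xs us} → Interleaving cs xs us → {F G : List A → List A → Carrier} →
    (∀ {ys zs c} → Interleaving ys zs us → c ∈ ys → c ∈ cs → F ys zs ≈ 0#) →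
    (∀ {ys zs zs′} → Interleaving ys zs us → Interleaving cs zs′ zs → Interleaving ys zs′ xs → F ys zs ≈ G ys zs′) →
    splitSum us F ≈ splitSum xs G
  splitSum-restrict [] vanish eq = eq [] [] []
  splitSum-restrict {xs = xs} {us = u ∷ us} (consˡ s) {F} {G} vanish eq = begin
    splitSum us (λ ys zs → F (u ∷ ys) zs) + splitSum us (λ ys zs → F ys (u ∷ zs))
      ≈⟨ +-cong (trans (splitSum-cong us λ t → vanish (consˡ t) (here ≡.refl) (here ≡.refl)) (splitSum-0 us))
           (splitSum-restrict s (λ t p q → vanish (consʳ t) p (there q)) (λ t t₁ t₂ → eq (consʳ t) (consˡ t₁) t₂)) ⟩
    0# + splitSum xs G  ≈⟨ +-identityˡ _ ⟩
    splitSum xs G       ∎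
  splitSum-restrict (consʳ s) vanish eq = +-cong
    (splitSum-restrict s (λ t p q → vanish (consˡ t) (there p) q) (λ t t₁ t₂ → eq (consˡ t) t₁ (consˡ t₂)))
    (splitSum-restrict s (λ t p q → vanish (consʳ t) p q) (λ t t₁ t₂ → eq (consʳ t) (consʳ t₁) (consʳ t₂)))

  -- At each element, the branch that contradicts `P?` vanishes as a whole; a single split is left.
  splitSum-unique : ∀ {P : A → Set} (P? : Decidable P) xs {F : List A → List A → Carrier} →
    (∀ {ys zs} → Interleaving ys zs xs → All P ys → All (λ z → ¬ P z) zs → F ys zs ≈ 1#) →
    (∀ {ys zs} → Interleaving ys zs xs → ¬ (All P ys × All (λ z → ¬ P z) zs) → F ys zs ≈ 0#) →
    splitSum xs F ≈ 1#
  splitSum-unique P? []       hit miss = hit [] [] []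
  splitSum-unique P? (x ∷ xs) hit miss with P? x
  ... | yes p = trans (+-cong
    (splitSum-unique P? xs (λ s ps ¬ps → hit (consˡ s) (p ∷ ps) ¬ps)
      (λ s ¬q → miss (consˡ s) λ { (_ ∷ ps , ¬ps) → ¬q (ps , ¬ps) }))
    (trans (splitSum-cong xs λ s → miss (consʳ s) λ { (_ , ¬p ∷ _) → ¬p p }) (splitSum-0 xs))) (+-identityʳ _)
  ... | no ¬p = trans (+-cong
    (trans (splitSum-cong xs λ s → miss (consˡ s) λ { (p ∷ _ , _) → ¬p p }) (splitSum-0 xs))
    (splitSum-unique P? xs (λ s ps ¬ps → hit (consʳ s) ps (¬p ∷ ¬ps))
      (λ s ¬q → miss (consʳ s) λ { (ps , _ ∷ ¬ps) → ¬q (ps , ¬ps) }))) (+-identityˡ _)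

module Indicators (R : CommutativeRing 0ℓ 0ℓ) where
  open RingTools R

  ⟦_⟧ : {P : Set} → Dec P → Carrier
  ⟦ p? ⟧ = if does p? then 1# else 0#

  ⟦⟧-true : {P : Set} (p? : Dec P) → P → ⟦ p? ⟧ ≈ 1#
  ⟦⟧-true (yes _) p = refl
  ⟦⟧-true (no ¬p) p = contradiction p ¬p

  ⟦⟧-false : {P : Set} (p? : Dec P) → ¬ P → ⟦ p? ⟧ ≈ 0#
  ⟦⟧-false (yes p) ¬p = contradiction p ¬p
  ⟦⟧-false (no _)  ¬p = refl

  ⟦⟧-cong : {P Q : Set} (p? : Dec P) (q? : Dec Q) → (P → Q) → (Q → P) → ⟦ p? ⟧ ≈ ⟦ q? ⟧
  ⟦⟧-cong p? (yes q) f g = ⟦⟧-true p? (g q)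
  ⟦⟧-cong p? (no ¬q) f g = ⟦⟧-false p? (λ p → ¬q (f p))

  ⟦⟧-× : {P Q : Set} (p? : Dec P) (q? : Dec Q) → ⟦ p? ×-dec q? ⟧ ≈ ⟦ p? ⟧ * ⟦ q? ⟧
  ⟦⟧-× (yes _) q? = sym (*-identityˡ _)
  ⟦⟧-× (no _)  q? = sym (zeroˡ _)

  ⟦⟧-*-cong : {P : Set} (p? : Dec P) {x y : Carrier} → (P → x ≈ y) → ⟦ p? ⟧ * x ≈ ⟦ p? ⟧ * y
  ⟦⟧-*-cong (yes p) eq = *-congˡ (eq p)
  ⟦⟧-*-cong (no _)  eq = trans (zeroˡ _) (sym (zeroˡ _))

-- Walks and strong connectivity, decidably.

module Walks {V : Set} (_≟_ : DecidableEquality V) where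
  open import Data.List.Membership.DecPropositional _≟_ using (_∈?_)

  Cfg : Set
  Cfg = V × V → Bool

  -- Only the vertices entered by a step must lie in `xs`; the starting vertex is free.
  data Walk (D : Cfg) (xs : List V) : V → V → Set where
    done : ∀ {a} → Walk D xs a a
    step : ∀ {a b c} → D (a , b) ≡ true → b ∈ xs → Walk D xs b c → Walk D xs a c

  walk-trans : ∀ {D xs a b c} → Walk D xs a b → Walk D xs b c → Walk D xs a c
  walk-trans done         w′ = w′
  walk-trans (step e p w) w′ = step e p (walk-trans w w′)

  -- Warshall's recursion: nonempty walks from a to b whose intermediate vertices lie in xs.
  Via : Cfg → List V → V → V → Set
  Via D []       a b = D (a , b) ≡ true
  Via D (x ∷ xs) a b = Via D xs a b ⊎ (Via D xs a x × Via D xs x b)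

  via? : ∀ D xs a b → Dec (Via D xs a b)
  via? D []       a b = D (a , b) Bool.≟ true
  via? D (x ∷ xs) a b = via? D xs a b ⊎-dec (via? D xs a x ×-dec via? D xs x b)

  edge⇒via : ∀ {D} xs {a b} → D (a , b) ≡ true → Via D xs a b
  edge⇒via []       e = e
  edge⇒via (x ∷ xs) e = inj₁ (edge⇒via xs e)

  -- Only existence matters, so closed detours at the head `x` may be dropped: the first leg into
  -- `x` and the last leg out of it are kept.
  via-trans : ∀ {D xs a b c} → b ∈ xs → Via D xs a b → Via D xs b c → Via D xs a c
  via-trans (here ≡.refl) p q = inj₂ ([ (λ z → z) , proj₁ ]′ p , [ (λ z → z) , proj₂ ]′ q)
  via-trans (there b∈) (inj₁ p)        (inj₁ q)        = inj₁ (via-trans b∈ p q)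
  via-trans (there b∈) (inj₁ p)        (inj₂ (q , q′)) = inj₂ (via-trans b∈ p q , q′)
  via-trans (there b∈) (inj₂ (p , p′)) (inj₁ q)        = inj₂ (p , via-trans b∈ p′ q)
  via-trans (there b∈) (inj₂ (p , p′)) (inj₂ (q , q′)) = inj₂ (p , q′)

  via⇒walk : ∀ {D} ys {xs a b} → (∀ {x} → x ∈ ys → x ∈ xs) → b ∈ xs → Via D ys a b → Walk D xs a b
  via⇒walk []       sub b∈ e              = step e b∈ done
  via⇒walk (y ∷ ys) sub b∈ (inj₁ p)       = via⇒walk ys (λ q → sub (there q)) b∈ p
  via⇒walk (y ∷ ys) sub b∈ (inj₂ (p , q)) =
    walk-trans (via⇒walk ys (λ q → sub (there q)) (sub (here ≡.refl)) p) (via⇒walk ys (λ q → sub (there q)) b∈ q)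

  walk⇒via : ∀ {D xs a b} → Walk D xs a b → a ≡ b ⊎ (b ∈ xs × Via D xs a b)
  walk⇒via done = inj₁ ≡.refl
  walk⇒via {xs = xs} (step e p w) with walk⇒via w
  ... | inj₁ ≡.refl   = inj₂ (p , edge⇒via xs e)
  ... | inj₂ (b∈ , v) = inj₂ (b∈ , via-trans p (edge⇒via xs e) v)

  -- Walks have unbounded length, while `Via` is a finite Boolean combination of edges and hence
  -- decidable.
  walk? : ∀ D xs a b → Dec (Walk D xs a b)
  walk? D xs a b = map′
    [ (λ { ≡.refl → done }) , (λ (b∈ , v) → via⇒walk xs (λ p → p) b∈ v) ]′
    walk⇒via
    ((a ≟ b) ⊎-dec ((b ∈? xs) ×-dec via? D xs a b))

  walk-map : ∀ {D D′ xs} → (∀ {a b} → a ∈ xs → b ∈ xs → D (a , b) ≡ true → D′ (a , b) ≡ true) →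
    ∀ {a b} → a ∈ xs → Walk D xs a b → Walk D′ xs a b
  walk-map f a∈ done          = done
  walk-map f a∈ (step e b∈ w) = step (f a∈ b∈ e) b∈ (walk-map f b∈ w)

  Strong : Cfg → List V → Set
  Strong D xs = ∀ {a b} → a ∈ xs → b ∈ xs → Walk D xs a b

  strong? : ∀ D xs → Dec (Strong D xs)
  strong? D xs = map′ (λ w p q → All.lookup (All.lookup w p) q) (λ w → All.tabulate λ p → All.tabulate λ q → w p q)
    (All.all? (λ a → All.all? (λ b → walk? D xs a b) xs) xs)

  NoEdges : Cfg → List V → List V → Set
  NoEdges D xs ys = ∀ {a b} → a ∈ xs → b ∈ ys → D (a , b) ≡ false

  noEdges? : ∀ D xs ys → Dec (NoEdges D xs ys)
  noEdges? D xs ys = map′ (λ w p q → All.lookup (All.lookup w p) q) (λ w → All.tabulate λ p → All.tabulate λ q → w p q)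
    (All.all? (λ a → All.all? (λ b → D (a , b) Bool.≟ false) ys) xs)

  true≢false : ∀ {b} → b ≡ true → b ≡ false → ⊥
  true≢false ≡.refl ()

  -- The first step that leaves `ps` must enter `qs`, and such an edge is forbidden.
  walk-crossing : ∀ {D xs ps qs a b} →
    (∀ {x} → x ∈ xs → x ∈ ps ⊎ x ∈ qs) → (∀ {x} → x ∈ ps → x ∈ qs → ⊥) → NoEdges D ps qs →
    Walk D xs a b → a ∈ ps → b ∈ qs → ⊥
  walk-crossing cover disj none done          a∈ b∈ = disj a∈ b∈
  walk-crossing cover disj none (step e c∈ w) a∈ b∈ with cover c∈
  ... | inj₁ c∈ps = walk-crossing cover disj none w c∈ps b∈
  ... | inj₂ c∈qs = true≢false e (none a∈ c∈qs)

-- Cancellation of signs over the sets of source components.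

module SourceComponents (R : CommutativeRing 0ℓ 0ℓ) {V : Set} (_≟_ : DecidableEquality V) where
  open RingTools R
  open SplitSums R {V}
  open Indicators R
  open Walks _≟_

  Isolated : Cfg → List V → List V → Set
  Isolated D C Z = Strong D C × NoEdges D C Z × NoEdges D Z C

  isolated? : ∀ D C Z → Dec (Isolated D C Z)
  isolated? D C Z = strong? D C ×-dec (noEdges? D C Z ×-dec noEdges? D Z C)

  -- The first argument is fuel, as `Z` is shorter than the list but no structural part of it. At
  -- most one `C` makes `v ∷ C` strong and isolated, namely the rest of the connected component of
  -- `v`, so each component contributes one factor -1.
  signWithin : ℕ → List V → Cfg → Carrier
  signWithin zero    _        D = 1#
  signWithin (suc n) []       D = 1#
  signWithin (suc n) (v ∷ xs) D = - splitSum xs (λ C Z → ⟦ isolated? D (v ∷ C) Z ⟧ * signWithin n Z D)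

  signWithin-irrelevant : ∀ m n xs D → length xs ≤ m → length xs ≤ n → signWithin m xs D ≈ signWithin n xs D
  signWithin-irrelevant zero    zero    []       D _ _ = refl
  signWithin-irrelevant zero    (suc n) []       D _ _ = refl
  signWithin-irrelevant (suc m) zero    []       D _ _ = refl
  signWithin-irrelevant (suc m) (suc n) []       D _ _ = refl
  signWithin-irrelevant (suc m) (suc n) (v ∷ xs) D (s≤s p) (s≤s q) = -‿cong (splitSum-cong xs λ {_} {Z} s →
    *-congˡ (signWithin-irrelevant m n Z D (ℕ.≤-trans (interleaving-lengthʳ s) p) (ℕ.≤-trans (interleaving-lengthʳ s) q)))

  -- (-1)ᶜ if the digraph induced on xs is a disjoint union of c strong digraphs, and 0 otherwise.
  sign : List V → Cfg → Carrier
  sign xs = signWithin (length xs) xs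

  sign-∷ : ∀ v xs D → sign (v ∷ xs) D ≈ - splitSum xs (λ C Z → ⟦ isolated? D (v ∷ C) Z ⟧ * sign Z D)
  sign-∷ v xs D = -‿cong (splitSum-cong xs λ {_} {Z} s →
    *-congˡ (signWithin-irrelevant _ _ Z D (interleaving-lengthʳ s) ℕ.≤-refl))

  sourceSum : List V → Cfg → Carrier
  sourceSum U D = splitSum U (λ B Z → ⟦ noEdges? D Z B ⟧ * sign B D)

  module _ (D : Cfg) (v : V) (U : List V) (unique : Unique (v ∷ U)) where

    -- The summands of `sourceSum (v ∷ U) D` whose set omits `v`; this is the η in (1 - N) η.
    avoiding : Carrier
    avoiding = splitSum U (λ B Z → ⟦ noEdges? D (v ∷ Z) B ⟧ * sign B D)

    Source : List V → List V → Set
    Source C Y = Strong D (v ∷ C) × NoEdges D Y (v ∷ C)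

    source? : ∀ C Y → Dec (Source C Y)
    source? C Y = strong? D (v ∷ C) ×-dec noEdges? D Y (v ∷ C)

    v∉U : ∀ {x} → x ∈ U → v ≢ x
    v∉U = All.lookup (AllPairs.head unique)

    cover : ∀ {ys zs} → Interleaving ys zs U → ∀ {x} → x ∈ v ∷ U → x ∈ v ∷ zs ⊎ x ∈ ys
    cover s (here eq) = inj₁ (here eq)
    cover s (there p) = [ inj₂ , (λ q → inj₁ (there q)) ]′ (∈-interleaving s p)

    disjoint : ∀ {ys zs} → Interleaving ys zs U → ∀ {x} → x ∈ v ∷ zs → x ∈ ys → ⊥
    disjoint s (here ≡.refl) q = v∉U (∈-interleavingˡ s q) ≡.refl
    disjoint s (there p)     q = interleaving-disjoint (AllPairs.tail unique) s q p

    -- A walk from `v` to a vertex of `B` has to enter `B` through an edge from `v ∷ Z`.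
    reachable-vanishes : ∀ {B Z b} → Interleaving B Z U → b ∈ B → Walk D (v ∷ U) v b →
      ⟦ noEdges? D (v ∷ Z) B ⟧ * sign B D ≈ 0#
    reachable-vanishes {B} {Z} s b∈B w = trans (*-congʳ (⟦⟧-false (noEdges? D (v ∷ Z) B) λ none →
      walk-crossing (cover s) (disjoint s) none w (here ≡.refl) b∈B)) (zeroˡ _)

    enlarge : ∀ {C Y a b} → Interleaving C Y U → Walk D (v ∷ C) a b → Walk D (v ∷ U) a b
    enlarge s done                  = done
    enlarge s (step e (here eq)  w) = step e (here eq) (enlarge s w)
    enlarge s (step e (there c∈) w) = step e (there (∈-interleavingˡ s c∈)) (enlarge s w)

    -- All of `C` is reachable from `v`, so in `avoiding` only the sets disjoint from `C` survive.
    -- The right side does not mention `C`, and this is what lets `containing` factor.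
    component-avoiding : ∀ {C Y} → Interleaving C Y U → Strong D (v ∷ C) →
      splitSum Y (λ B Z → ⟦ noEdges? D Z B ×-dec noEdges? D (v ∷ C) B ⟧ * sign B D) ≈ avoiding
    component-avoiding {C} {Y} s strong = sym (splitSum-restrict s
      (λ t c∈B c∈C → reachable-vanishes t c∈B (enlarge s (strong (here ≡.refl) (there c∈C))))
      (λ {B} {Z} {Z′} t t₁ t₂ → *-congʳ (⟦⟧-cong (noEdges? D (v ∷ Z) B) (noEdges? D Z′ B ×-dec noEdges? D (v ∷ C) B)
        (λ none → (λ z∈ b∈ → none (there (∈-interleavingʳ t₁ z∈)) b∈) ,
          λ { (here eq) b∈ → none (here eq) b∈ ; (there c∈) b∈ → none (there (∈-interleavingˡ t₁ c∈)) b∈ })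
        (λ { (none , none′) (here eq) b∈ → none′ (here eq) b∈
           ; (none , none′) (there z∈) b∈ → [ (λ c∈ → none′ (there c∈) b∈) , (λ z∈′ → none z∈′ b∈) ]′ (∈-interleaving t₁ z∈) }))))

    -- Taking the component `v ∷ C` of `v` out of the set costs a sign and leaves a set of source
    -- components without `v`. The sum over `C` then counts the source components that contain `v`.
    containing : splitSum U (λ B Z → ⟦ noEdges? D Z (v ∷ B) ⟧ * sign (v ∷ B) D) ≈
      - (splitSum U (λ C Y → ⟦ source? C Y ⟧) * avoiding)
    containing = begin
      splitSum U (λ B Z → ⟦ noEdges? D Z (v ∷ B) ⟧ * sign (v ∷ B) D)
        ≈⟨ splitSum-cong U (λ {B} {Z} s → expand s) ⟩
      splitSum U (λ B Z → - splitSum B (λ C B′ → ⟦ joint? C B′ Z ⟧ * sign B′ D))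
        ≈⟨ splitSum-neg U _ ⟩
      - splitSum U (λ B Z → splitSum B (λ C B′ → ⟦ joint? C B′ Z ⟧ * sign B′ D))
        ≈⟨ -‿cong (splitSum-assoc U (λ C B′ Z → ⟦ joint? C B′ Z ⟧ * sign B′ D)) ⟩
      - splitSum U (λ C Y → splitSum Y (λ B′ Z → ⟦ joint? C B′ Z ⟧ * sign B′ D))
        ≈⟨ -‿cong (splitSum-cong U λ {C} {Y} s → trans (factor C Y)
             (⟦⟧-*-cong (source? C Y) λ (strong , _) → component-avoiding s strong)) ⟩
      - splitSum U (λ C Y → ⟦ source? C Y ⟧ * avoiding)
        ≈⟨ -‿cong (splitSum-*ʳ U avoiding _) ⟨
      - (splitSum U (λ C Y → ⟦ source? C Y ⟧) * avoiding) ∎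
      where
      -- The conditions are regrouped by the target of the forbidden edges: the first group says
      -- that `v ∷ C` is a source component, the second that nothing enters `B`.
      joint? : ∀ C B Z → Dec ((Strong D (v ∷ C) × NoEdges D Z (v ∷ C) × NoEdges D B (v ∷ C)) ×
        (NoEdges D Z B × NoEdges D (v ∷ C) B))
      joint? C B Z = (strong? D (v ∷ C) ×-dec (noEdges? D Z (v ∷ C) ×-dec noEdges? D B (v ∷ C))) ×-dec
        (noEdges? D Z B ×-dec noEdges? D (v ∷ C) B)

      expand : ∀ {B Z} → Interleaving B Z U → ⟦ noEdges? D Z (v ∷ B) ⟧ * sign (v ∷ B) D ≈
        - splitSum B (λ C B′ → ⟦ joint? C B′ Z ⟧ * sign B′ D)
      expand {B} {Z} s = begin
        ⟦ noEdges? D Z (v ∷ B) ⟧ * sign (v ∷ B) D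
          ≈⟨ *-congˡ (sign-∷ v B D) ⟩
        ⟦ noEdges? D Z (v ∷ B) ⟧ * - splitSum B (λ C B′ → ⟦ isolated? D (v ∷ C) B′ ⟧ * sign B′ D)
          ≈⟨ -‿distribʳ-* _ _ ⟨
        - (⟦ noEdges? D Z (v ∷ B) ⟧ * splitSum B (λ C B′ → ⟦ isolated? D (v ∷ C) B′ ⟧ * sign B′ D))
          ≈⟨ -‿cong (splitSum-*ˡ B _ _) ⟩
        - splitSum B (λ C B′ → ⟦ noEdges? D Z (v ∷ B) ⟧ * (⟦ isolated? D (v ∷ C) B′ ⟧ * sign B′ D))
          ≈⟨ -‿cong (splitSum-cong B λ {C} {B′} t → trans (sym (*-assoc _ _ _)) (*-congʳ
               (trans (sym (⟦⟧-× (noEdges? D Z (v ∷ B)) (isolated? D (v ∷ C) B′)))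
                 (⟦⟧-cong (noEdges? D Z (v ∷ B) ×-dec isolated? D (v ∷ C) B′) (joint? C B′ Z)
                   (λ (none , strong , CB , BC) →
                     (strong , (λ { z∈ (here eq) → none z∈ (here eq) ; z∈ (there c∈) → none z∈ (there (∈-interleavingˡ t c∈)) }) , BC) ,
                     (λ z∈ b∈ → none z∈ (there (∈-interleavingʳ t b∈))) , CB)
                   (λ ((strong , ZC , BC) , ZB , CB) →
                     (λ { z∈ (here eq) → ZC z∈ (here eq)
                        ; z∈ (there b∈) → [ (λ c∈ → ZC z∈ (there c∈)) , (λ b∈′ → ZB z∈ b∈′) ]′ (∈-interleaving t b∈) }) ,
                     strong , CB , BC))))) ⟩
        - splitSum B (λ C B′ → ⟦ joint? C B′ Z ⟧ * sign B′ D) ∎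

      factor : ∀ C Y → splitSum Y (λ B Z → ⟦ joint? C B Z ⟧ * sign B D) ≈
        ⟦ source? C Y ⟧ * splitSum Y (λ B Z → ⟦ noEdges? D Z B ×-dec noEdges? D (v ∷ C) B ⟧ * sign B D)
      factor C Y = begin
        splitSum Y (λ B Z → ⟦ joint? C B Z ⟧ * sign B D)
          ≈⟨ splitSum-cong Y (λ {B} {Z} t → trans (*-congʳ (trans (⟦⟧-× (strong? D (v ∷ C) ×-dec (noEdges? D Z (v ∷ C) ×-dec noEdges? D B (v ∷ C))) (noEdges? D Z B ×-dec noEdges? D (v ∷ C) B)) (*-congʳ
               (⟦⟧-cong (strong? D (v ∷ C) ×-dec (noEdges? D Z (v ∷ C) ×-dec noEdges? D B (v ∷ C))) (source? C Y)
                 (λ (strong , ZC , BC) → strong , λ y∈ c∈ → [ (λ b∈ → BC b∈ c∈) , (λ z∈ → ZC z∈ c∈) ]′ (∈-interleaving t y∈))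
                 (λ (strong , YC) → strong , (λ z∈ → YC (∈-interleavingʳ t z∈)) , λ b∈ → YC (∈-interleavingˡ t b∈)))))) (*-assoc _ _ _)) ⟩
        splitSum Y (λ B Z → ⟦ source? C Y ⟧ * (⟦ noEdges? D Z B ×-dec noEdges? D (v ∷ C) B ⟧ * sign B D))
          ≈⟨ splitSum-*ˡ Y _ _ ⟨
        ⟦ source? C Y ⟧ * splitSum Y (λ B Z → ⟦ noEdges? D Z B ×-dec noEdges? D (v ∷ C) B ⟧ * sign B D) ∎

    reachable? : Decidable (Walk D (v ∷ U) v)
    reachable? b = walk? D (v ∷ U) v b

    unreached : List V
    unreached = filter (λ x → ¬? (reachable? x)) U

    unreached-interleaving : Interleaving (filter reachable? U) unreached U
    unreached-interleaving = interleaving-filter reachable? U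

    -- A set that meets the reachable vertices contributes 0. An edge from a reachable vertex into
    -- an unreached one cannot exist, so for the other sets only edges among unreached vertices
    -- matter.
    avoiding-unreached : avoiding ≈ sourceSum unreached D
    avoiding-unreached = splitSum-restrict unreached-interleaving
      (λ t b∈B b∈R → reachable-vanishes t b∈B (proj₂ (∈-filter⁻ reachable? {xs = U} b∈R)))
      (λ {B} {Z} {Z′} t t₁ t₂ → *-congʳ (⟦⟧-cong (noEdges? D (v ∷ Z) B) (noEdges? D Z′ B)
        (λ none z∈ b∈ → none (there (∈-interleavingʳ t₁ z∈)) b∈)
        (λ { none (here ≡.refl) b∈ → Bool.¬-not (λ e → proj₂ (unreached⁻ (∈-interleavingˡ t₂ b∈))
               (step e (there (∈-interleavingˡ t b∈)) done))
           ; none (there z∈) b∈ → [ (λ r∈ → Bool.¬-not λ e → proj₂ (unreached⁻ (∈-interleavingˡ t₂ b∈))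
                 (walk-trans (proj₂ (∈-filter⁻ reachable? {xs = U} r∈)) (step e (there (∈-interleavingˡ t b∈)) done)))
               , (λ z∈′ → none z∈′ b∈) ]′ (∈-interleaving t₁ z∈) })))
      where
      unreached⁻ : ∀ {x} → x ∈ unreached → x ∈ U × ¬ Walk D (v ∷ U) v x
      unreached⁻ = ∈-filter⁻ (λ x → ¬? (reachable? x)) {xs = U}

    ancestor? : Decidable (λ a → Walk D (v ∷ U) a v)
    ancestor? a = walk? D (v ∷ U) a v

    -- If v reaches everything, its strong component (the set of its ancestors) is the only source component.
    unique-source : unreached ≡ [] → splitSum U (λ C Y → ⟦ source? C Y ⟧) ≈ 1#
    unique-source none-unreached = splitSum-unique ancestor? U
      (λ {C} {Y} s anc ¬anc → ⟦⟧-true (source? C Y)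
        (strong-ancestors s anc ¬anc , λ { y∈ (here ≡.refl) → Bool.¬-not λ e → All.lookup ¬anc y∈ (step e (here ≡.refl) done)
          ; y∈ (there c∈) → Bool.¬-not λ e → All.lookup ¬anc y∈
              (step e (there (∈-interleavingˡ s c∈)) (All.lookup anc c∈)) }))
      (λ {C} {Y} s ¬component → ⟦⟧-false (source? C Y) λ (strong , YC) → ¬component
        ( All.tabulate (λ c∈ → enlarge s (strong (there c∈) (here ≡.refl)))
        , All.tabulate (λ y∈ w → walk-crossing (λ p → [ (λ q → inj₂ q) , inj₁ ]′ (cover (Interleaving.swap s) p))
            (λ y∈ c∈ → disjoint (Interleaving.swap s) c∈ y∈) YC w y∈ (here ≡.refl))))
      where
      reach : ∀ {x} → x ∈ v ∷ U → Walk D (v ∷ U) v x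
      reach (here ≡.refl) = done
      reach (there p) with ∈-interleaving unreached-interleaving p
      ... | inj₁ r∈ = proj₂ (∈-filter⁻ reachable? {xs = U} r∈)
      ... | inj₂ w∈ with ≡.subst (_ ∈_) none-unreached w∈
      ... | ()

      module _ {C Y} (s : Interleaving C Y U) (anc : All (λ a → Walk D (v ∷ U) a v) C)
        (¬anc : All (λ a → ¬ Walk D (v ∷ U) a v) Y) where

        ancestor : ∀ {x} → x ∈ v ∷ C → Walk D (v ∷ U) x v
        ancestor (here ≡.refl) = done
        ancestor (there c∈)    = All.lookup anc c∈

        ancestor-∈ : ∀ {x} → x ∈ v ∷ U → Walk D (v ∷ U) x v → x ∈ v ∷ C
        ancestor-∈ (here eq) w = here eq
        ancestor-∈ (there p) w = [ there , (λ y∈ → contradiction w (All.lookup ¬anc y∈)) ]′ (∈-interleaving s p)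

        -- Every vertex on a walk to an ancestor of `v` is an ancestor of `v` itself.
        shrink : ∀ {a b} → Walk D (v ∷ U) b v → Walk D (v ∷ U) a b → Walk D (v ∷ C) a b
        shrink back done          = done
        shrink back (step e p w) = step e (ancestor-∈ p (walk-trans w back)) (shrink back w)

        strong-ancestors : Strong D (v ∷ C)
        strong-ancestors a∈ b∈ = shrink (ancestor b∈) (walk-trans (ancestor a∈) (reach (∈-included b∈)))
          where
          ∈-included : ∀ {x} → x ∈ v ∷ C → x ∈ v ∷ U
          ∈-included (here eq) = here eq
          ∈-included (there p) = there (∈-interleavingˡ s p)

    sourceSum-∷ : sourceSum (v ∷ U) D ≈ - (splitSum U (λ C Y → ⟦ source? C Y ⟧) * avoiding) + avoiding
    sourceSum-∷ = +-congʳ containing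

  -- If `v` reaches every vertex, the factor 1 - N is 0. Otherwise η is the same signed sum for the
  -- unreached vertices, a nonempty and smaller set, and vanishes by induction.
  sourceSum-vanishes : ∀ D v U → Unique (v ∷ U) → sourceSum (v ∷ U) D ≈ 0#
  sourceSum-vanishes D v U = go (length U) v U ℕ.≤-refl
    where
    go : ∀ n v U → length U ≤ n → Unique (v ∷ U) → sourceSum (v ∷ U) D ≈ 0#
    go n v U U≤n unique with unreached D v U unique in eq
    ... | [] = begin
      sourceSum (v ∷ U) D
        ≈⟨ sourceSum-∷ D v U unique ⟩
      - (splitSum U (λ C Y → ⟦ source? D v U unique C Y ⟧) * η) + η
        ≈⟨ +-congʳ (-‿cong (trans (*-congʳ (unique-source D v U unique eq)) (*-identityˡ η))) ⟩
      - η + η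
        ≈⟨ -‿inverseˡ η ⟩
      0# ∎
      where η = avoiding D v U unique
    go zero    v []      U≤n unique | w ∷ W with eq
    ... | ()
    go (suc n) v U U≤n unique | w ∷ W = begin
      sourceSum (v ∷ U) D
        ≈⟨ sourceSum-∷ D v U unique ⟩
      - (N * avoiding D v U unique) + avoiding D v U unique
        ≈⟨ +-cong (-‿cong (trans (*-congˡ η≈0) (zeroʳ N))) η≈0 ⟩
      - 0# + 0#
        ≈⟨ -‿inverseˡ 0# ⟩
      0# ∎
      where
      N = splitSum U (λ C Y → ⟦ source? D v U unique C Y ⟧)
      interleaving : Interleaving (filter (reachable? D v U unique) U) (w ∷ W) U
      interleaving = ≡.subst (λ ws → Interleaving (filter (reachable? D v U unique) U) ws U) eq (unreached-interleaving D v U unique)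
      η≈0 : avoiding D v U unique ≈ 0#
      η≈0 = trans (avoiding-unreached D v U unique) (trans (reflexive (≡.cong (λ W → sourceSum W D) eq))
        (go n w W (ℕ.s≤s⁻¹ (ℕ.≤-trans (interleaving-lengthʳ interleaving) U≤n))
          (AllPairs-interleavingʳ interleaving (AllPairs.tail unique))))

-- Blocks of edges between vertex lists.

module _ {A : Set} where

  ++-interchange : ∀ (as bs cs ds : List A) → (as ++ bs) ++ (cs ++ ds) ↭ (as ++ cs) ++ (bs ++ ds)
  ++-interchange as bs cs ds = begin
    (as ++ bs) ++ (cs ++ ds)  ≡⟨ List.++-assoc as bs (cs ++ ds) ⟩
    as ++ (bs ++ (cs ++ ds))  ≡⟨ ≡.cong (as ++_) (List.++-assoc bs cs ds) ⟨
    as ++ ((bs ++ cs) ++ ds)  ↭⟨ Perm.++⁺ˡ as (Perm.++⁺ʳ ds (Perm.++-comm bs cs)) ⟩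
    as ++ ((cs ++ bs) ++ ds)  ≡⟨ ≡.cong (as ++_) (List.++-assoc cs bs ds) ⟩
    as ++ (cs ++ (bs ++ ds))  ≡⟨ List.++-assoc as cs (bs ++ ds) ⟨
    (as ++ cs) ++ (bs ++ ds)  ∎
    where open Perm.PermutationReasoning

module _ {A : Set} where

  cartesianProduct-splitˡ : ∀ {as zs us : List A} → Interleaving as zs us → (ys : List A) →
    cartesianProduct us ys ↭ cartesianProduct as ys ++ cartesianProduct zs ys
  cartesianProduct-splitˡ []        ys = ↭-refl
  cartesianProduct-splitˡ {as = a ∷ as} {zs} {_ ∷ us} (consˡ s) ys = ↭-trans
    (Perm.++⁺ˡ (map (a ,_) ys) (cartesianProduct-splitˡ s ys))
    (Perm.↭-reflexive (≡.sym (List.++-assoc (map (a ,_) ys) (cartesianProduct as ys) (cartesianProduct zs ys))))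
  cartesianProduct-splitˡ {as = as} {z ∷ zs} {_ ∷ us} (consʳ s) ys = ↭-trans
    (Perm.++⁺ˡ (map (z ,_) ys) (cartesianProduct-splitˡ s ys))
    (++-interchange [] (map (z ,_) ys) (cartesianProduct as ys) (cartesianProduct zs ys))

  cartesianProduct-splitʳ : ∀ {as zs us : List A} → Interleaving as zs us → (ys : List A) →
    cartesianProduct ys us ↭ cartesianProduct ys as ++ cartesianProduct ys zs
  cartesianProduct-splitʳ s [] = ↭-refl
  cartesianProduct-splitʳ {as} {zs} {us} s (y ∷ ys) = ↭-trans
    (Perm.++⁺ (↭-trans (Perm.map⁺ (y ,_) (Interleaving.toPermutation s)) (Perm.↭-reflexive (List.map-++ (y ,_) as zs)))
      (cartesianProduct-splitʳ s ys))
    (++-interchange (map (y ,_) as) (map (y ,_) zs) (cartesianProduct ys as) (cartesianProduct ys zs))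

  -- The blocks are put in the order in which `subsetSum-square` nests its sums, with the crossing
  -- edges innermost.
  cartesianProduct-square : ∀ {as zs us : List A} → Interleaving as zs us → cartesianProduct us us ↭
    cartesianProduct as as ++ (cartesianProduct zs zs ++ (cartesianProduct as zs ++ cartesianProduct zs as))
  cartesianProduct-square {as} {zs} {us} s = begin
    cartesianProduct us us
      ↭⟨ cartesianProduct-splitˡ s us ⟩
    cartesianProduct as us ++ cartesianProduct zs us
      ↭⟨ Perm.++⁺ (cartesianProduct-splitʳ s as) (↭-trans (cartesianProduct-splitʳ s zs) (Perm.++-comm za zz)) ⟩
    (aa ++ az) ++ (zz ++ za)
      ↭⟨ ++-interchange aa az zz za ⟩
    (aa ++ zz) ++ (az ++ za)
      ≡⟨ List.++-assoc aa zz (az ++ za) ⟩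
    aa ++ (zz ++ (az ++ za)) ∎
    where
    open Perm.PermutationReasoning
    aa = cartesianProduct as as
    az = cartesianProduct as zs
    za = cartesianProduct zs as
    zz = cartesianProduct zs zs

-- Weighted sums over sets of edges.

module EdgeSums (R : CommutativeRing 0ℓ 0ℓ) {V : Set} (_≟_ : DecidableEquality V)
  (w : V × V → CommutativeRing.Carrier R) where
  open RingTools R
  open SplitSums R {V}
  open Indicators R
  open Walks _≟_
  open SourceComponents R _≟_

  _≟ᵉ_ : DecidableEquality (V × V)
  _≟ᵉ_ = ×-≡-dec _≟_ _≟_

  ∅ : Cfg
  ∅ _ = false

  add : V × V → Cfg → Cfg
  add e D f = if does (f ≟ᵉ e) then true else D f

  add-same : ∀ e D → add e D e ≡ true
  add-same e D rewrite dec-true (e ≟ᵉ e) ≡.refl = ≡.refl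

  add-other : ∀ {e f} D → f ≢ e → add e D f ≡ D f
  add-other {e} {f} D f≢e rewrite dec-false (f ≟ᵉ e) f≢e = ≡.refl

  Agree : (V × V → Set) → Cfg → Cfg → Set
  Agree P D D′ = ∀ {e} → P e → D e ≡ D′ e

  -- Digraphs are functions here and pointwise agreement is weaker than equality, so respect for
  -- agreement is a property to be carried along. With a block of edges as `P` it also expresses
  -- that `F` ignores all other edges.
  DependsOn : (V × V → Set) → (Cfg → Carrier) → Set
  DependsOn P F = ∀ {D D′} → Agree P D D′ → F D ≈ F D′

  Everywhere : V × V → Set
  Everywhere _ = ⊤

  dependsOn-weaken : ∀ {P F} → DependsOn P F → DependsOn Everywhere F
  dependsOn-weaken dep agree = dep λ {e} _ → agree {e} tt

  add-agree : ∀ {P D D′} e → Agree P D D′ → Agree P (add e D) (add e D′)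
  add-agree e agree {f} p with does (f ≟ᵉ e)
  ... | true  = ≡.refl
  ... | false = agree p

  Insensitive : V × V → (Cfg → Carrier) → Set
  Insensitive e F = ∀ D → F (add e D) ≈ F D

  dependsOn⇒insensitive : ∀ {P F e} → DependsOn P F → ¬ P e → Insensitive e F
  dependsOn⇒insensitive {P} dep ¬p D = dep λ {f} p → add-other D λ { ≡.refl → ¬p p }

  -- For distinct edges: the sum over the subsets X of `es` of the weight of X times the value of
  -- `F` at D with X added.
  subsetSum : List (V × V) → (Cfg → Carrier) → Cfg → Carrier
  subsetSum []       F D = F D
  subsetSum (e ∷ es) F D = subsetSum es F D + w e * subsetSum es F (add e D)

  total : List (V × V) → Carrier
  total []       = 1#
  total (e ∷ es) = (1# + w e) * total es

  -- An edge of weight 0 may break the invariant, since its branch is multiplied by 0. Loops are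
  -- discarded in this way.
  subsetSum-cong-invariant : ∀ es {F G : Cfg → Carrier} (Inv : Cfg → Set) →
    (∀ {e} → e ∈ es → w e ≈ 0# ⊎ (∀ {D} → Inv D → Inv (add e D))) →
    (∀ {D} → Inv D → F D ≈ G D) → ∀ {D} → Inv D → subsetSum es F D ≈ subsetSum es G D
  subsetSum-cong-invariant []       Inv stable eq inv = eq inv
  subsetSum-cong-invariant (e ∷ es) Inv stable eq inv = +-cong
    (subsetSum-cong-invariant es Inv (λ p → stable (there p)) eq inv)
    ([ (λ w≈0 → trans (*-congʳ w≈0) (trans (zeroˡ _) (sym (trans (*-congʳ w≈0) (zeroˡ _)))))
     , (λ keep → *-congˡ (subsetSum-cong-invariant es Inv (λ p → stable (there p)) eq (keep inv))) ]′ (stable (here ≡.refl)))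

  subsetSum-cong : ∀ es {F G : Cfg → Carrier} → (∀ D → F D ≈ G D) → ∀ D → subsetSum es F D ≈ subsetSum es G D
  subsetSum-cong es eq D = subsetSum-cong-invariant es (λ _ → ⊤) (λ _ → inj₂ λ _ → tt) (λ {D} _ → eq D) tt

  subsetSum-dependsOn : ∀ es {P F} → DependsOn P F → DependsOn P (subsetSum es F)
  subsetSum-dependsOn []       dep agree = dep agree
  subsetSum-dependsOn (e ∷ es) {P} dep agree =
    +-cong (subsetSum-dependsOn es dep agree) (*-congˡ (subsetSum-dependsOn es dep (λ {f} → add-agree {P} e agree {f})))

  subsetSum-++ : ∀ es fs F D → subsetSum (es ++ fs) F D ≡ subsetSum es (subsetSum fs F) D
  subsetSum-++ []       fs F D = ≡.refl
  subsetSum-++ (e ∷ es) fs F D = ≡.cong₂ (λ a b → a + w e * b) (subsetSum-++ es fs F D) (subsetSum-++ es fs F (add e D))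

  add-comm : ∀ e f D → Agree Everywhere (add e (add f D)) (add f (add e D))
  add-comm e f D {g} _ with does (g ≟ᵉ e) | does (g ≟ᵉ f)
  ... | true  | true  = ≡.refl
  ... | true  | false = ≡.refl
  ... | false | true  = ≡.refl
  ... | false | false = ≡.refl

  -- Two edges added in either order give digraphs that only agree pointwise, hence the condition on
  -- `F`.
  subsetSum-↭ : ∀ {es fs F} → es ↭ fs → DependsOn Everywhere F → ∀ D → subsetSum es F D ≈ subsetSum fs F D
  subsetSum-↭ Perm.refl          ext D = refl
  subsetSum-↭ (Perm.prep e p)    ext D = +-cong (subsetSum-↭ p ext D) (*-congˡ (subsetSum-↭ p ext (add e D)))
  subsetSum-↭ (Perm.trans p q)   ext D = trans (subsetSum-↭ p ext D) (subsetSum-↭ q ext D)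
  subsetSum-↭ {F = F} (Perm.swap {es} {fs} e f p) ext D = begin
    (S D + w f * S (add f D)) + w e * (S (add e D) + w f * S (add f (add e D)))
      ≈⟨ solve 6 (λ a b c d we wf → (a :+ wf :* b) :+ we :* (c :+ wf :* d) := (a :+ we :* c) :+ wf :* (b :+ we :* d))
           refl (S D) (S (add f D)) (S (add e D)) (S (add f (add e D))) (w e) (w f) ⟩
    (S D + w e * S (add e D)) + w f * (S (add f D) + w e * S (add f (add e D)))
      ≈⟨ +-cong (+-cong (subsetSum-↭ p ext D) (*-congˡ (subsetSum-↭ p ext _))) (*-congˡ (+-cong (subsetSum-↭ p ext _)
           (*-congˡ (trans (subsetSum-↭ p ext _) (subsetSum-dependsOn fs ext (add-comm f e D)))))) ⟩
    (T D + w e * T (add e D)) + w f * (T (add f D) + w e * T (add e (add f D))) ∎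
    where
    S = subsetSum es F
    T = subsetSum fs F

  subsetSum-+ : ∀ es F G D → subsetSum es (λ D → F D + G D) D ≈ subsetSum es F D + subsetSum es G D
  subsetSum-+ []       F G D = refl
  subsetSum-+ (e ∷ es) F G D = trans (+-cong (subsetSum-+ es F G D)
    (trans (*-congˡ (subsetSum-+ es F G (add e D))) (distribˡ _ _ _))) (+-interchange _ _ _ _)

  subsetSum-*ʳ : ∀ es F {G : Cfg → Carrier} → (∀ {e} → e ∈ es → Insensitive e G) → ∀ D →
    subsetSum es (λ D → F D * G D) D ≈ subsetSum es F D * G D
  subsetSum-*ʳ []       F     ins D = refl
  subsetSum-*ʳ (e ∷ es) F {G} ins D = begin
    subsetSum es (λ D → F D * G D) D + w e * subsetSum es (λ D → F D * G D) (add e D)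
      ≈⟨ +-cong (subsetSum-*ʳ es F (λ p → ins (there p)) D) (*-congˡ (trans (subsetSum-*ʳ es F (λ p → ins (there p)) (add e D))
           (*-congˡ (ins (here ≡.refl) D)))) ⟩
    subsetSum es F D * G D + w e * (subsetSum es F (add e D) * G D)
      ≈⟨ solve 4 (λ a b c d → a :* d :+ b :* (c :* d) := (a :+ b :* c) :* d) refl _ _ _ _ ⟩
    (subsetSum es F D + w e * subsetSum es F (add e D)) * G D ∎

  subsetSum-1 : ∀ es D → subsetSum es (λ _ → 1#) D ≈ total es
  subsetSum-1 []       D = refl
  subsetSum-1 (e ∷ es) D = trans (+-cong (trans (subsetSum-1 es D) (sym (*-identityˡ _))) (*-congˡ (subsetSum-1 es (add e D))))
    (sym (distribʳ _ _ _))

  subsetSum-insensitive : ∀ es {F : Cfg → Carrier} → (∀ {e} → e ∈ es → Insensitive e F) → ∀ D →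
    subsetSum es F D ≈ total es * F D
  subsetSum-insensitive es {F} ins D = begin
    subsetSum es F D                      ≈⟨ subsetSum-cong es (λ D → *-identityˡ (F D)) D ⟨
    subsetSum es (λ D → 1# * F D) D       ≈⟨ subsetSum-*ʳ es (λ _ → 1#) ins D ⟩
    subsetSum es (λ _ → 1#) D * F D       ≈⟨ *-congʳ (subsetSum-1 es D) ⟩
    total es * F D                        ∎

  -- Only the empty subset contributes: any added edge makes `F` vanish.
  subsetSum-excluded : ∀ es {F : Cfg → Carrier} → (∀ {e} → e ∈ es → ∀ D → F (add e D) ≈ 0#) → ∀ D →
    subsetSum es F D ≈ F D
  subsetSum-excluded []       excl D = refl
  subsetSum-excluded (e ∷ es) {F} excl D = begin
    subsetSum es F D + w e * subsetSum es F (add e D)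
      ≈⟨ +-cong (subsetSum-excluded es (λ p → excl (there p)) D)
           (*-congˡ (trans (subsetSum-excluded es (λ p → excl (there p)) (add e D)) (excl (here ≡.refl) D))) ⟩
    F D + w e * 0#  ≈⟨ trans (+-congˡ (zeroʳ _)) (+-identityʳ _) ⟩
    F D             ∎

  subsetSum-*ˡ : ∀ es c F D → subsetSum es (λ D → c * F D) D ≈ c * subsetSum es F D
  subsetSum-*ˡ es c F D = trans (subsetSum-cong es (λ _ → *-comm c _) D)
    (trans (subsetSum-*ʳ es F {λ _ → c} (λ _ _ → refl) D) (*-comm _ c))

  subsetSum-neg : ∀ es F D → subsetSum es (λ D → - F D) D ≈ - subsetSum es F D
  subsetSum-neg es F D = trans (subsetSum-cong es (λ _ → sym (-1*x≈-x _)) D)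
    (trans (subsetSum-*ˡ es (- 1#) F D) (-1*x≈-x _))

  subsetSum-splitSum : ∀ es xs (F : List V → List V → Cfg → Carrier) D →
    subsetSum es (λ D → splitSum xs (λ ys zs → F ys zs D)) D ≈ splitSum xs (λ ys zs → subsetSum es (F ys zs) D)
  subsetSum-splitSum es []       F D = refl
  subsetSum-splitSum es (x ∷ xs) F D = trans (subsetSum-+ es _ _ D)
    (+-cong (subsetSum-splitSum es xs (λ ys zs → F (x ∷ ys) zs) D) (subsetSum-splitSum es xs (λ ys zs → F ys (x ∷ zs)) D))

  Between : List V → List V → V × V → Set
  Between xs ys (a , b) = a ∈ xs × b ∈ ys

  ∈-product : ∀ xs ys {e} → e ∈ cartesianProduct xs ys → Between xs ys e
  ∈-product xs ys = ∈-cartesianProduct⁻ xs ys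

  strong-dependsOn : ∀ xs → DependsOn (Between xs xs) (λ D → ⟦ strong? D xs ⟧)
  strong-dependsOn xs {D} {D′} agree = ⟦⟧-cong (strong? D xs) (strong? D′ xs)
    (λ s p q → walk-map (λ a∈ b∈ e → ≡.trans (≡.sym (agree (a∈ , b∈))) e) p (s p q))
    (λ s p q → walk-map (λ a∈ b∈ e → ≡.trans (agree (a∈ , b∈)) e) p (s p q))

  noEdges-dependsOn : ∀ xs ys → DependsOn (Between xs ys) (λ D → ⟦ noEdges? D xs ys ⟧)
  noEdges-dependsOn xs ys {D} {D′} agree = ⟦⟧-cong (noEdges? D xs ys) (noEdges? D′ xs ys)
    (λ none p q → ≡.trans (≡.sym (agree (p , q))) (none p q)) (λ none p q → ≡.trans (agree (p , q)) (none p q))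

  isolated-factor : ∀ C Z D → ⟦ isolated? D C Z ⟧ ≈ ⟦ strong? D C ⟧ * (⟦ noEdges? D C Z ⟧ * ⟦ noEdges? D Z C ⟧)
  isolated-factor C Z D = trans (⟦⟧-× (strong? D C) (noEdges? D C Z ×-dec noEdges? D Z C)) (*-congˡ (⟦⟧-× (noEdges? D C Z) (noEdges? D Z C)))

  signWithin-dependsOn : ∀ n xs → DependsOn (Between xs xs) (signWithin n xs)
  signWithin-dependsOn zero    xs       agree = refl
  signWithin-dependsOn (suc n) []       agree = refl
  signWithin-dependsOn (suc n) (v ∷ xs) {D} {D′} agree = -‿cong (splitSum-cong xs λ {C} {Z} s →
    let C⊆ : ∀ {x} → x ∈ v ∷ C → x ∈ v ∷ xs
        C⊆ = ∈-interleavingˡ (consˡ s)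
        Z⊆ : ∀ {x} → x ∈ Z → x ∈ v ∷ xs
        Z⊆ = ∈-interleavingʳ (consˡ s)
    in *-cong (trans (isolated-factor (v ∷ C) Z D) (trans (*-cong
         (strong-dependsOn (v ∷ C) λ (p , q) → agree (C⊆ p , C⊆ q))
         (*-cong (noEdges-dependsOn (v ∷ C) Z λ (p , q) → agree (C⊆ p , Z⊆ q))
           (noEdges-dependsOn Z (v ∷ C) λ (p , q) → agree (Z⊆ p , C⊆ q)))) (sym (isolated-factor (v ∷ C) Z D′))))
       (signWithin-dependsOn n Z λ (p , q) → agree (Z⊆ p , Z⊆ q)))

  sign-dependsOn : ∀ xs → DependsOn (Between xs xs) (sign xs)
  sign-dependsOn xs = signWithin-dependsOn (length xs) xs

  noEdges-∅ : ∀ xs ys → ⟦ noEdges? ∅ xs ys ⟧ ≈ 1#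
  noEdges-∅ xs ys = ⟦⟧-true (noEdges? ∅ xs ys) (λ _ _ → ≡.refl)

  noEdges-excluded : ∀ xs ys {e} → Between xs ys e → ∀ D → ⟦ noEdges? (add e D) xs ys ⟧ ≈ 0#
  noEdges-excluded xs ys {e} (p , q) D = ⟦⟧-false (noEdges? (add e D) xs ys) λ none → true≢false (add-same e D) (none p q)

  strongSum : List V → Carrier
  strongSum xs = subsetSum (cartesianProduct xs xs) (λ D → ⟦ strong? D xs ⟧) ∅

  signSum : List V → Carrier
  signSum xs = subsetSum (cartesianProduct xs xs) (sign xs) ∅

  module _ {as zs us : List V} (unique : Unique us) (s : Interleaving as zs us) where
    private
      aa = cartesianProduct as as
      az = cartesianProduct as zs
      za = cartesianProduct zs as
      zz = cartesianProduct zs zs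

      disj : ∀ {x} → x ∈ as → x ∈ zs → ⊥
      disj = interleaving-disjoint unique s

    subsetSum-square : ∀ {F} → DependsOn Everywhere F → ∀ D → subsetSum (cartesianProduct us us) F D ≈
      subsetSum aa (subsetSum zz (subsetSum (az ++ za) F)) D
    subsetSum-square {F} ext D = trans (subsetSum-↭ (cartesianProduct-square s) ext D)
      (trans (reflexive (subsetSum-++ aa (zz ++ (az ++ za)) F D))
        (subsetSum-cong aa (λ D → reflexive (subsetSum-++ zz (az ++ za) F D)) D))

    -- The four blocks of edges are independent. Those inside `as` carry the sign, those from `zs`
    -- to `as` are forbidden, and the other two are free.
    source-weight : subsetSum (cartesianProduct us us) (λ D → ⟦ noEdges? D zs as ⟧ * sign as D) ∅ ≈
      signSum as * (total az * total zz)
    source-weight = begin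
      subsetSum (cartesianProduct us us) F ∅
        ≈⟨ subsetSum-square (λ agree → *-cong (dependsOn-weaken (noEdges-dependsOn zs as) agree)
             (dependsOn-weaken (sign-dependsOn as) agree)) ∅ ⟩
      subsetSum aa (subsetSum zz (subsetSum (az ++ za) F)) ∅
        ≈⟨ subsetSum-cong aa (λ D → trans (subsetSum-cong zz inner D) (trans (subsetSum-*ˡ zz _ _ D)
             (trans (*-congˡ (subsetSum-insensitive zz (λ e∈ → F-insensitive (proj₂ (∈-product zs zs e∈))) D)) (sym (*-assoc _ _ _))))) ∅ ⟩
      subsetSum aa (λ D → (total az * total zz) * F D) ∅
        ≈⟨ subsetSum-*ˡ aa _ F ∅ ⟩
      (total az * total zz) * subsetSum aa F ∅
        ≈⟨ *-congˡ (trans (subsetSum-cong aa (λ _ → *-comm _ _) ∅) (trans (subsetSum-*ʳ aa (sign as)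
             (λ e∈ → dependsOn⇒insensitive (noEdges-dependsOn zs as) λ (z∈ , _) → disj (proj₁ (∈-product as as e∈)) z∈) ∅)
             (trans (*-congˡ (noEdges-∅ zs as)) (*-identityʳ _)))) ⟩
      (total az * total zz) * signSum as
        ≈⟨ *-comm _ _ ⟩
      signSum as * (total az * total zz) ∎
      where
      F : Cfg → Carrier
      F D = ⟦ noEdges? D zs as ⟧ * sign as D

      F-insensitive : ∀ {a z} → z ∈ zs → Insensitive (a , z) F
      F-insensitive z∈ D = *-cong (dependsOn⇒insensitive (noEdges-dependsOn zs as) (λ (_ , a∈) → disj a∈ z∈) D)
        (dependsOn⇒insensitive (sign-dependsOn as) (λ (_ , a∈) → disj a∈ z∈) D)

      inner : ∀ D → subsetSum (az ++ za) F D ≈ total az * F D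
      inner D = begin
        subsetSum (az ++ za) F D
          ≡⟨ subsetSum-++ az za F D ⟩
        subsetSum az (subsetSum za F) D
          ≈⟨ subsetSum-cong az (subsetSum-excluded za λ e∈ D → trans (*-congʳ
               (noEdges-excluded zs as (∈-product zs as e∈) D)) (zeroˡ _)) D ⟩
        subsetSum az F D
          ≈⟨ subsetSum-insensitive az (λ e∈ → F-insensitive (proj₂ (∈-product as zs e∈))) D ⟩
        total az * F D ∎

    -- Both crossing blocks are forbidden, and the conditions on the two inner blocks are
    -- independent.
    isolated-weight : subsetSum (cartesianProduct us us) (λ D → ⟦ isolated? D as zs ⟧ * sign zs D) ∅ ≈
      strongSum as * signSum zs
    isolated-weight = begin
      subsetSum (cartesianProduct us us) (λ D → ⟦ isolated? D as zs ⟧ * sign zs D) ∅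
        ≈⟨ subsetSum-cong (cartesianProduct us us) (λ D → trans (*-comm _ _) (*-congˡ (isolated-factor as zs D))) ∅ ⟩
      subsetSum (cartesianProduct us us) F ∅
        ≈⟨ subsetSum-square (λ agree → *-cong (dependsOn-weaken (sign-dependsOn zs) agree)
             (*-cong (dependsOn-weaken (strong-dependsOn as) agree) (*-cong
               (dependsOn-weaken (noEdges-dependsOn as zs) agree) (dependsOn-weaken (noEdges-dependsOn zs as) agree)))) ∅ ⟩
      subsetSum aa (subsetSum zz (subsetSum (az ++ za) F)) ∅
        ≈⟨ subsetSum-cong aa (λ D → trans (subsetSum-cong zz inner D) (subsetSum-*ʳ zz (sign zs) zz-insensitive D)) ∅ ⟩
      subsetSum aa (λ D → subsetSum zz (sign zs) D * (S D * N D)) ∅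
        ≈⟨ subsetSum-cong aa (λ D → *-comm _ _) ∅ ⟩
      subsetSum aa (λ D → (S D * N D) * subsetSum zz (sign zs) D) ∅
        ≈⟨ subsetSum-*ʳ aa _ (λ e∈ → dependsOn⇒insensitive (subsetSum-dependsOn zz (sign-dependsOn zs))
             λ (z∈ , _) → disj (proj₁ (∈-product as as e∈)) z∈) ∅ ⟩
      subsetSum aa (λ D → S D * N D) ∅ * signSum zs
        ≈⟨ *-congʳ (trans (subsetSum-*ʳ aa S aa-insensitive ∅)
             (trans (*-congˡ (trans (*-cong (noEdges-∅ as zs) (noEdges-∅ zs as)) (*-identityˡ _))) (*-identityʳ _))) ⟩
      strongSum as * signSum zs ∎
      where
      S N F : Cfg → Carrier
      S D = ⟦ strong? D as ⟧
      N D = ⟦ noEdges? D as zs ⟧ * ⟦ noEdges? D zs as ⟧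
      F D = sign zs D * (S D * N D)

      zz-insensitive : ∀ {e} → e ∈ zz → Insensitive e (λ D → S D * N D)
      zz-insensitive e∈ D with ∈-product zs zs e∈
      ... | p , q = *-cong (dependsOn⇒insensitive (strong-dependsOn as) (λ (a∈ , _) → disj a∈ p) D)
        (*-cong (dependsOn⇒insensitive (noEdges-dependsOn as zs) (λ (a∈ , _) → disj a∈ p) D)
          (dependsOn⇒insensitive (noEdges-dependsOn zs as) (λ (_ , a∈) → disj a∈ q) D))

      aa-insensitive : ∀ {e} → e ∈ aa → Insensitive e N
      aa-insensitive e∈ D with ∈-product as as e∈
      ... | p , q = *-cong (dependsOn⇒insensitive (noEdges-dependsOn as zs) (λ (_ , z∈) → disj q z∈) D)
        (dependsOn⇒insensitive (noEdges-dependsOn zs as) (λ (z∈ , _) → disj p z∈) D)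

      N-vanishes⇒F-vanishes : ∀ {D} → N D ≈ 0# → F D ≈ 0#
      N-vanishes⇒F-vanishes N≈0 = trans (*-congˡ (trans (*-congˡ N≈0) (zeroʳ _))) (zeroʳ _)

      inner : ∀ D → subsetSum (az ++ za) F D ≈ F D
      inner D = begin
        subsetSum (az ++ za) F D
          ≡⟨ subsetSum-++ az za F D ⟩
        subsetSum az (subsetSum za F) D
          ≈⟨ subsetSum-cong az (subsetSum-excluded za λ e∈ D → N-vanishes⇒F-vanishes
               (trans (*-congˡ (noEdges-excluded zs as (∈-product zs as e∈) D)) (zeroʳ _))) D ⟩
        subsetSum az F D
          ≈⟨ subsetSum-excluded az (λ e∈ D → N-vanishes⇒F-vanishes
               (trans (*-congʳ (noEdges-excluded as zs (∈-product as zs e∈) D)) (zeroˡ _))) D ⟩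
        F D ∎

  signSum-∷ : ∀ v xs → Unique (v ∷ xs) →
    signSum (v ∷ xs) ≈ - splitSum xs (λ C Z → strongSum (v ∷ C) * signSum Z)
  signSum-∷ v xs unique = begin
    subsetSum es (sign (v ∷ xs)) ∅
      ≈⟨ subsetSum-cong es (sign-∷ v xs) ∅ ⟩
    subsetSum es (λ D → - splitSum xs (λ C Z → ⟦ isolated? D (v ∷ C) Z ⟧ * sign Z D)) ∅
      ≈⟨ subsetSum-neg es _ ∅ ⟩
    - subsetSum es (λ D → splitSum xs (λ C Z → ⟦ isolated? D (v ∷ C) Z ⟧ * sign Z D)) ∅
      ≈⟨ -‿cong (trans (subsetSum-splitSum es xs _ ∅) (splitSum-cong xs λ s → isolated-weight unique (consˡ s))) ⟩
    - splitSum xs (λ C Z → strongSum (v ∷ C) * signSum Z) ∎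
    where es = cartesianProduct (v ∷ xs) (v ∷ xs)

  -- The signs cancel for each digraph separately. Exchanging the sum over digraphs with the sum
  -- over `A` turns this into a relation between block weights.
  sourceSum-total : ∀ v xs → Unique (v ∷ xs) →
    splitSum (v ∷ xs) (λ A Z → signSum A * (total (cartesianProduct A Z) * total (cartesianProduct Z Z))) ≈ 0#
  sourceSum-total v xs unique = begin
    splitSum (v ∷ xs) (λ A Z → signSum A * (total (cartesianProduct A Z) * total (cartesianProduct Z Z)))
      ≈⟨ splitSum-cong (v ∷ xs) (λ s → source-weight unique s) ⟨
    splitSum (v ∷ xs) (λ A Z → subsetSum es (λ D → ⟦ noEdges? D Z A ⟧ * sign A D) ∅)
      ≈⟨ subsetSum-splitSum es (v ∷ xs) (λ A Z D → ⟦ noEdges? D Z A ⟧ * sign A D) ∅ ⟨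
    subsetSum es (sourceSum (v ∷ xs)) ∅
      ≈⟨ subsetSum-cong es (λ D → trans (sourceSum-vanishes D v xs unique) (sym (zeroʳ 1#))) ∅ ⟩
    subsetSum es (λ D → 1# * 0#) ∅
      ≈⟨ trans (subsetSum-*ʳ es (λ _ → 1#) {λ _ → 0#} (λ _ _ → refl) ∅) (zeroʳ _) ⟩
    0# ∎
    where es = cartesianProduct (v ∷ xs) (v ∷ xs)

-- Invariance under weight-preserving relabelling.

module Relabelling (R : CommutativeRing 0ℓ 0ℓ) {V V′ : Set}
  (_≟_ : DecidableEquality V) (_≟′_ : DecidableEquality V′)
  (w : V × V → CommutativeRing.Carrier R) (w′ : V′ × V′ → CommutativeRing.Carrier R)
  (f : V → V′) (f-injective : ∀ {a b} → f a ≡ f b → a ≡ b)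
  (f-weight : ∀ a b → CommutativeRing._≈_ R (w (a , b)) (w′ (f a , f b))) where
  open RingTools R
  open Indicators R
  private
    module S = EdgeSums R _≟_ w
    module S′ = EdgeSums R _≟′_ w′
    module W = Walks _≟_
    module W′ = Walks _≟′_

  f² : V × V → V′ × V′
  f² (a , b) = f a , f b

  f²-injective : ∀ {e e′} → f² e ≡ f² e′ → e ≡ e′
  f²-injective eq = ≡.cong₂ _,_ (f-injective (≡.cong proj₁ eq)) (f-injective (≡.cong proj₂ eq))

  Pullback : W.Cfg → W′.Cfg → Set
  Pullback D D′ = ∀ e → D′ (f² e) ≡ D e

  add-pullback : ∀ {D D′} e → Pullback D D′ → Pullback (S.add e D) (S′.add (f² e) D′)
  add-pullback {D} {D′} e pb g with g S.≟ᵉ e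
  ... | yes ≡.refl = S′.add-same (f² e) D′
  ... | no  g≢e    = ≡.trans (S′.add-other D′ (λ eq → g≢e (f²-injective eq))) (pb g)

  subsetSum-pullback : ∀ es {F F′} → (∀ {D D′} → Pullback D D′ → F D ≈ F′ D′) →
    ∀ {D D′} → Pullback D D′ → S.subsetSum es F D ≈ S′.subsetSum (map f² es) F′ D′
  subsetSum-pullback []       eq pb = eq pb
  subsetSum-pullback (e ∷ es) eq {D} {D′} pb = +-cong (subsetSum-pullback es eq pb)
    (*-cong (f-weight _ _) (subsetSum-pullback es eq (add-pullback {D} {D′} e pb)))

  map-cartesianProduct : ∀ xs ys → map f² (cartesianProduct xs ys) ≡ cartesianProduct (map f xs) (map f ys)
  map-cartesianProduct []       ys = ≡.refl
  map-cartesianProduct (x ∷ xs) ys = ≡.trans (List.map-++ f² (map (x ,_) ys) _)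
    (≡.cong₂ _++_ (≡.trans (≡.sym (List.map-∘ ys)) (List.map-∘ ys)) (map-cartesianProduct xs ys))

  module _ {D D′} (pb : Pullback D D′) {xs : List V} where

    walk⁺ : ∀ {a b} → W.Walk D xs a b → W′.Walk D′ (map f xs) (f a) (f b)
    walk⁺ W.done          = W′.done
    walk⁺ (W.step e p w) = W′.step (≡.trans (pb _) e) (∈-map⁺ f p) (walk⁺ w)

    -- The end points come with equations because indices of the form `f a` would block matching on
    -- the walk.
    walk⁻ : ∀ {a b a′ b′} → a′ ≡ f a → b′ ≡ f b → W′.Walk D′ (map f xs) a′ b′ → W.Walk D xs a b
    walk⁻ eq eq′ W′.done with f-injective (≡.trans (≡.sym eq) eq′)
    ... | ≡.refl = W.done
    walk⁻ ≡.refl eq′ (W′.step e p w) with ∈-map⁻ f p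
    ... | c , c∈ , ≡.refl = W.step (≡.trans (≡.sym (pb _)) e) c∈ (walk⁻ ≡.refl eq′ w)

    strong⁺ : W.Strong D xs → W′.Strong D′ (map f xs)
    strong⁺ s p q with ∈-map⁻ f p | ∈-map⁻ f q
    ... | _ , p′ , ≡.refl | _ , q′ , ≡.refl = walk⁺ (s p′ q′)

    strong⁻ : W′.Strong D′ (map f xs) → W.Strong D xs
    strong⁻ s p q = walk⁻ ≡.refl ≡.refl (s (∈-map⁺ f p) (∈-map⁺ f q))

  strongSum-map : ∀ xs → S.strongSum xs ≈ S′.strongSum (map f xs)
  strongSum-map xs = trans
    (subsetSum-pullback (cartesianProduct xs xs)
      (λ pb → ⟦⟧-cong (W.strong? _ xs) (W′.strong? _ (map f xs)) (strong⁺ pb) (strong⁻ pb)) (λ _ → ≡.refl))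
    (reflexive (≡.cong (λ es → S′.subsetSum es (λ D → ⟦ W′.strong? D (map f xs) ⟧) S′.∅) (map-cartesianProduct xs xs)))

-- Homogeneous q-integers and Gaussian binomial sums.

module GaussianSums (R : CommutativeRing 0ℓ 0ℓ) (a b : CommutativeRing.Carrier R) where
  open RingTools R

  -- The homogeneous q-integer aⁿ⁻¹ + aⁿ⁻²b + ⋯ + bⁿ⁻¹.
  bracket : ℕ → Carrier
  bracket zero    = 0#
  bracket (suc n) = a * bracket n + b ^ n

  factorial : ℕ → Carrier
  factorial zero    = 1#
  factorial (suc n) = factorial n * bracket (suc n)

  -- Sum of f k (n ∸ k) over the subsets of size k of an n-element chain, weighted by a to the number of
  -- ascents and b to the number of descents from the subset to its complement.
  gaussSum : ℕ → (ℕ → ℕ → Carrier) → Carrier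
  gaussSum zero    f = f 0 0
  gaussSum (suc n) f = gaussSum n (λ k m → a ^ m * f (suc k) m + b ^ k * f k (suc m))

  gaussSum-cong : ∀ n {f g : ℕ → ℕ → Carrier} → (∀ k m → k ℕ.+ m ≡ n → f k m ≈ g k m) → gaussSum n f ≈ gaussSum n g
  gaussSum-cong zero    eq = eq 0 0 ≡.refl
  gaussSum-cong (suc n) eq = gaussSum-cong n λ k m p →
    +-cong (*-congˡ (eq (suc k) m (≡.cong suc p))) (*-congˡ (eq k (suc m) (≡.trans (ℕ.+-suc k m) (≡.cong suc p))))

  -- Both sides are `bracket (suc m)`, with the pure power of a or the pure power of b split off.
  bracket-difference : ∀ m → a ^ m + b * bracket m ≈ a * bracket m + b ^ m
  bracket-difference zero    = trans (+-congˡ (zeroʳ b)) (trans (+-comm _ _) (+-congʳ (sym (zeroʳ a))))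
  bracket-difference (suc m) = begin
    a * a ^ m + b * (a * bracket m + b ^ m)
      ≈⟨ solve 5 (λ a b x y z → a :* x :+ b :* (a :* y :+ z) := a :* (x :+ b :* y) :+ b :* z) refl a b (a ^ m) (bracket m) (b ^ m) ⟩
    a * (a ^ m + b * bracket m) + b * b ^ m
      ≈⟨ +-congʳ (*-congˡ (bracket-difference m)) ⟩
    a * (a * bracket m + b ^ m) + b * b ^ m ∎

  -- Among the monomials of degree k + m - 1, those with exponent of a at least m form the first
  -- term and the others the second. This is the q-Pascal rule with denominators cleared.
  bracket-+ : ∀ k m → a ^ m * bracket k + b ^ k * bracket m ≈ bracket (k ℕ.+ m)
  bracket-+ zero    m = trans (+-cong (zeroʳ _) (*-identityˡ _)) (+-identityˡ _)
  bracket-+ (suc k) m = begin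
    a ^ m * (a * bracket k + b ^ k) + (b * b ^ k) * bracket m
      ≈⟨ solve 6 (λ a b x y z t → x :* (a :* y :+ z) :+ (b :* z) :* t := a :* (x :* y) :+ z :* (x :+ b :* t)) refl
           a b (a ^ m) (bracket k) (b ^ k) (bracket m) ⟩
    a * (a ^ m * bracket k) + b ^ k * (a ^ m + b * bracket m)
      ≈⟨ +-congˡ (*-congˡ (bracket-difference m)) ⟩
    a * (a ^ m * bracket k) + b ^ k * (a * bracket m + b ^ m)
      ≈⟨ solve 5 (λ a x z t s → a :* x :+ z :* (a :* t :+ s) := a :* (x :+ z :* t) :+ z :* s) refl
           a (a ^ m * bracket k) (b ^ k) (bracket m) (b ^ m) ⟩
    a * (a ^ m * bracket k + b ^ k * bracket m) + b ^ k * b ^ m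
      ≈⟨ +-cong (*-congˡ (bracket-+ k m)) (sym (^-homo-* b k m)) ⟩
    a * bracket (k ℕ.+ m) + b ^ (k ℕ.+ m) ∎

  -- The Gaussian binomial coefficient is `factorial n` over `factorial k * factorial m`, here
  -- without division. The induction step rests on `bracket-+`.
  gaussSum-conv : ∀ n (h : ℕ → ℕ → Carrier) →
    gaussSum n (λ k m → (factorial k * factorial m) * h k m) ≈ factorial n * conv n h
  gaussSum-conv zero    h = *-congʳ (*-identityˡ 1#)
  gaussSum-conv (suc n) h = begin
    gaussSum n (λ k m → a ^ m * ((factorial (suc k) * factorial m) * h (suc k) m) +
                        b ^ k * ((factorial k * factorial (suc m)) * h k (suc m)))
      ≈⟨ gaussSum-cong n (λ k m _ → solve 8 (λ x y fk fm bk bm p q →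
           x :* (((fk :* bk) :* fm) :* p) :+ y :* ((fk :* (fm :* bm)) :* q) :=
           (fk :* fm) :* (x :* bk :* p :+ y :* bm :* q)) refl
           (a ^ m) (b ^ k) (factorial k) (factorial m) (bracket (suc k)) (bracket (suc m)) (h (suc k) m) (h k (suc m))) ⟩
    gaussSum n (λ k m → (factorial k * factorial m) *
                        (a ^ m * bracket (suc k) * h (suc k) m + b ^ k * bracket (suc m) * h k (suc m)))
      ≈⟨ gaussSum-conv n _ ⟩
    factorial n * conv n (λ k m → a ^ m * bracket (suc k) * h (suc k) m + b ^ k * bracket (suc m) * h k (suc m))
      ≈⟨ *-congˡ (conv-+ n _ _) ⟩
    factorial n * (conv n (λ k m → a ^ m * bracket (suc k) * h (suc k) m) +
                   conv n (λ k m → b ^ k * bracket (suc m) * h k (suc m)))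
      -- `bracket 0` is 0, so each sum can be extended by its missing boundary term, k = 0 in the
      -- first and m = 0 in the second.
      ≈⟨ *-congˡ (+-cong (sym (trans (+-congʳ (trans (*-congʳ (zeroʳ _)) (zeroˡ _))) (+-identityˡ _)))
           (sym (trans (conv-last n (λ k m → b ^ k * bracket m * h k m))
             (trans (+-congˡ (trans (*-congʳ (zeroʳ _)) (zeroˡ _))) (+-identityʳ _))))) ⟩
    factorial n * (conv (suc n) (λ k m → a ^ m * bracket k * h k m) + conv (suc n) (λ k m → b ^ k * bracket m * h k m))
      ≈⟨ *-congˡ (conv-+ (suc n) (λ k m → a ^ m * bracket k * h k m) (λ k m → b ^ k * bracket m * h k m)) ⟨
    factorial n * conv (suc n) (λ k m → a ^ m * bracket k * h k m + b ^ k * bracket m * h k m)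
      ≈⟨ *-congˡ (conv-cong (suc n) λ k m k+m≡ → trans (sym (distribʳ (h k m) _ _))
           (*-congʳ (trans (bracket-+ k m) (reflexive (≡.cong bracket k+m≡))))) ⟩
    factorial n * conv (suc n) (λ k m → bracket (suc n) * h k m)
      ≈⟨ *-congˡ (conv-*ˡ (suc n) (bracket (suc n)) h) ⟨
    factorial n * (bracket (suc n) * conv (suc n) h)
      ≈⟨ *-assoc _ _ _ ⟨
    (factorial n * bracket (suc n)) * conv (suc n) h ∎

-- Digraphs on a chain, weighted by ascents and descents.

AllPairs-lookup : ∀ {A : Set} {_∼_ : A → A → Set} {xs : List A} → AllPairs _∼_ xs →
  ∀ {i j} → i Fin.< j → lookup xs i ∼ lookup xs j
AllPairs-lookup {xs = x ∷ xs} (r ∷ _)  {zero}  {suc j} _         = All.lookup r (∈-lookup j)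
AllPairs-lookup {xs = x ∷ xs} (_ ∷ rs) {suc i} {suc j} (s≤s i<j) = AllPairs-lookup rs i<j

module Chains (R : CommutativeRing 0ℓ 0ℓ) (asc desc : CommutativeRing.Carrier R) where
  open RingTools R

  -- Loops get weight 0 instead of being left out, so that every block of edges is a full product of
  -- vertex lists.
  weight : ∀ {n} → Fin n × Fin n → Carrier
  weight (s , t) = if does (t Fin.<? s) then desc else if does (s Fin.<? t) then asc else 0#

  weight-desc : ∀ {n} {s t : Fin n} → t Fin.< s → weight (s , t) ≡ desc
  weight-desc {s = s} {t} t<s rewrite dec-true (t Fin.<? s) t<s = ≡.refl

  weight-asc : ∀ {n} {s t : Fin n} → s Fin.< t → weight (s , t) ≡ asc
  weight-asc {s = s} {t} s<t rewrite dec-false (t Fin.<? s) (ℕ.<-asym s<t) | dec-true (s Fin.<? t) s<t = ≡.refl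

  weight-loop : ∀ {n} (s : Fin n) → weight (s , s) ≡ 0#
  weight-loop s rewrite dec-false (s Fin.<? s) (ℕ.<-irrefl ≡.refl) = ≡.refl

  Increasing : ∀ {n} → List (Fin n) → Set
  Increasing = AllPairs Fin._<_

  increasing⇒unique : ∀ {n} {xs : List (Fin n)} → Increasing xs → Unique xs
  increasing⇒unique = AllPairs.map λ { x<y ≡.refl → ℕ.<-irrefl ≡.refl x<y }

  allFin-increasing : ∀ n → Increasing (allFin n)
  allFin-increasing n = AllPairs.tabulate⁺-< λ i<j → i<j

  module Edges {n : ℕ} = EdgeSums R {Fin n} Fin._≟_ weight
  open Edges using (strongSum; signSum; total; signSum-∷; sourceSum-total) public

  strongNumber signNumber : ℕ → Carrier
  strongNumber n = strongSum (allFin n)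
  signNumber n = signSum (allFin n)

  -- `lookup xs` is strictly increasing, hence injective, and preserves ascents and descents.
  strongSum-increasing : ∀ {n} {xs : List (Fin n)} → Increasing xs → strongSum xs ≈ strongNumber (length xs)
  strongSum-increasing {n} {xs} inc = sym (trans (strongSum-map (allFin (length xs)))
    (reflexive (≡.cong strongSum (≡.trans (List.map-tabulate (λ i → i) (lookup xs)) (List.tabulate-lookup xs)))))
    where
    f : Fin (length xs) → Fin n
    f = lookup xs
    f-mono : ∀ {i j} → i Fin.< j → f i Fin.< f j
    f-mono = AllPairs-lookup inc
    f-injective : ∀ {i j} → f i ≡ f j → i ≡ j
    f-injective {i} {j} eq with Fin.<-cmp i j
    ... | tri< i<j _ _ = contradiction (f-mono i<j) (ℕ.<-irrefl (≡.cong toℕ eq))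
    ... | tri≈ _ i≡j _ = i≡j
    ... | tri> _ _ j<i = contradiction (f-mono j<i) (ℕ.<-irrefl (≡.cong toℕ (≡.sym eq)))
    f-weight : ∀ i j → weight (i , j) ≈ weight (f i , f j)
    f-weight i j with Fin.<-cmp i j
    ... | tri< i<j _ _ = reflexive (≡.trans (weight-asc i<j) (≡.sym (weight-asc (f-mono i<j))))
    ... | tri≈ _ ≡.refl _ = reflexive (≡.trans (weight-loop i) (≡.sym (weight-loop (f i))))
    ... | tri> _ _ j<i = reflexive (≡.trans (weight-desc j<i) (≡.sym (weight-desc (f-mono j<i))))
    open Relabelling R Fin._≟_ Fin._≟_ weight weight f f-injective f-weight using (strongSum-map)

  module _ {n : ℕ} where
    open SplitSums R {Fin n} public

  a b : Carrier
  a = 1# + asc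
  b = 1# + desc

  -- At a = b = 1 the Gaussian sum is a plain sum over subsets and `factorial` is the ordinary
  -- factorial.
  module Subsets = GaussianSums R 1# 1#
  module Gauss = GaussianSums R a b

  1^n≈1 : ∀ n → 1# ^ n ≈ 1#
  1^n≈1 zero    = refl
  1^n≈1 (suc n) = trans (*-identityˡ _) (1^n≈1 n)

  splitSum-length : ∀ {n} (xs : List (Fin n)) f →
    splitSum xs (λ A Z → f (length A) (length Z)) ≈ Subsets.gaussSum (length xs) f
  splitSum-length []       f = refl
  splitSum-length (x ∷ xs) f = begin
    splitSum xs (λ A Z → f (suc (length A)) (length Z)) + splitSum xs (λ A Z → f (length A) (suc (length Z)))
      ≈⟨ splitSum-+ xs _ _ ⟨
    splitSum xs (λ A Z → f (suc (length A)) (length Z) + f (length A) (suc (length Z)))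
      ≈⟨ splitSum-length xs (λ k m → f (suc k) m + f k (suc m)) ⟩
    Subsets.gaussSum (length xs) (λ k m → f (suc k) m + f k (suc m))
      ≈⟨ Subsets.gaussSum-cong (length xs) (λ k m _ → +-cong
           (sym (trans (*-congʳ (1^n≈1 m)) (*-identityˡ _))) (sym (trans (*-congʳ (1^n≈1 k)) (*-identityˡ _)))) ⟩
    Subsets.gaussSum (suc (length xs)) f ∎

  total-++ : ∀ {n} (es fs : List (Fin n × Fin n)) → total (es ++ fs) ≈ total es * total fs
  total-++ []       fs = sym (*-identityˡ _)
  total-++ (e ∷ es) fs = trans (*-congˡ (total-++ es fs)) (sym (*-assoc _ _ _))

  total-↭ : ∀ {n} {es fs : List (Fin n × Fin n)} → es ↭ fs → total es ≈ total fs
  total-↭ Perm.refl         = refl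
  total-↭ (Perm.prep e p)   = *-congˡ (total-↭ p)
  total-↭ (Perm.swap e f p) = trans (*-congˡ (*-congˡ (total-↭ p)))
    (solve 3 (λ x y z → x :* (y :* z) := y :* (x :* z)) refl _ _ _)
  total-↭ (Perm.trans p q)  = trans (total-↭ p) (total-↭ q)

  total-row : ∀ {n} {x : Fin n} {ys} → All (x Fin.<_) ys → total (cartesianProduct (x ∷ []) ys) ≈ a ^ length ys
  total-row []            = refl
  total-row (x<y ∷ x<ys) = *-cong (+-congˡ (reflexive (weight-asc x<y))) (total-row x<ys)

  total-column : ∀ {n} {x : Fin n} {ys} → All (x Fin.<_) ys → total (cartesianProduct ys (x ∷ [])) ≈ b ^ length ys
  total-column []            = refl
  total-column (x<y ∷ x<ys) = *-cong (+-congˡ (reflexive (weight-desc x<y))) (total-column x<ys)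

  headInterleaving : ∀ {n} (x : Fin n) ys → Interleaving (x ∷ []) ys (x ∷ ys)
  headInterleaving x ys = consˡ (Interleaving.right (Pointwise.refl ≡.refl))

  total-∷ˡ : ∀ {n} (x : Fin n) as zs → All (x Fin.<_) zs →
    total (cartesianProduct (x ∷ as) zs) ≈ a ^ length zs * total (cartesianProduct as zs)
  total-∷ˡ x as zs x<zs = trans (total-↭ (cartesianProduct-splitˡ (headInterleaving x as) zs))
    (trans (total-++ (cartesianProduct (x ∷ []) zs) _) (*-congʳ (total-row x<zs)))

  total-∷ʳ : ∀ {n} (x : Fin n) as zs → All (x Fin.<_) as →
    total (cartesianProduct as (x ∷ zs)) ≈ b ^ length as * total (cartesianProduct as zs)
  total-∷ʳ x as zs x<as = trans (total-↭ (cartesianProduct-splitʳ (headInterleaving x zs) as))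
    (trans (total-++ (cartesianProduct as (x ∷ [])) _) (*-congʳ (total-column x<as)))

  -- The first element is the smallest. Placed in `A`, it has an ascent to every element of `Z`;
  -- placed in `Z`, it receives a descent from every element of `A`. This is the recursion of
  -- `gaussSum`.
  splitSum-total : ∀ {n} {xs : List (Fin n)} → Increasing xs → ∀ f →
    splitSum xs (λ A Z → total (cartesianProduct A Z) * f (length A) (length Z)) ≈ Gauss.gaussSum (length xs) f
  splitSum-total {xs = []}     []           f = *-identityˡ _
  splitSum-total {xs = x ∷ xs} (x< ∷ inc) f = begin
    splitSum xs (λ A Z → total (cartesianProduct (x ∷ A) Z) * f (suc (length A)) (length Z)) +
      splitSum xs (λ A Z → total (cartesianProduct A (x ∷ Z)) * f (length A) (suc (length Z)))
      ≈⟨ splitSum-+ xs _ _ ⟨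
    splitSum xs (λ A Z → total (cartesianProduct (x ∷ A) Z) * f (suc (length A)) (length Z) +
                         total (cartesianProduct A (x ∷ Z)) * f (length A) (suc (length Z)))
      ≈⟨ splitSum-cong xs (λ {A} {Z} s → trans (+-cong
           (*-congʳ (total-∷ˡ x A Z (All.tabulate λ z∈ → All.lookup x< (∈-interleavingʳ s z∈))))
           (*-congʳ (total-∷ʳ x A Z (All.tabulate λ a∈ → All.lookup x< (∈-interleavingˡ s a∈)))))
           (solve 5 (λ u v t f g → (u :* t) :* f :+ (v :* t) :* g := t :* (u :* f :+ v :* g)) refl
             (a ^ length Z) (b ^ length A) (total (cartesianProduct A Z)) (f (suc (length A)) (length Z)) (f (length A) (suc (length Z))))) ⟩
    splitSum xs (λ A Z → total (cartesianProduct A Z) *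
      (a ^ length Z * f (suc (length A)) (length Z) + b ^ length A * f (length A) (suc (length Z))))
      ≈⟨ splitSum-total inc (λ k m → a ^ m * f (suc k) m + b ^ k * f k (suc m)) ⟩
    Gauss.gaussSum (suc (length xs)) f ∎

  -- This is (ab) to the power n choose 2, the total weight of all digraphs on [n].
  digraphTotal : ℕ → Carrier
  digraphTotal zero    = 1#
  digraphTotal (suc n) = (a * b) ^ n * digraphTotal n

  total-square : ∀ {n} {xs : List (Fin n)} → Increasing xs → total (cartesianProduct xs xs) ≈ digraphTotal (length xs)
  total-square {xs = []}     []         = refl
  total-square {xs = x ∷ xs} (x< ∷ inc) = begin
    total (cartesianProduct (x ∷ xs) (x ∷ xs))
      ≈⟨ total-↭ (cartesianProduct-splitˡ (headInterleaving x xs) (x ∷ xs)) ⟩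
    total (cartesianProduct (x ∷ []) (x ∷ xs) ++ cartesianProduct xs (x ∷ xs))
      ≈⟨ total-++ (cartesianProduct (x ∷ []) (x ∷ xs)) _ ⟩
    (1# + weight (x , x)) * total (cartesianProduct (x ∷ []) xs) * total (cartesianProduct xs (x ∷ xs))
      ≈⟨ *-cong (*-cong (trans (+-congˡ (reflexive (weight-loop x))) (+-identityʳ 1#)) (total-row x<))
           (trans (total-∷ʳ x xs xs x<) (*-congˡ (total-square inc))) ⟩
    1# * a ^ length xs * (b ^ length xs * digraphTotal (length xs))
      ≈⟨ trans (*-congʳ (*-identityˡ _)) (sym (*-assoc _ _ _)) ⟩
    a ^ length xs * b ^ length xs * digraphTotal (length xs)
      ≈⟨ *-congʳ (^-distrib-* a b (length xs)) ⟨
    digraphTotal (suc (length xs)) ∎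

  signSum-step : ∀ {n} {v : Fin n} {xs} → Increasing (v ∷ xs) →
    (∀ {zs} → Increasing zs → length zs ≤ length xs → signSum zs ≈ signNumber (length zs)) →
    signSum (v ∷ xs) ≈ - Subsets.gaussSum (length xs) (λ k m → strongNumber (suc k) * signNumber m)
  signSum-step {n} {v} {xs} inc hyp = trans (signSum-∷ v xs (increasing⇒unique inc)) (-‿cong (trans
    (splitSum-cong xs λ s → *-cong
      (strongSum-increasing (AllPairs-interleavingˡ (consˡ s) inc))
      (hyp (AllPairs-interleavingʳ (consˡ s) inc) (interleaving-lengthʳ s)))
    (splitSum-length xs (λ k m → strongNumber (suc k) * signNumber m))))

  -- The right side of `signSum-step` sees a list only through its length. It is applied both to
  -- `xs` and to `allFin` of that length, by induction on a bound for the length.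
  signSum-increasing : ∀ {n} {xs : List (Fin n)} → Increasing xs → signSum xs ≈ signNumber (length xs)
  signSum-increasing {xs = xs} = go (length xs) ℕ.≤-refl
    where
    go : ∀ l {n} {xs : List (Fin n)} → length xs ≤ l → Increasing xs → signSum xs ≈ signNumber (length xs)
    go l       {xs = []}     _        _   = refl
    go (suc l) {xs = x ∷ xs} (s≤s xs≤l) inc = trans
      (signSum-step inc λ inc′ zs≤xs → go l (ℕ.≤-trans zs≤xs xs≤l) inc′)
      (sym (trans (signSum-step (allFin-increasing (suc (length xs)))
             λ inc′ zs≤ → go l (ℕ.≤-trans zs≤ (ℕ.≤-trans (ℕ.≤-reflexive len) xs≤l)) inc′)
        (reflexive (≡.cong (λ n → - Subsets.gaussSum n (λ k m → strongNumber (suc k) * signNumber m)) len))))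
      where
      len : length (tabulate {n = length xs} Fin.suc) ≡ length xs
      len = List.length-tabulate Fin.suc

  signNumber-suc : ∀ n →
    signNumber (suc n) ≈ - Subsets.gaussSum n (λ k m → strongNumber (suc k) * signNumber m)
  signNumber-suc n = trans (signSum-step (allFin-increasing (suc n)) λ inc _ → signSum-increasing inc)
    (reflexive (≡.cong (λ n → - Subsets.gaussSum n (λ k m → strongNumber (suc k) * signNumber m))
      (List.length-tabulate {n = n} Fin.suc)))

  -- This is the cancellation on [n + 1] with all factors expressed by sizes; the edges from A to
  -- its complement become the weights of `gaussSum`.
  signNumber-gaussSum : ∀ n → Gauss.gaussSum (suc n) (λ k m → signNumber k * digraphTotal m) ≈ 0#
  signNumber-gaussSum n = begin
    Gauss.gaussSum (suc n) (λ k m → signNumber k * digraphTotal m)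
      ≡⟨ ≡.cong (λ l → Gauss.gaussSum l (λ k m → signNumber k * digraphTotal m)) (List.length-tabulate {n = suc n} (λ i → i)) ⟨
    Gauss.gaussSum (length (allFin (suc n))) (λ k m → signNumber k * digraphTotal m)
      ≈⟨ splitSum-total (allFin-increasing (suc n)) (λ k m → signNumber k * digraphTotal m) ⟨
    splitSum (allFin (suc n)) (λ A Z → total (cartesianProduct A Z) * (signNumber (length A) * digraphTotal (length Z)))
      ≈⟨ splitSum-cong (allFin (suc n)) (λ {A} {Z} s → trans
           (solve 3 (λ x y z → x :* (y :* z) := y :* (x :* z)) refl
             (total (cartesianProduct A Z)) (signNumber (length A)) (digraphTotal (length Z)))
           (*-cong (sym (signSum-increasing (AllPairs-interleavingˡ s (allFin-increasing (suc n)))))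
             (*-congˡ (sym (total-square (AllPairs-interleavingʳ s (allFin-increasing (suc n)))))))) ⟩
    splitSum (allFin (suc n)) (λ A Z → signSum A * (total (cartesianProduct A Z) * total (cartesianProduct Z Z)))
      ≈⟨ sourceSum-total Fin.zero (tabulate Fin.suc) (increasing⇒unique (allFin-increasing (suc n))) ⟩
    0# ∎

-- The series of signs, its logarithm and the inverse of D.

module LogarithmOfSigns (R : CommutativeRing 0ℓ 0ℓ) (asc desc : CommutativeRing.Carrier R)
  (inv : ℕ → CommutativeRing.Carrier R)
  (inv-correct : ∀ n → CommutativeRing._≈_ R (CommutativeRing._*_ R (RingTools.fromℕ R (suc n)) (inv n)) (CommutativeRing.1# R))
  (F⁻¹ : ℕ → CommutativeRing.Carrier R)
  (F⁻¹-correct : ∀ n → CommutativeRing._≈_ R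
    (CommutativeRing._*_ R (GaussianSums.factorial R (CommutativeRing._+_ R (CommutativeRing.1# R) asc)
      (CommutativeRing._+_ R (CommutativeRing.1# R) desc) n) (F⁻¹ n)) (CommutativeRing.1# R)) where
  open RingTools R
  open PowerSeries R
  open Chains R asc desc

  F : ℕ → Carrier
  F = Gauss.factorial

  natFactorial inverseFactorial : ℕ → Carrier
  natFactorial zero    = 1#
  natFactorial (suc n) = natFactorial n * fromℕ (suc n)
  inverseFactorial zero    = 1#
  inverseFactorial (suc n) = inverseFactorial n * inv n

  inverseFactorial-correct : ∀ n → natFactorial n * inverseFactorial n ≈ 1#
  inverseFactorial-correct zero    = *-identityˡ 1#
  inverseFactorial-correct (suc n) = begin
    natFactorial n * fromℕ (suc n) * (inverseFactorial n * inv n)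
      ≈⟨ solve 4 (λ a b c d → a :* b :* (c :* d) := (a :* c) :* (b :* d)) refl _ _ _ _ ⟩
    (natFactorial n * inverseFactorial n) * (fromℕ (suc n) * inv n)
      ≈⟨ *-cong (inverseFactorial-correct n) (inv-correct n) ⟩
    1# * 1#
      ≈⟨ *-identityˡ 1# ⟩
    1# ∎

  factorial-fromℕ : ∀ n → Subsets.factorial n ≈ natFactorial n
  factorial-fromℕ zero    = refl
  factorial-fromℕ (suc n) = *-cong (factorial-fromℕ n) (bracket-fromℕ (suc n))
    where
    bracket-fromℕ : ∀ n → Subsets.bracket n ≈ fromℕ n
    bracket-fromℕ zero    = refl
    bracket-fromℕ (suc n) = trans (+-comm _ _) (+-cong (1^n≈1 n) (trans (*-identityˡ _) (bracket-fromℕ n)))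

  -- `F n` stands for the q-factorial times a to the power n choose 2. Hence `D` has the
  -- coefficients of the series D(x), and `inverseD` is the image of `signSeries` under Δ.
  signSeries strongSeries inverseD D : ℕ → Carrier
  signSeries   n = signNumber n * inverseFactorial n
  strongSeries n = strongNumber n * inverseFactorial n
  inverseD     n = signNumber n * F⁻¹ n
  D            n = digraphTotal n * F⁻¹ n

  -- Multiplication by the unit `F (suc n)` turns the coefficient into the Gaussian sum that
  -- vanishes.
  inverseD-correct : (inverseD ⊛ D) S.≈ S.1#
  inverseD-correct zero = begin
    (1# * F⁻¹ 0) * (1# * F⁻¹ 0)
      ≈⟨ *-cong (F⁻¹-correct 0) (F⁻¹-correct 0) ⟩
    1# * 1#
      ≈⟨ *-identityˡ 1# ⟩
    1# ∎
  inverseD-correct (suc n) = IsUnit-cancelˡ {F (suc n)} _ 0# (F⁻¹ (suc n) , F⁻¹-correct (suc n)) (begin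
    F (suc n) * (inverseD ⊛ D) (suc n)
      ≈⟨ Gauss.gaussSum-conv (suc n) (λ k m → inverseD k * D m) ⟨
    Gauss.gaussSum (suc n) (λ k m → (F k * F m) * (inverseD k * D m))
      ≈⟨ Gauss.gaussSum-cong (suc n) (λ k m _ → trans
           (solve 6 (λ a b c d e f → (a :* b) :* ((c :* d) :* (e :* f)) := (a :* d) :* (b :* f) :* (c :* e)) refl
             (F k) (F m) (signNumber k) (F⁻¹ k) (digraphTotal m) (F⁻¹ m))
           (trans (*-congʳ (trans (*-cong (F⁻¹-correct k) (F⁻¹-correct m)) (*-identityˡ 1#))) (*-identityˡ _))) ⟩
    Gauss.gaussSum (suc n) (λ k m → signNumber k * digraphTotal m)
      ≈⟨ signNumber-gaussSum n ⟩
    0#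
      ≈⟨ zeroʳ _ ⟨
    F (suc n) * 0# ∎)

  inverseFactorial-suc : ∀ n x → fromℕ (suc n) * (x * inverseFactorial (suc n)) ≈ x * inverseFactorial n
  inverseFactorial-suc n x = begin
    fromℕ (suc n) * (x * (inverseFactorial n * inv n))
      ≈⟨ solve 4 (λ a b c d → a :* (b :* (c :* d)) := (a :* d) :* (b :* c)) refl _ _ _ _ ⟩
    (fromℕ (suc n) * inv n) * (x * inverseFactorial n)
      ≈⟨ trans (*-congʳ (inv-correct n)) (*-identityˡ _) ⟩
    x * inverseFactorial n ∎

  -- The component of the first vertex has k further vertices, chosen among n. The shift from k to k
  -- + 1 is the derivative of `strongSeries`.
  ∂-signSeries : ∂ signSeries S.≈ ((S.- ∂ strongSeries) ⊛ signSeries)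
  ∂-signSeries n = begin
    ∂ signSeries n
      ≈⟨ inverseFactorial-suc n _ ⟩
    signNumber (suc n) * inverseFactorial n
      ≈⟨ *-congʳ (trans (signNumber-suc n) (-‿cong (trans (Subsets.gaussSum-cong n term) (Subsets.gaussSum-conv n _)))) ⟩
    - (Subsets.factorial n * conv n (λ k m → ∂ strongSeries k * signSeries m)) * inverseFactorial n
      ≈⟨ -‿distribˡ-* _ _ ⟨
    - (Subsets.factorial n * conv n (λ k m → ∂ strongSeries k * signSeries m) * inverseFactorial n)
      ≈⟨ -‿cong (trans (solve 3 (λ a b c → a :* b :* c := a :* c :* b) refl _ _ _)
           (trans (*-congʳ (trans (*-congʳ (factorial-fromℕ n)) (inverseFactorial-correct n))) (*-identityˡ _))) ⟩
    - conv n (λ k m → ∂ strongSeries k * signSeries m)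
      ≈⟨ conv-neg n _ ⟨
    conv n (λ k m → - (∂ strongSeries k * signSeries m))
      ≈⟨ conv-cong n (λ k m _ → -‿distribˡ-* _ _) ⟩
    ((S.- ∂ strongSeries) ⊛ signSeries) n ∎
    where
    term : ∀ k m → k ℕ.+ m ≡ n → strongNumber (suc k) * signNumber m ≈
      (Subsets.factorial k * Subsets.factorial m) * (∂ strongSeries k * signSeries m)
    term k m _ = sym (begin
      (Subsets.factorial k * Subsets.factorial m) * (∂ strongSeries k * signSeries m)
        ≈⟨ *-cong (*-cong (factorial-fromℕ k) (factorial-fromℕ m)) (*-congʳ (inverseFactorial-suc k _)) ⟩
      (natFactorial k * natFactorial m) * ((strongNumber (suc k) * inverseFactorial k) * (signNumber m * inverseFactorial m))
        ≈⟨ solve 6 (λ a b c d e f → (a :* b) :* ((c :* d) :* (e :* f)) := (a :* d) :* (b :* f) :* (c :* e)) refl _ _ _ _ _ _ ⟩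
      (natFactorial k * inverseFactorial k) * (natFactorial m * inverseFactorial m) * (strongNumber (suc k) * signNumber m)
        ≈⟨ trans (*-congʳ (trans (*-cong (inverseFactorial-correct k) (inverseFactorial-correct m)) (*-identityˡ 1#))) (*-identityˡ _) ⟩
      strongNumber (suc k) * signNumber m ∎)

  signSeries-1 : ℕ → Carrier
  signSeries-1 zero    = signSeries 0 + - 1#
  signSeries-1 (suc n) = signSeries (suc n)

  signSeries₀ : signSeries 0 ≈ 1#
  signSeries₀ = *-identityˡ 1#

  signSeries-1₀ : signSeries-1 0 ≈ 0#
  signSeries-1₀ = trans (+-congʳ signSeries₀) (-‿inverseʳ 1#)

  open Logarithm signSeries-1 signSeries-1₀ inv inv-correct using (log1+; ∂-log1+)

  -- Both sides have the same derivative and n + 1 is a unit. The index 0 must stay out: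
  -- `strongNumber 0` is 1, as the empty digraph is strong, whereas S has no constant term.
  log-signSeries : ∀ n → log1+ (suc n) ≈ - strongSeries (suc n)
  log-signSeries n = IsUnit-cancelˡ _ _ (inv n , inv-correct n) (begin
    ∂ log1+ n                    ≈⟨ ⊛-cancelʳ signSeries₀ derivatives n ⟩
    - ∂ strongSeries n           ≈⟨ -‿distribʳ-* _ _ ⟩
    fromℕ (suc n) * - strongSeries (suc n) ∎)
    where
    1+signSeries-1 : (S.1# S.+ signSeries-1) S.≈ signSeries
    1+signSeries-1 zero    = trans (+-congˡ signSeries-1₀) (trans (+-identityʳ 1#) (sym signSeries₀))
    1+signSeries-1 (suc n) = +-identityˡ _
    derivatives : (∂ log1+ ⊛ signSeries) S.≈ ((S.- ∂ strongSeries) ⊛ signSeries)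
    derivatives = S.trans (S.*-comm (∂ log1+) signSeries) (S.trans (S.*-congʳ (S.sym 1+signSeries-1))
      (S.trans ∂-log1+ ∂-signSeries))

-- Fractions with unit denominator as elements of the ring.

-- The coefficient of u²y in `d *P w` with its sums unfolded, where `y`, `x`, `z` stand for 2, 1, 0.
expand : (d w : P) (x y z : ℕ) → ℚ
expand d w x y z =
  ((d z z ℚ.* w y x ℚ.+ d z x ℚ.* w y z) ℚ.+ (d x z ℚ.* w x x ℚ.+ d x x ℚ.* w x z)) ℚ.+ (d y z ℚ.* w z x ℚ.+ d y x ℚ.* w z z)

-- invRev calls a recursive helper that is private to Defs. It is recovered by unification: in the coefficient of
-- u²y, once 0, 1, 2 and the list are abstracted, the unknown is applied to distinct variables only.
module _ (Q : ℚ → Set) (q : ∀ x → Q x) where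
  mutual
    weightedNum weightedDen : Ser → ℕ → List K → P
    weightedNum f j cs = _
    weightedDen f j cs = _

    solveNum : ∀ f n → Q (num (headK (invRev f (suc n))) 2 1)
    solveNum f n with 2 | 1 | 0 | invRev f n
    ... | y | x | z | cs = q (ℚ.- expand (den (f z)) (weightedNum f z cs) x y z)

    solveDen : ∀ f n → Q (den (headK (invRev f (suc n))) 2 1)
    solveDen f n with 2 | 1 | 0 | invRev f n
    ... | y | x | z | cs = q (expand (num (f z)) (weightedDen f z cs) x y z)

weighted : Ser → ℕ → List K → K
weighted f j cs = weightedNum (λ _ → ℚ) (λ x → x) f j cs ⁄ weightedDen (λ _ → ℚ) (λ x → x) f j cs

-- These properties are all that the transfer uses about ℚ⟦u,y⟧. They keep coefficients out of the
-- argument; in the instance, `⟪_⟫` is the identity.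
record Embedding (R : CommutativeRing 0ℓ 0ℓ) : Set where
  open RingTools R
  field
    ⟪_⟫       : P → Carrier
    injective : ∀ {p r} → ⟪ p ⟫ ≈ ⟪ r ⟫ → ∀ a b → p a b ≡ r a b
    +-homo    : ∀ p r → ⟪ p +P r ⟫ ≈ ⟪ p ⟫ + ⟪ r ⟫
    *-homo    : ∀ p r → ⟪ p *P r ⟫ ≈ ⟪ p ⟫ * ⟪ r ⟫
    neg-homo  : ∀ p → ⟪ -P p ⟫ ≈ - ⟪ p ⟫
    0-homo    : ⟪ constP 0ℚ ⟫ ≈ 0#
    1-homo    : ⟪ constP 1ℚ ⟫ ≈ 1#
    ℕ-homo    : ∀ n → ⟪ constP (ℕtoℚ n) ⟫ ≈ fromℕ n

    u y       : Carrier
    monomial-1 : ⟪ monoP 0 0 ⟫ ≈ 1#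
    monomial-u : ∀ i j → ⟪ monoP (suc i) j ⟫ ≈ u * ⟪ monoP i j ⟫
    monomial-y : ∀ i j → ⟪ monoP i (suc j) ⟫ ≈ y * ⟪ monoP i j ⟫
    ℕ-unit       : ∀ n → IsUnit (fromℕ (suc n))
    ascent-unit  : IsUnit (1# + y)
    bracket-unit : ∀ n → IsUnit (GaussianSums.bracket R (1# + y) (1# + u * y) (suc n))

  monomial : ∀ i j → ⟪ monoP i j ⟫ ≈ u ^ i * y ^ j
  monomial zero    zero    = trans monomial-1 (sym (*-identityˡ 1#))
  monomial zero    (suc j) = trans (monomial-y 0 j) (trans (*-congˡ (monomial 0 j))
    (trans (*-congˡ (*-identityˡ _)) (sym (*-identityˡ _))))
  monomial (suc i) j       = trans (monomial-u i j) (trans (*-congˡ (monomial i j)) (sym (*-assoc _ _ _)))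

  asc desc : Carrier
  asc = y
  desc = u * y

module Transport (R : CommutativeRing 0ℓ 0ℓ) (embedding : Embedding R) where
  open RingTools R
  open PowerSeries R
  open Embedding embedding
  open Chains R asc desc

  infix 4 _∼_
  -- The value of the fraction is `p`. A unit denominator survives every operation, including `invK`
  -- at a unit value, and it rules out the zero denominators that spoil `≈K`.
  record _∼_ (x : K) (p : Carrier) : Set where
    constructor represents
    field
      fraction : ⟪ num x ⟫ ≈ p * ⟪ den x ⟫
      den-unit : IsUnit ⟪ den x ⟫

  ∼-resp : ∀ {x p r} → p ≈ r → x ∼ p → x ∼ r
  ∼-resp p≈r (represents eq unit) = represents (trans eq (*-congʳ p≈r)) unit

  ∼⇒≈K : ∀ {x z p r} → x ∼ p → z ∼ r → p ≈ r → x ≈K z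
  ∼⇒≈K {x} {z} {p} {r} (represents eq _) (represents eq′ _) p≈r = injective (begin
    ⟪ num x *P den z ⟫             ≈⟨ *-homo _ _ ⟩
    ⟪ num x ⟫ * ⟪ den z ⟫          ≈⟨ *-congʳ eq ⟩
    p * ⟪ den x ⟫ * ⟪ den z ⟫      ≈⟨ *-congʳ (*-congʳ p≈r) ⟩
    r * ⟪ den x ⟫ * ⟪ den z ⟫      ≈⟨ solve 3 (λ a b c → a :* b :* c := a :* c :* b) refl _ _ _ ⟩
    r * ⟪ den z ⟫ * ⟪ den x ⟫      ≈⟨ *-congʳ eq′ ⟨
    ⟪ num z ⟫ * ⟪ den x ⟫          ≈⟨ *-homo _ _ ⟨
    ⟪ num z *P den x ⟫             ∎)

  fromP-∼ : ∀ p → fromP p ∼ ⟪ p ⟫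
  fromP-∼ p = represents (sym (trans (*-congˡ 1-homo) (*-identityʳ _))) (IsUnit-resp (sym 1-homo) (1# , *-identityˡ 1#))

  0K-∼ : 0K ∼ 0#
  0K-∼ = ∼-resp 0-homo (fromP-∼ _)

  1K-∼ : 1K ∼ 1#
  1K-∼ = ∼-resp 1-homo (fromP-∼ _)

  ℕtoK-∼ : ∀ n → ℕtoK n ∼ fromℕ n
  ℕtoK-∼ n = ∼-resp (ℕ-homo n) (fromP-∼ _)

  uK-∼ : uK ∼ u
  uK-∼ = ∼-resp (trans (monomial 1 0) (trans (*-identityʳ _) (*-identityʳ u))) (fromP-∼ _)

  yK-∼ : yK ∼ y
  yK-∼ = ∼-resp (trans (monomial 0 1) (trans (*-identityˡ _) (*-identityʳ y))) (fromP-∼ _)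

  *-unit : ∀ p r → IsUnit ⟪ p ⟫ → IsUnit ⟪ r ⟫ → IsUnit ⟪ p *P r ⟫
  *-unit p r p-unit r-unit = IsUnit-resp (sym (*-homo p r)) (IsUnit-* p-unit r-unit)

  +K-∼ : ∀ {x z p r} → x ∼ p → z ∼ r → (x +K z) ∼ (p + r)
  +K-∼ {x} {z} {p} {r} (represents eq unit) (represents eq′ unit′) = represents (begin
    ⟪ (num x *P den z) +P (num z *P den x) ⟫
      ≈⟨ trans (+-homo _ _) (+-cong (*-homo _ _) (*-homo _ _)) ⟩
    ⟪ num x ⟫ * ⟪ den z ⟫ + ⟪ num z ⟫ * ⟪ den x ⟫
      ≈⟨ +-cong (*-congʳ eq) (*-congʳ eq′) ⟩
    p * ⟪ den x ⟫ * ⟪ den z ⟫ + r * ⟪ den z ⟫ * ⟪ den x ⟫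
      ≈⟨ solve 4 (λ p r a b → p :* a :* b :+ r :* b :* a := (p :+ r) :* (a :* b)) refl _ _ _ _ ⟩
    (p + r) * (⟪ den x ⟫ * ⟪ den z ⟫)
      ≈⟨ *-congˡ (*-homo _ _) ⟨
    (p + r) * ⟪ den x *P den z ⟫ ∎) (*-unit _ _ unit unit′)

  *K-∼ : ∀ {x z p r} → x ∼ p → z ∼ r → (x *K z) ∼ (p * r)
  *K-∼ {x} {z} {p} {r} (represents eq unit) (represents eq′ unit′) = represents (begin
    ⟪ num x *P num z ⟫                       ≈⟨ trans (*-homo _ _) (*-cong eq eq′) ⟩
    (p * ⟪ den x ⟫) * (r * ⟪ den z ⟫)        ≈⟨ solve 4 (λ p r a b → (p :* a) :* (r :* b) := (p :* r) :* (a :* b)) refl _ _ _ _ ⟩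
    (p * r) * (⟪ den x ⟫ * ⟪ den z ⟫)        ≈⟨ *-congˡ (*-homo _ _) ⟨
    (p * r) * ⟪ den x *P den z ⟫             ∎) (*-unit _ _ unit unit′)

  -K-∼ : ∀ {x p} → x ∼ p → (-K x) ∼ (- p)
  -K-∼ (represents eq unit) = represents (trans (neg-homo _) (trans (-‿cong eq) (-‿distribˡ-* _ _))) unit

  invK-∼ : ∀ {x p r} → x ∼ p → p * r ≈ 1# → invK x ∼ r
  invK-∼ {x} {p} {r} (represents eq unit) pr≈1 = represents (begin
    ⟪ den x ⟫               ≈⟨ trans (*-congʳ pr≈1) (*-identityˡ _) ⟨
    (p * r) * ⟪ den x ⟫     ≈⟨ solve 3 (λ p r d → (p :* r) :* d := r :* (p :* d)) refl p r ⟪ den x ⟫ ⟩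
    r * (p * ⟪ den x ⟫)     ≈⟨ *-congˡ eq ⟨
    r * ⟪ num x ⟫           ∎) (IsUnit-resp (sym eq) (IsUnit-* (r , pr≈1) unit))

  /K-∼ : ∀ {x z p r s} → x ∼ p → z ∼ r → r * s ≈ 1# → (x /K z) ∼ (p * s)
  /K-∼ x∼p z∼r rs≈1 = *K-∼ x∼p (invK-∼ z∼r rs≈1)

  powK-∼ : ∀ {x p} → x ∼ p → ∀ n → powK x n ∼ (p ^ n)
  powK-∼ x∼p zero    = 1K-∼
  powK-∼ x∼p (suc n) = *K-∼ x∼p (powK-∼ x∼p n)

  sumToK-∼ : ∀ n {f p} → (∀ i → f i ∼ p i) → sumToK n f ∼ sumTo n p
  sumToK-∼ zero    f∼p = f∼p 0
  sumToK-∼ (suc n) f∼p = +K-∼ (sumToK-∼ n f∼p) (f∼p (suc n))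

  sumBelowK-∼ : ∀ n {f p} → (∀ i → f i ∼ p i) → sumBelowK n f ∼ sumBelow n p
  sumBelowK-∼ zero    f∼p = 0K-∼
  sumBelowK-∼ (suc n) f∼p = +K-∼ (sumBelowK-∼ n f∼p) (f∼p n)

  _∼S_ : Ser → (ℕ → Carrier) → Set
  f ∼S p = ∀ n → f n ∼ p n

  *S-∼ : ∀ {f g p r} → f ∼S p → g ∼S r → (f *S g) ∼S (p ⊛ r)
  *S-∼ {p = p} {r} f∼p g∼r n = ∼-resp (sumTo-conv n (λ i j → p i * r j))
    (sumToK-∼ n λ i → *K-∼ (f∼p i) (g∼r (n ℕ.∸ i)))

  powS-∼ : ∀ {f p} → f ∼S p → ∀ k → powS f k ∼S (p S.^ k)
  powS-∼ f∼p zero    zero    = 1K-∼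
  powS-∼ f∼p zero    (suc n) = 0K-∼
  powS-∼ f∼p (suc k) = *S-∼ f∼p (powS-∼ f∼p k)

  inv : ℕ → Carrier
  inv n = proj₁ (ℕ-unit n)

  inv-correct : ∀ n → fromℕ (suc n) * inv n ≈ 1#
  inv-correct n = proj₂ (ℕ-unit n)

  F-unit : ∀ n → IsUnit (Gauss.factorial n)
  F-unit zero    = 1# , *-identityˡ 1#
  F-unit (suc n) = IsUnit-* (F-unit n) (bracket-unit n)

  F⁻¹ : ℕ → Carrier
  F⁻¹ n = proj₁ (F-unit n)

  F⁻¹-correct : ∀ n → Gauss.factorial n * F⁻¹ n ≈ 1#
  F⁻¹-correct n = proj₂ (F-unit n)

  open LogarithmOfSigns R asc desc inv inv-correct F⁻¹ F⁻¹-correct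

  module _ {f : Ser} (z : ℕ → Carrier) (z₀ : z 0 ≈ 0#) (f-1∼z : minusOneS f ∼S z) where

    logS-∼ : logS f ∼S Logarithm.log1+ z z₀ inv inv-correct
    logS-∼ n = sumBelowK-∼ n λ k → *K-∼
      (/K-∼ (powK-∼ (-K-∼ 1K-∼) k) (ℕtoK-∼ (suc k)) (inv-correct k)) (powS-∼ f-1∼z (suc k) n)

  module _ {f : Ser} {d g : ℕ → Carrier} (f∼d : f ∼S d) (g⊛d≈1 : (g ⊛ d) S.≈ S.1#) where

    -- The values g n, …, g 0 held by the list invRev f n.
    data Values : ℕ → List K → Set where
      [_] : ∀ {x} → x ∼ g 0 → Values 0 (x ∷ [])
      _∷_ : ∀ {n x xs} → x ∼ g (suc n) → Values n xs → Values (suc n) (x ∷ xs)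

    -- The list runs down from `g n` to `g 0` while the coefficients of `f` run up from `suc j`,
    -- which makes an antidiagonal sum. The offset `j` serves the induction.
    weighted-∼ : ∀ {n xs} j → Values n xs → weighted f j xs ∼ conv n (λ i k → d (suc (j ℕ.+ i)) * g k)
    weighted-∼ {zero}  j [ x∼ ] = ∼-resp (trans (+-identityʳ _) (*-congʳ (reflexive (≡.cong (λ i → d (suc i)) (≡.sym (ℕ.+-identityʳ j))))))
      (+K-∼ (*K-∼ (f∼d (suc j)) x∼) 0K-∼)
    weighted-∼ {suc n} j (x∼ ∷ xs∼) = ∼-resp
      (+-cong (*-congʳ (reflexive (≡.cong (λ i → d (suc i)) (≡.sym (ℕ.+-identityʳ j)))))
        (conv-cong n λ i k _ → *-congʳ (reflexive (≡.cong (λ i → d (suc i)) (≡.sym (ℕ.+-suc j i))))))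
      (+K-∼ (*K-∼ (f∼d (suc j)) x∼) (weighted-∼ (suc j) xs∼))

    d₀g₀≈1 : d 0 * g 0 ≈ 1#
    d₀g₀≈1 = trans (*-comm _ _) (g⊛d≈1 0)

    recursion : ∀ n → - (g 0 * conv n (λ i k → d (suc i) * g k)) ≈ g (suc n)
    recursion n = begin
      - (g 0 * c)                       ≈⟨ -‿distribʳ-* _ _ ⟩
      -- The coefficient of index n + 1 in the product is `d 0 * g (suc n)` plus `c`, and it is 0.
      g 0 * - c                         ≈⟨ *-congˡ (sym (-‿uniqueˡ _ _ (trans (S.*-comm d g (suc n)) (g⊛d≈1 (suc n))))) ⟩
      g 0 * (d 0 * g (suc n))           ≈⟨ *-assoc _ _ _ ⟨
      (g 0 * d 0) * g (suc n)           ≈⟨ *-congʳ (g⊛d≈1 0) ⟩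
      1# * g (suc n)                    ≈⟨ *-identityˡ _ ⟩
      g (suc n)                         ∎
      where c = conv n (λ i k → d (suc i) * g k)

    invRev-∼ : ∀ n → Values n (invRev f n)
    invRev-∼ zero    = [ invK-∼ (f∼d 0) d₀g₀≈1 ]
    invRev-∼ (suc n) = ∼-resp (recursion n) (-K-∼ (*K-∼ (invK-∼ (f∼d 0) d₀g₀≈1) (weighted-∼ 0 (invRev-∼ n)))) ∷ invRev-∼ n

    headK-∼ : ∀ {n xs} → Values n xs → headK xs ∼ g n
    headK-∼ [ x∼ ]    = x∼
    headK-∼ (x∼ ∷ _) = x∼

    invS-∼ : invS f ∼S g
    invS-∼ n = headK-∼ (invRev-∼ n)

  a⁻¹ q : Carrier
  a⁻¹ = proj₁ ascent-unit
  q = b * a⁻¹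

  qFactorial : ℕ → Carrier
  qFactorial zero    = 1#
  qFactorial (suc n) = qFactorial n * sumBelow (suc n) (q ^_)

  a-∼ : (1K +K yK) ∼ a
  a-∼ = +K-∼ 1K-∼ yK-∼

  b-∼ : (1K +K (uK *K yK)) ∼ b
  b-∼ = +K-∼ 1K-∼ (*K-∼ uK-∼ yK-∼)

  qFactK-∼ : ∀ n → qFactK n ∼ qFactorial n
  qFactK-∼ zero    = 1K-∼
  qFactK-∼ (suc n) = *K-∼ (qFactK-∼ n) (sumBelowK-∼ (suc n) (powK-∼ (/K-∼ b-∼ a-∼ (proj₂ ascent-unit))))

  a^n*q^n : ∀ n → a ^ n * q ^ n ≈ b ^ n
  a^n*q^n n = trans (sym (^-distrib-* a q n)) (^-congˡ n (begin
    a * (b * a⁻¹)   ≈⟨ solve 3 (λ a b c → a :* (b :* c) := (a :* c) :* b) refl a b a⁻¹ ⟩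
    (a * a⁻¹) * b   ≈⟨ *-congʳ (proj₂ ascent-unit) ⟩
    1# * b          ≈⟨ *-identityˡ b ⟩
    b               ∎))

  bracket-qInteger : ∀ n → sumBelow (suc n) (q ^_) * a ^ n ≈ Gauss.bracket (suc n)
  bracket-qInteger zero    = trans (*-identityʳ _) (+-congʳ (sym (zeroʳ a)))
  bracket-qInteger (suc n) = begin
    (sumBelow (suc n) (q ^_) + q ^ suc n) * a ^ suc n
      ≈⟨ solve 4 (λ x y a t → (x :+ y) :* (a :* t) := a :* (x :* t) :+ (a :* t) :* y) refl _ _ a (a ^ n) ⟩
    a * (sumBelow (suc n) (q ^_) * a ^ n) + a ^ suc n * q ^ suc n
      ≈⟨ +-cong (*-congˡ (bracket-qInteger n)) (a^n*q^n (suc n)) ⟩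
    a * Gauss.bracket (suc n) + b ^ suc n ∎

  suc-choose-2 : ∀ n → suc n choose 2 ≡ n ℕ.+ n choose 2
  suc-choose-2 n = ≡.trans (≡.sym (nCk+nC[k+1]≡[n+1]C[k+1] n 1)) (≡.cong (ℕ._+ n choose 2) (nC1≡n n))

  ^-choose-2 : ∀ x n → x ^ (suc n choose 2) ≈ x ^ n * x ^ (n choose 2)
  ^-choose-2 x n = trans (reflexive (≡.cong (x ^_) (suc-choose-2 n))) (^-homo-* x n (n choose 2))

  -- Homogenising the k-th q-integer takes the factor a to the power k - 1, and these multiply to
  -- the power n choose 2. Here lies the origin of the power of 1 + y in Δ.
  factorial-qFactorial : ∀ n → qFactorial n * a ^ (n choose 2) ≈ Gauss.factorial n
  factorial-qFactorial zero    = *-identityˡ 1#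
  factorial-qFactorial (suc n) = begin
    qFactorial n * sumBelow (suc n) (q ^_) * a ^ (suc n choose 2)
      ≈⟨ *-congˡ (^-choose-2 a n) ⟩
    qFactorial n * sumBelow (suc n) (q ^_) * (a ^ n * a ^ (n choose 2))
      ≈⟨ solve 4 (λ f s x c → f :* s :* (x :* c) := (f :* c) :* (s :* x)) refl _ _ _ _ ⟩
    (qFactorial n * a ^ (n choose 2)) * (sumBelow (suc n) (q ^_) * a ^ n)
      ≈⟨ *-cong (factorial-qFactorial n) (bracket-qInteger n) ⟩
    Gauss.factorial n * Gauss.bracket (suc n) ∎

  digraphTotal-choose-2 : ∀ n → b ^ (n choose 2) * a ^ (n choose 2) ≈ digraphTotal n
  digraphTotal-choose-2 zero    = *-identityˡ 1#
  digraphTotal-choose-2 (suc n) = begin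
    b ^ (suc n choose 2) * a ^ (suc n choose 2)
      ≈⟨ *-cong (^-choose-2 b n) (^-choose-2 a n) ⟩
    (b ^ n * b ^ (n choose 2)) * (a ^ n * a ^ (n choose 2))
      ≈⟨ solve 4 (λ s t x y → (s :* t) :* (x :* y) := (x :* s) :* (t :* y)) refl _ _ _ _ ⟩
    (a ^ n * b ^ n) * (b ^ (n choose 2) * a ^ (n choose 2))
      ≈⟨ *-cong (sym (^-distrib-* a b n)) (digraphTotal-choose-2 n) ⟩
    (a * b) ^ n * digraphTotal n ∎

  Dser-∼ : Dser ∼S D
  Dser-∼ n = ∼-resp (trans (sym (*-assoc _ _ _)) (*-congʳ (digraphTotal-choose-2 n)))
    (/K-∼ (powK-∼ b-∼ (n choose 2)) (qFactK-∼ n)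
      (trans (sym (*-assoc _ _ _)) (trans (*-congʳ (factorial-qFactorial n)) (F⁻¹-correct n))))

  natFactorial-fromℕ : ∀ n → fromℕ (n !) ≈ natFactorial n
  natFactorial-fromℕ zero    = +-identityʳ 1#
  natFactorial-fromℕ (suc n) = trans (fromℕ-* (suc n) (n !)) (trans (*-comm _ _) (*-congʳ (natFactorial-fromℕ n)))
    where
    fromℕ-* : ∀ m n → fromℕ (m ℕ.* n) ≈ fromℕ m * fromℕ n
    fromℕ-* zero    n = sym (zeroˡ _)
    fromℕ-* (suc m) n = trans (fromℕ-+ n (m ℕ.* n)) (trans (+-cong (sym (*-identityˡ _)) (fromℕ-* m n)) (sym (distribʳ _ _ _)))

  factorialK-∼ : ∀ n → ℕtoK (n !) ∼ natFactorial n
  factorialK-∼ n = ∼-resp (natFactorial-fromℕ n) (ℕtoK-∼ (n !))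

  δ-∼ : ∀ n → δ n ∼ (natFactorial n * F⁻¹ n)
  δ-∼ n = /K-∼ (factorialK-∼ n) (*K-∼ (qFactK-∼ n) (powK-∼ a-∼ (n choose 2)))
    (trans (*-congʳ (factorial-qFactorial n)) (F⁻¹-correct n))

  -- `δ n` is n! over `F n`, so dividing by it exchanges the factor `F⁻¹ n` of `inverseD n` for
  -- `inverseFactorial n`.
  signSeries-∼ : Δ⁻¹ (invS Dser) ∼S signSeries
  signSeries-∼ n = ∼-resp
    (trans (solve 4 (λ t f g i → (t :* f) :* (g :* i) := (g :* f) :* (t :* i)) refl _ _ _ _)
      (trans (*-congʳ (F⁻¹-correct n)) (*-identityˡ _)))
    (/K-∼ (invS-∼ Dser-∼ inverseD-correct n) (δ-∼ n)
      (trans (solve 4 (λ m f g i → (m :* f) :* (g :* i) := (g :* f) :* (m :* i)) refl _ _ _ _)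
        (trans (*-cong (F⁻¹-correct n) (inverseFactorial-correct n)) (*-identityˡ 1#))))

  minusOneS-∼ : minusOneS (Δ⁻¹ (invS Dser)) ∼S signSeries-1
  minusOneS-∼ zero    = +K-∼ (signSeries-∼ 0) (-K-∼ 1K-∼)
  minusOneS-∼ (suc n) = signSeries-∼ (suc n)

  -log-∼ : ∀ n → (-S (logS (Δ⁻¹ (invS Dser)))) (suc n) ∼ strongSeries (suc n)
  -log-∼ n = ∼-resp (trans (-‿cong (log-signSeries n)) (-‿involutive _))
    (-K-∼ (logS-∼ signSeries-1 signSeries-1₀ minusOneS-∼ (suc n)))

  log-constant-term : (-S (logS (Δ⁻¹ (invS Dser)))) 0 ≈K 0K
  log-constant-term = ∼⇒≈K (-K-∼ 0K-∼) 0K-∼ -0#≈0#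

  strong-coefficient : ∀ n {x} → x ∼ strongNumber (suc n) →
    (x /K ℕtoK (suc n !)) ≈K (-S (logS (Δ⁻¹ (invS Dser)))) (suc n)
  strong-coefficient n x∼ = ∼⇒≈K (/K-∼ x∼ (factorialK-∼ (suc n)) (inverseFactorial-correct (suc n))) (-log-∼ n) refl

-- Adjacency matrices, and the sum over an enumeration of the strong digraphs.

_≟ᴰ_ : ∀ {n} → DecidableEquality (Digraph n)
_≟ᴰ_ = Vec.≡-dec (Vec.≡-dec Bool._≟_)

module StrongDigraphs (n : ℕ) where
  open Walks (Fin._≟_ {n})

  entries : Digraph n → Cfg
  entries M (s , t) = Vec.lookup (Vec.lookup M s) t

  matrix : Cfg → Digraph n
  matrix D = Vec.tabulate λ s → Vec.tabulate λ t → D (s , t)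

  entries-matrix : ∀ D e → entries (matrix D) e ≡ D e
  entries-matrix D (s , t) = ≡.trans
    (≡.cong (λ row → Vec.lookup row t) (Vec.lookup∘tabulate (λ s → Vec.tabulate λ t → D (s , t)) s))
    (Vec.lookup∘tabulate (λ t → D (s , t)) t)

  matrix-unique : ∀ D M → (∀ e → D e ≡ entries M e) → matrix D ≡ M
  matrix-unique D M eq = ≡.trans
    (Vec.tabulate-cong λ s → ≡.trans (Vec.tabulate-cong λ t → eq (s , t)) (Vec.tabulate∘lookup (Vec.lookup M s)))
    (Vec.tabulate∘lookup M)

  path⇒walk : ∀ {D a b} → Path (matrix D) a b → Walk D (allFin n) a b
  path⇒walk []      = done
  path⇒walk (e ∷ p) = step (≡.trans (≡.sym (entries-matrix _ _)) e) (∈-allFin _) (path⇒walk p)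

  walk⇒path : ∀ {D a b} → Walk D (allFin n) a b → Path (matrix D) a b
  walk⇒path done         = []
  walk⇒path (step e _ w) = ≡.trans (entries-matrix _ _) e ∷ walk⇒path w

module StrongWeights (R : CommutativeRing 0ℓ 0ℓ) (embedding : Embedding R) (n : ℕ) where
  open RingTools R
  open Indicators R
  open Embedding embedding
  open Transport R embedding
  open Chains R asc desc
  open Walks (Fin._≟_ {n})
  open StrongDigraphs n
  open Edges {n} using (subsetSum; subsetSum-cong; subsetSum-cong-invariant; subsetSum-+; subsetSum-*ʳ; add; add-same; add-other; ∅)
  open import Data.List.Membership.DecPropositional (_≟ᴰ_ {n}) using (_∈?_)
  open import Data.List.Membership.DecPropositional (Edges._≟ᵉ_ {n}) using () renaming (_∈?_ to _∈ᵉ?_)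

  product : List (Fin n × Fin n) → (Fin n × Fin n → Carrier) → Carrier
  product []       g = 1#
  product (e ∷ es) g = g e * product es g

  product-cong : ∀ es {g h : Fin n × Fin n → Carrier} → (∀ e → g e ≈ h e) → product es g ≈ product es h
  product-cong []       eq = refl
  product-cong (e ∷ es) eq = *-cong (eq e) (product-cong es eq)

  product-* : ∀ es g h → product es g * product es h ≈ product es (λ e → g e * h e)
  product-* []       g h = *-identityˡ 1#
  product-* (e ∷ es) g h = trans
    (solve 4 (λ a b c d → (a :* b) :* (c :* d) := (a :* c) :* (b :* d)) refl _ _ _ _) (*-congˡ (product-* es g h))

  product-++ : ∀ es fs g → product (es ++ fs) g ≈ product es g * product fs g
  product-++ []       fs g = sym (*-identityˡ _)
  product-++ (e ∷ es) fs g = trans (*-congˡ (product-++ es fs g)) (sym (*-assoc _ _ _))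

  ^-sum : ∀ x (c : Fin n → Fin n → ℕ) ss ts →
    x ^ sumℕ (map (λ s → sumℕ (map (c s) ts)) ss) ≈ product (cartesianProduct ss ts) (λ (s , t) → x ^ c s t)
  ^-sum x c []       ts = refl
  ^-sum x c (s ∷ ss) ts = trans (^-homo-* x (sumℕ (map (c s) ts)) _)
    (trans (*-cong (row ts) (^-sum x c ss ts)) (sym (product-++ (map (s ,_) ts) _ _)))
    where
    row : ∀ ts → x ^ sumℕ (map (c s) ts) ≈ product (map (s ,_) ts) (λ (s , t) → x ^ c s t)
    row []       = refl
    row (t ∷ ts) = trans (^-homo-* x (c s t) _) (*-congˡ (row ts))

  allEdges : List (Fin n × Fin n)
  allEdges = cartesianProduct (allFin n) (allFin n)

  factor : Digraph n → Fin n × Fin n → Carrier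
  factor M e = if entries M e then weight {n} e else 1#

  -- A loop would contribute y to the monomial although its `weight` is 0, hence the condition s ≢ t
  -- on edges.
  factor-monomial : ∀ s t e → (e ≡ true → s ≢ t) →
    u ^ (if (if does (t Fin.<? s) then e else false) then 1 else 0) * y ^ (if e then 1 else 0) ≈
    (if e then weight {n} (s , t) else 1#)
  factor-monomial s t false _ with does (t Fin.<? s)
  ... | true  = *-identityˡ 1#
  ... | false = *-identityˡ 1#
  factor-monomial s t true s≢t with Fin.<-cmp s t
  ... | tri< s<t _ _ rewrite weight-asc s<t | dec-false (t Fin.<? s) (ℕ.<-asym s<t) = trans (*-identityˡ _) (*-identityʳ y)
  ... | tri≈ _ s≡t _ = contradiction s≡t (s≢t ≡.refl)
  ... | tri> _ _ t<s rewrite weight-desc t<s | dec-true (t Fin.<? s) t<s = *-cong (*-identityʳ u) (*-identityʳ y)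

  weightK-∼ : ∀ M → Loopless M → weightK M ∼ product allEdges (factor M)
  weightK-∼ M loopless = ∼-resp (begin
    ⟪ monoP (des M) (edges M) ⟫
      ≈⟨ monomial (des M) (edges M) ⟩
    u ^ des M * y ^ edges M
      ≈⟨ *-cong (^-sum u descent (allFin n) (allFin n)) (^-sum y edge (allFin n) (allFin n)) ⟩
    product allEdges (λ (s , t) → u ^ descent s t) * product allEdges (λ (s , t) → y ^ edge s t)
      ≈⟨ product-* allEdges (λ (s , t) → u ^ descent s t) (λ (s , t) → y ^ edge s t) ⟩
    product allEdges (λ (s , t) → u ^ descent s t * y ^ edge s t)
      ≈⟨ product-cong allEdges (λ (s , t) → factor-monomial s t (entries M (s , t)) λ { e ≡.refl → loopless s e }) ⟩
    product allEdges (factor M) ∎) (fromP-∼ _)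
    where
    descent edge : Fin n → Fin n → ℕ
    descent s t = if (if does (t Fin.<? s) then entries M (s , t) else false) then 1 else 0
    edge s t = if entries M (s , t) then 1 else 0

  is : Digraph n → Cfg → Carrier
  is M D = ⟦ matrix D ≟ᴰ M ⟧

  -- An entry outside `es` is never changed again, so a disagreement with `M` there is permanent.
  subsetSum-miss : ∀ M es {D e} → e ∉ es → D e ≢ entries M e → subsetSum es (is M) D ≈ 0#
  subsetSum-miss M []       {D} {e} e∉ D≢M = ⟦⟧-false (matrix D ≟ᴰ M) λ eq →
    D≢M (≡.trans (≡.sym (entries-matrix D e)) (≡.cong (λ M → entries M e) eq))
  subsetSum-miss M (f ∷ es) {D} {e} e∉ D≢M = trans (+-cong
    (subsetSum-miss M es (λ p → e∉ (there p)) D≢M)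
    (trans (*-congˡ (subsetSum-miss M es (λ p → e∉ (there p))
      λ eq → D≢M (≡.trans (≡.sym (add-other D λ e≡f → e∉ (here e≡f))) eq))) (zeroʳ _))) (+-identityʳ 0#)

  -- Exactly one subset of `es` completes `D` to `M`. At each edge the wrong choice is ruled out by
  -- `subsetSum-miss`, as the edge does not recur.
  subsetSum-hit : ∀ M es {D} → Unique es → (∀ {e} → e ∈ es → D e ≡ false) → (∀ {e} → e ∉ es → D e ≡ entries M e) →
    subsetSum es (is M) D ≈ product es (factor M)
  subsetSum-hit M [] {D} _ _ outside = ⟦⟧-true (matrix D ≟ᴰ M) (matrix-unique D M λ e → outside λ ())
  subsetSum-hit M (e ∷ es) {D} (e∉ ∷ unique) inside outside with entries M e in eq
  ... | true = trans (+-cong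
    (subsetSum-miss M es e∉es λ D≡M → true≢false (≡.trans D≡M eq) (inside (here ≡.refl)))
    (*-congˡ (subsetSum-hit M es unique
      (λ {f} f∈ → ≡.trans (add-other D (λ { ≡.refl → e∉es f∈ })) (inside (there f∈)))
      (λ {f} f∉ → extend f f∉)))) (+-identityˡ _)
    where
    e∉es : e ∉ es
    e∉es p = All.lookup e∉ p ≡.refl
    extend : ∀ f → f ∉ es → add e D f ≡ entries M f
    extend f f∉ with f Edges.≟ᵉ e
    ... | yes ≡.refl = ≡.sym eq
    ... | no  f≢e    = outside λ { (here f≡e) → f≢e f≡e ; (there p) → f∉ p }
  ... | false = trans (+-cong
    (subsetSum-hit M es unique (λ p → inside (there p)) (λ {f} f∉ → extend f f∉))
    (trans (*-congˡ (subsetSum-miss M es (λ p → All.lookup e∉ p ≡.refl)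
      λ D≡M → true≢false (≡.trans (≡.sym D≡M) (add-same e D)) eq)) (zeroʳ _)))
    (trans (+-identityʳ _) (sym (*-identityˡ _)))
    where
    extend : ∀ f → f ∉ es → D f ≡ entries M f
    extend f f∉ with f Edges.≟ᵉ e
    ... | yes ≡.refl = ≡.trans (inside (here ≡.refl)) (≡.sym eq)
    ... | no  f≢e    = outside λ { (here f≡e) → f≢e f≡e ; (there p) → f∉ p }

  ∈-allEdges : ∀ e → e ∈ allEdges
  ∈-allEdges (s , t) = ∈-cartesianProduct⁺ (∈-allFin s) (∈-allFin t)

  weightK-subsetSum : ∀ M → Loopless M → weightK M ∼ subsetSum allEdges (is M) ∅
  weightK-subsetSum M loopless = ∼-resp
    (sym (subsetSum-hit M allEdges (Unique.cartesianProduct⁺ (Unique.allFin⁺ n) (Unique.allFin⁺ n))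
      (λ _ → ≡.refl) (λ {e} e∉ → contradiction (∈-allEdges e) e∉)))
    (weightK-∼ M loopless)

  occurrences : List (Digraph n) → Cfg → Carrier
  occurrences []       D = 0#
  occurrences (M ∷ Ms) D = is M D + occurrences Ms D

  occurrences-unique : ∀ {L} → Unique L → ∀ D → occurrences L D ≈ ⟦ matrix D ∈? L ⟧
  occurrences-unique {[]}     _             D = refl
  occurrences-unique {M ∷ Ms} (M∉ ∷ unique) D with matrix D ≟ᴰ M
  ... | yes ≡.refl = trans (+-congˡ (trans (occurrences-unique unique D)
    (⟦⟧-false (matrix D ∈? Ms) λ p → All.lookup M∉ p ≡.refl))) (+-identityʳ 1#)
  ... | no _       = trans (+-identityˡ _) (occurrences-unique unique D)

  sumWeights-∼ : ∀ L → (∀ {M} → M ∈ L → Loopless M) → sumWeights L ∼ subsetSum allEdges (occurrences L) ∅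
  sumWeights-∼ []       _        = ∼-resp (sym (trans
    (subsetSum-cong allEdges (λ _ → sym (zeroʳ 1#)) ∅)
    (trans (subsetSum-*ʳ allEdges (λ _ → 1#) {λ _ → 0#} (λ _ _ → refl) ∅) (zeroʳ _)))) 0K-∼
  sumWeights-∼ (M ∷ Ms) loopless = ∼-resp (sym (subsetSum-+ allEdges (is M) (occurrences Ms) ∅))
    (+K-∼ (weightK-subsetSum M (loopless (here ≡.refl))) (sumWeights-∼ Ms λ p → loopless (there p)))

  -- Both sides are sums over all sets of edges. On loop-free digraphs, membership in `L` and strong
  -- connectivity have the same indicator.
  sumWeights-strongNumber : ∀ L → Unique L → (∀ D → (D ∈ L) ⇔ (Loopless D × StronglyConnected D)) →
    sumWeights L ∼ strongNumber n
  sumWeights-strongNumber L unique characterise = ∼-resp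
    (subsetSum-cong-invariant allEdges NoLoops stable
      (λ {D} noLoops → trans (occurrences-unique unique D) (⟦⟧-cong (matrix D ∈? L) (strong? D (allFin n))
        (λ D∈L _ _ → path⇒walk (proj₂ (Equivalence.to (characterise (matrix D)) D∈L) _ _))
        (λ strong → Equivalence.from (characterise (matrix D))
          ( (λ s loop → true≢false (≡.trans (≡.sym (entries-matrix D (s , s))) loop) (noLoops s))
          , (λ s t → walk⇒path (strong (∈-allFin s) (∈-allFin t)))))))
      (λ _ → ≡.refl))
    (sumWeights-∼ L λ {M} M∈L → proj₁ (Equivalence.to (characterise M) M∈L))
    where
    NoLoops : Cfg → Set
    NoLoops D = ∀ s → D (s , s) ≡ false

    -- Adding a loop leaves NoLoops, but loops have weight 0.
    stable : ∀ {e} → e ∈ allEdges → weight e ≈ 0# ⊎ (∀ {D} → NoLoops D → NoLoops (add e D))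
    stable {s , t} _ with s Fin.≟ t
    ... | yes ≡.refl = inj₁ (reflexive (weight-loop s))
    ... | no  s≢t    = inj₂ λ {D} noLoops v → ≡.trans
      (add-other D λ eq → s≢t (≡.trans (≡.sym (≡.cong proj₁ eq)) (≡.cong proj₂ eq))) (noLoops v)

-- The concrete ring ℚ⟦u,y⟧ as iterated power series.

module ℚ⟦y⟧ = PowerSeries ℚ.+-*-commutativeRing
module ℚ⟦u,y⟧ = PowerSeries ℚ⟦y⟧.ring-PS
module R = RingTools ℚ⟦u,y⟧.ring-PS
module ℚTools = RingTools ℚ.+-*-commutativeRing

-- Addition in ℚ normalises its result, so the identity is checked on unnormalised fractions, where
-- it concerns integers only.
ℕtoℚ-suc : ∀ n → ℕtoℚ (suc n) ≡ 1ℚ ℚ.+ ℕtoℚ n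
ℕtoℚ-suc n = ℚ.toℚᵘ-injective (begin
  ℚ.toℚᵘ (ℕtoℚ (suc n))                      ≈⟨ toℚᵘ-ℕtoℚ (suc n) ⟩
  ℚᵘ.mkℚᵘ (+ suc n) 0                        ≈⟨ ℚᵘ.*≡* (≡.cong (λ k → (+ 1 ℤ.+ k) ℤ.* + 1) (≡.sym (ℤ.*-identityʳ (+ n)))) ⟩
  ℚᵘ.mkℚᵘ (+ 1) 0 ℚᵘ.+ ℚᵘ.mkℚᵘ (+ n) 0       ≈⟨ ℚᵘ.+-congʳ (ℚᵘ.mkℚᵘ (+ 1) 0) (ℚᵘ.≃-sym (toℚᵘ-ℕtoℚ n)) ⟩
  ℚ.toℚᵘ 1ℚ ℚᵘ.+ ℚ.toℚᵘ (ℕtoℚ n)             ≈⟨ ℚᵘ.≃-sym (ℚ.toℚᵘ-homo-+ 1ℚ (ℕtoℚ n)) ⟩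
  ℚ.toℚᵘ (1ℚ ℚ.+ ℕtoℚ n)                     ∎)
  where
  open import Relation.Binary.Reasoning.Setoid ℚᵘ.≃-setoid
  toℚᵘ-ℕtoℚ : ∀ n → ℚ.toℚᵘ (ℕtoℚ n) ℚᵘ.≃ ℚᵘ.mkℚᵘ (+ n) 0
  toℚᵘ-ℕtoℚ n = ℚ.toℚᵘ-fromℚᵘ (ℚᵘ.mkℚᵘ (+ n) 0)

sumToℚ-conv : ∀ n (h : ℕ → ℕ → ℚ) → sumToℚ n (λ i → h i (n ℕ.∸ i)) ≡ ℚTools.conv n h
sumToℚ-conv n h = ≡.trans (sumToℚ-sumTo n (λ i → h i (n ℕ.∸ i))) (ℚTools.sumTo-conv n h)
  where
  sumToℚ-sumTo : ∀ n f → sumToℚ n f ≡ ℚTools.sumTo n f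
  sumToℚ-sumTo zero    f = ≡.refl
  sumToℚ-sumTo (suc n) f = ≡.cong (ℚ._+ f (suc n)) (sumToℚ-sumTo n f)

sumToℚ-cong : ∀ n {f g : ℕ → ℚ} → (∀ i → f i ≡ g i) → sumToℚ n f ≡ sumToℚ n g
sumToℚ-cong zero    eq = eq 0
sumToℚ-cong (suc n) eq = ≡.cong₂ ℚ._+_ (sumToℚ-cong n eq) (eq (suc n))

conv-coeff : ∀ n (h : ℕ → ℕ → ℕ → ℚ) b → ℚ⟦y⟧.S.conv n h b ≡ ℚTools.conv n (λ i j → h i j b)
conv-coeff zero    h b = ≡.refl
conv-coeff (suc n) h b = ≡.cong (h 0 (suc n) b ℚ.+_) (conv-coeff n (λ i j → h (suc i) j) b)

*P-correct : ∀ p r → (p *P r) R.≈ (p R.* r)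
*P-correct p r a b = begin
  sumToℚ a (λ i → sumToℚ b (λ j → p i j ℚ.* r (a ℕ.∸ i) (b ℕ.∸ j)))
    ≡⟨ sumToℚ-cong a (λ i → sumToℚ-conv b (λ j l → p i j ℚ.* r (a ℕ.∸ i) l)) ⟩
  sumToℚ a (λ i → (p i ℚ⟦y⟧.⊛ r (a ℕ.∸ i)) b)
    ≡⟨ sumToℚ-conv a (λ i k → (p i ℚ⟦y⟧.⊛ r k) b) ⟩
  ℚTools.conv a (λ i k → (p i ℚ⟦y⟧.⊛ r k) b)
    ≡⟨ conv-coeff a (λ i k → p i ℚ⟦y⟧.⊛ r k) b ⟨
  (p R.* r) a b ∎
  where open ≡.≡-Reasoning

constP-0 : constP 0ℚ R.≈ R.0#
constP-0 zero    zero    = ≡.refl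
constP-0 zero    (suc b) = ≡.refl
constP-0 (suc a) b       = ≡.refl

constP-1 : constP 1ℚ R.≈ R.1#
constP-1 zero    zero    = ≡.refl
constP-1 zero    (suc b) = ≡.refl
constP-1 (suc a) b       = ≡.refl

constP-ℕ : ∀ n → constP (ℕtoℚ n) R.≈ R.fromℕ n
constP-ℕ zero    = constP-0
constP-ℕ (suc n) = R.trans (constP-suc n) (R.+-cong constP-1 (constP-ℕ n))
  where
  constP-suc : ∀ n → constP (ℕtoℚ (suc n)) R.≈ (constP 1ℚ R.+ constP (ℕtoℚ n))
  constP-suc n zero    zero    = ℕtoℚ-suc n
  constP-suc n zero    (suc b) = ≡.refl
  constP-suc n (suc a) b       = ≡.refl

u y : P
u = ℚ⟦u,y⟧.X
y = ℚ⟦u,y⟧.constant ℚ⟦y⟧.X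

monoP-0-0 : monoP 0 0 R.≈ R.1#
monoP-0-0 zero    zero    = ≡.refl
monoP-0-0 zero    (suc b) = ≡.refl
monoP-0-0 (suc a) b       = ≡.refl

monoP-suc-u : ∀ i j → monoP (suc i) j R.≈ (u R.* monoP i j)
monoP-suc-u i j zero    b = ≡.sym (ℚ⟦u,y⟧.X-⊛-zero (monoP i j) b)
monoP-suc-u i j (suc a) b = ≡.sym (ℚ⟦u,y⟧.X-⊛-suc (monoP i j) a b)

monoP-suc-y : ∀ i j → monoP i (suc j) R.≈ (y R.* monoP i j)
monoP-suc-y i j a b = ≡.trans (shift b) (≡.sym (ℚ⟦u,y⟧.conv-constantˡ a ℚ⟦y⟧.X (monoP i j) b))
  where
  shift : ∀ b → monoP i (suc j) a b ≡ (ℚ⟦y⟧.X ℚ⟦y⟧.⊛ monoP i j a) b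
  shift zero    = ≡.trans no-y (≡.sym (ℚ⟦y⟧.X-⊛-zero (monoP i j a)))
    where
    no-y : monoP i (suc j) a 0 ≡ 0ℚ
    -- `monoP` tests the exponent of u first, so the value 0 appears only after that test is
    -- decided.
    no-y with does (a ℕ.≟ i)
    ... | true  = ≡.refl
    ... | false = ≡.refl
  shift (suc b) = ≡.sym (ℚ⟦y⟧.X-⊛-suc (monoP i j a) b)

-- `unit-series` is used once for u and once for y. Positive integers suffice as constant terms: 1
-- for 1 + y, and n + 1 for the other elements to be inverted.
constant-term-unit : ∀ n p → p 0 0 ≡ ℕtoℚ (suc n) → R.IsUnit p
constant-term-unit n p eq = ℚ⟦u,y⟧.unit-series p (ℚ⟦y⟧.unit-series (p 0)
  (ℚTools.IsUnit-resp (≡.sym eq) (ℚ.1/ ℕtoℚ (suc n) , ℚ.*-inverseʳ (ℕtoℚ (suc n)))))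
  where
  instance
    nonZero : ℚ.NonZero (ℕtoℚ (suc n))
    nonZero = ℚ.pos⇒nonZero (ℕtoℚ (suc n)) {{ℚ.normalize-pos (suc n) 1}}

a b : P
a = R.1# R.+ y
b = R.1# R.+ (u R.* y)

-- Both a and b have constant term 1, so each of the n monomials contributes 1.
bracket-constant-term : ∀ n → GaussianSums.bracket ℚ⟦u,y⟧.ring-PS a b n 0 0 ≡ ℕtoℚ n
bracket-constant-term zero    = ≡.refl
bracket-constant-term (suc n) = begin
  1ℚ ℚ.* bracket n 0 0 ℚ.+ (b R.^ n) 0 0  ≡⟨ ≡.cong₂ ℚ._+_ (≡.trans (ℚ.*-identityˡ _) (bracket-constant-term n)) (b^n₀₀ n) ⟩
  ℕtoℚ n ℚ.+ 1ℚ                           ≡⟨ ℚ.+-comm (ℕtoℚ n) 1ℚ ⟩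
  1ℚ ℚ.+ ℕtoℚ n                           ≡⟨ ℕtoℚ-suc n ⟨
  ℕtoℚ (suc n)                            ∎
  where
  open ≡.≡-Reasoning
  open GaussianSums ℚ⟦u,y⟧.ring-PS a b using (bracket)
  b^n₀₀ : ∀ n → (b R.^ n) 0 0 ≡ 1ℚ
  b^n₀₀ zero    = ≡.refl
  b^n₀₀ (suc n) = ≡.trans (ℚ.*-identityˡ _) (b^n₀₀ n)

embedding : Embedding ℚ⟦u,y⟧.ring-PS
embedding = record
  { ⟪_⟫       = λ p → p
  ; injective = λ eq → eq
  ; +-homo    = λ _ _ → R.refl
  ; *-homo    = *P-correct
  ; neg-homo  = λ _ → R.refl
  ; 0-homo    = constP-0
  ; 1-homo    = constP-1
  ; ℕ-homo    = constP-ℕ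
  ; u         = u
  ; y         = y
  ; monomial-1 = monoP-0-0
  ; monomial-u = monoP-suc-u
  ; monomial-y = monoP-suc-y
  ; ℕ-unit       = λ n → constant-term-unit n (R.fromℕ (suc n)) (≡.sym (constP-ℕ (suc n) 0 0))
  ; ascent-unit  = constant-term-unit 0 a ≡.refl
  ; bracket-unit = λ n → constant-term-unit n (GaussianSums.bracket ℚ⟦u,y⟧.ring-PS a b (suc n)) (bracket-constant-term (suc n))
  }

theorem3p6 : (-S (logS (Δ⁻¹ (invS Dser)))) 0 ≈K 0K
    × ((n : ℕ) → 1 ≤ n → (L : List (Digraph n)) → Unique L
    → (∀ D → (D ∈ L) ⇔ (Loopless D × StronglyConnected D))
    → (sumWeights L /K ℕtoK (n !)) ≈K (-S (logS (Δ⁻¹ (invS Dser)))) n)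
theorem3p6 = log-constant-term , λ { (suc n) _ L unique characterise →
  strong-coefficient n (StrongWeights.sumWeights-strongNumber ℚ⟦u,y⟧.ring-PS embedding (suc n) L unique characterise) }
  where open Transport ℚ⟦u,y⟧.ring-PS embedding
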